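{- If $\le_T^{U}\neq\le_T^{p}$ (as sets of pairs $(A,B)$ with $A\le B$), then $\mathrm{P}\neq\mathrm{NP}$.
   Context: $\le_T^p$ is polynomial-time Turing reducibility. An NPTM is a nondeterministic oracle Turing machine $N$ each of whose computation paths ends in one of three outcomes $\mathbf{acc}$, $\mathbf{rej}$, $\mathbf{?}$, such that there is a polynomial $p$ with: for every oracle $D$ and every input $x$, every computation path of $N^D(x)$ has length at most $p(|x|)$. For an oracle $D$ and input $x$, let $out_{N^D}(x)$ be the set of outcomes occurring on some path of $N^D(x)$; $L(N^D)=\{x:\mathbf{acc}\in out_{N^D}(x)\}$. $N^D(x)$ is underproductive if $\{\mathbf{acc},\mathbf{rej}\}\not\subseteq out_{N^D}(x)$, and overproductive if $out_{N^D}(x)\neq\{\mathbf{?}\}$; $N^D$ is underproductive (overproductive) if $N^D(x)$ is so for every $x$. $N$ is robustly underproductive if $N^D$ is underproductive for every oracle $D$. $A\le_T^{U}B$ if there is an NPTM $N$ that is robustly underproductive, with $N^B$ overproductive, and $A=L(N^B)$. -}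

module Defs where

open import Data.Nat using (ℕ; zero; suc; _+_; _*_; _≤_)
open import Data.Bool using (Bool; true; false; if_then_else_)
open import Data.Fin using (Fin)
open import Data.List using (List; []; _∷_; length; _++_; reverse)
open import Data.List.Membership.Propositional using (_∈_)
open import Data.List.Relation.Unary.All using (All)
open import Data.Maybe using (Maybe; just; nothing)
open import Data.Sum using (_⊎_; inj₁; inj₂)
open import Data.Product using (Σ; ∃; _×_; _,_)
open import Relation.Binary.PropositionalEquality using (_≡_; _≢_)
open import Relation.Nullary using (¬_)
open import Function.Bundles using (_⇔_)

-- Strings, languages, oracles
-- Words are binary strings; a language / oracle is a (classical) set of
-- words, represented by its characteristic function.

Word : Set
Word = List Bool

Lang : Set
Lang = Word → Bool

Poly : Set
Poly = List ℕ

evalP : Poly → ℕ → ℕ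
evalP []       n = 0
evalP (a ∷ as) n = a + n * evalP as n

-- Oracle Turing machines with two two-way infinite tapes:
-- tape 1 = input/work tape, tape 2 = oracle query tape.

data Sym : Set where
  blank : Sym
  bit   : Bool → Sym

data Dir : Set where
  L R S : Dir

record Tape : Set where
  constructor tape
  field
    left  : List Sym   -- cells to the left of the head, nearest first
    here  : Sym
    right : List Sym   -- cells to the right of the head, nearest first

write : Sym → Tape → Tape
write s (tape l _ r) = tape l s r

moveT : Dir → Tape → Tape
moveT L (tape []      h r)       = tape [] blank (h ∷ r)
moveT L (tape (s ∷ l) h r)       = tape l s (h ∷ r)
moveT R (tape l h [])            = tape (h ∷ l) blank []
moveT R (tape l h (s ∷ r))       = tape (h ∷ l) s r
moveT S t                        = t

bitsOf : List Sym → Word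
bitsOf []            = []
bitsOf (blank ∷ ss)  = bitsOf ss
bitsOf (bit b ∷ ss)  = b ∷ bitsOf ss

contents : Tape → Word
contents (tape l h r) = bitsOf (reverse l ++ (h ∷ r))

inputTape : Word → Tape
inputTape []       = tape [] blank []
inputTape (b ∷ bs) = tape [] (bit b) (mapBit bs)
  where
  mapBit : Word → List Sym
  mapBit []       = []
  mapBit (c ∷ cs) = bit c ∷ mapBit cs

emptyTape : Tape
emptyTape = tape [] blank []

data Action (n : ℕ) (O : Set) : Set where
  move : Fin n → Sym → Sym → Dir → Dir → Action n O
  ask  : Fin n → Fin n → Action n O
  halt : O → Action n O

record Config (n : ℕ) : Set where
  constructor cfg
  field
    state : Fin n
    tape₁ : Tape
    tape₂ : Tape

stepAct : ∀ {n O} → Lang → Config n → Action n O → Config n ⊎ O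
stepAct D (cfg q t₁ t₂) (move q' w₁ w₂ d₁ d₂) =
  inj₁ (cfg q' (moveT d₁ (write w₁ t₁)) (moveT d₂ (write w₂ t₂)))
stepAct D (cfg q t₁ t₂) (ask qy qn) =
  inj₁ (cfg (if D (contents t₂) then qy else qn) t₁ t₂)
stepAct D c (halt o) = inj₂ o

record DOTM : Set where
  field
    nst   : ℕ
    start : Fin nst
    δ     : Fin nst → Sym → Sym → Action nst Bool

module _ (M : DOTM) where
  open DOTM M

  initD : Word → Config nst
  initD x = cfg start (inputTape x) emptyTape

  -- run for at most t steps (the halting step counts as a step)
  runD : Lang → Config nst → ℕ → Maybe Bool
  runD D c zero = nothing
  runD D c (suc t) with stepAct D c (δ (Config.state c) (Tape.here (Config.tape₁ c)) (Tape.here (Config.tape₂ c)))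
  ... | inj₁ c' = runD D c' t
  ... | inj₂ b  = just b

PolyTimeD : DOTM → Set
PolyTimeD M = Σ Poly λ p → ∀ (D : Lang) (x : Word) →
  Σ Bool λ b → runD M D (initD M x) (evalP p (length x)) ≡ just b

DecidesWith : DOTM → Poly → Lang → Lang → Set
DecidesWith M p D A = ∀ x → runD M D (initD M x) (evalP p (length x)) ≡ just (A x)

_≤pT_ : Lang → Lang → Set
A ≤pT B = Σ DOTM λ M → Σ Poly λ p →
  (∀ (D : Lang) (x : Word) →
     Σ Bool λ b → runD M D (initD M x) (evalP p (length x)) ≡ just b)
  × DecidesWith M p B A

data Outcome : Set where
  acc rej unk : Outcome

record NOTM : Set where
  field
    nst   : ℕ
    start : Fin nst
    δ     : Fin nst → Sym → Sym → List (Action nst Outcome)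

module _ (N : NOTM) (D : Lang) where
  open NOTM N

  acts : Config nst → List (Action nst Outcome)
  acts c = δ (Config.state c) (Tape.here (Config.tape₁ c)) (Tape.here (Config.tape₂ c))

  mutual
    data HaltsWithin (c : Config nst) : ℕ → Set where
      hw : ∀ {t} → acts c ≢ [] →
           All (λ a → NextHalts t (stepAct D c a)) (acts c) →
           HaltsWithin c (suc t)

    data NextHalts (t : ℕ) : Config nst ⊎ Outcome → Set where
      done : ∀ {o}  → NextHalts t (inj₂ o)
      cont : ∀ {c'} → HaltsWithin c' t → NextHalts t (inj₁ c')

  data Yields (c : Config nst) (o : Outcome) : Set where
    here  : ∀ {a} → a ∈ acts c → stepAct D c a ≡ inj₂ o → Yields c o
    there : ∀ {a c'} → a ∈ acts c → stepAct D c a ≡ inj₁ c' → Yields c' o → Yields c o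

initN : (N : NOTM) → Word → Config (NOTM.nst N)
initN N x = cfg (NOTM.start N) (inputTape x) emptyTape

_∈out_^_[_] : Outcome → NOTM → Lang → Word → Set
o ∈out N ^ D [ x ] = Yields N D (initN N x) o

IsNPTM : NOTM → Set
IsNPTM N = Σ Poly λ p → ∀ (D : Lang) (x : Word) →
  HaltsWithin N D (initN N x) (evalP p (length x))

AcceptsL : NOTM → Lang → Lang → Set
AcceptsL N D A = ∀ x → (A x ≡ true) ⇔ (acc ∈out N ^ D [ x ])

UnderprodAt : NOTM → Lang → Word → Set
UnderprodAt N D x = ¬ ((acc ∈out N ^ D [ x ]) × (rej ∈out N ^ D [ x ]))

OverprodAt : NOTM → Lang → Word → Set
OverprodAt N D x = (acc ∈out N ^ D [ x ]) ⊎ (rej ∈out N ^ D [ x ])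

RobustlyUnderproductive : NOTM → Set
RobustlyUnderproductive N = ∀ (D : Lang) (x : Word) → UnderprodAt N D x

Overproductive : NOTM → Lang → Set
Overproductive N D = ∀ x → OverprodAt N D x

_≤UT_ : Lang → Lang → Set
A ≤UT B = Σ NOTM λ N → IsNPTM N × RobustlyUnderproductive N
  × Overproductive N B × AcceptsL N B A

-- P and NP (machines that ignore the oracle: we use the empty oracle)

∅ : Lang
∅ _ = false

InP : Lang → Set
InP A = Σ DOTM λ M → Σ Poly λ p → DecidesWith M p ∅ A

InNP : Lang → Set
InNP A = Σ NOTM λ N → IsNPTM N × AcceptsL N ∅ A

P≡NP : Set
P≡NP = ∀ (A : Lang) → InP A ⇔ InNP A

≤UT≡≤pT : Set
≤UT≡≤pT = ∀ (A B : Lang) → (A ≤UT B) ⇔ (A ≤pT B)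

{-# OPTIONS --safe #-}
-- Suppose P = NP and let N witness A ≤UT B.  Over a finite table of oracle
-- answers, an accepting and a rejecting run of N on x have a common query unknown
-- to the table, since otherwise both would occur under one oracle, against robust
-- underproductivity.  A machine with oracle B can therefore proceed in rounds:
-- while both kinds of runs exist over the table, it determines, bit by bit, the
-- unknown queries of an accepting run by prefix search with an NP predicate,
-- asks them, and enters the answers into the table.  Each round lowers the
-- number of unknown queries on every rejecting run, so at most p(|x|) + 1 rounds
-- take place, for every oracle.  When no accepting run is left, x is not in A;
-- when no rejecting run is left, x is in A by overproductivity.
--
-- The verifier of the NP predicate and the search are programs over bit stacks,
-- compiled to two-tape machines.  All halting predicates are defined by recursion
-- on the time and take the meaning of a query (by an oracle, all answers, some
-- answer) as a parameter, so that one compiler proof serves deterministic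
-- machines as well as both directions of nondeterministic acceptance.

module Submission where

open import Defs
open import Data.Bool using (Bool; true; false; if_then_else_) renaming (_≟_ to _≟ᵇ_)
open import Data.Empty using (⊥; ⊥-elim)
open import Data.Fin using (Fin; zero; suc; toℕ; fromℕ<; inject₁; splitAt; join)
open import Data.Fin.Properties using (splitAt-join; toℕ-fromℕ<; toℕ-inject₁; toℕ<n; toℕ-injective)
open import Data.List using (List; []; _∷_; length; reverse; map; replicate; foldl; _ʳ++_; _++_; _∷ʳ_)
open import Data.List.Properties hiding (lookup-replicate)
open import Data.List.Membership.DecPropositional (≡-dec _≟ᵇ_) using (_∈?_)
open import Data.List.Membership.Propositional using (_∈_; _∉_)
open import Data.List.Relation.Unary.All as All using (All; []; _∷_)
open import Data.List.Relation.Unary.Any using (Any; any?) renaming (here to ∈-here; there to ∈-there)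
open import Data.Maybe using (Maybe; just; nothing; fromMaybe)
open import Data.Maybe.Properties using (just-injective)
open import Data.Nat using (ℕ; zero; suc; _+_; _*_; _∸_; _≤_; _<_; z≤n; s≤s; s≤s⁻¹; _≡ᵇ_; _≟_)
open import Data.Nat.DivMod using (_%_; m<n⇒m%n≡m; [m+kn]%n≡m%n)
open import Data.Nat.Properties hiding (_≟_)
open import Data.Nat.Solver using (module +-*-Solver)
open import Data.Product using (Σ; ∃; _×_; _,_; proj₁; proj₂)
open import Data.Sum using (_⊎_; inj₁; inj₂; [_,_]′)
open import Data.Unit using (⊤; tt)
open import Data.Vec as Vec using (Vec; []; _∷_; lookup; _[_]≔_; head)
open import Data.Vec.Properties using (lookup∘update; lookup∘update′; lookup-replicate)
open import Function using (_∘_; id; flip)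
open import Function.Bundles using (mk⇔; Equivalence)
open import Relation.Binary.PropositionalEquality
open import Relation.Nullary using (yes; no; ¬_; Dec; does; contradiction)
open import Relation.Nullary.Decidable using (map′; _⊎-dec_)

open Tape using (left; right) renaming (here to scan)

-- The answers guessed in a lazy run may contradict the actual oracle, and this shapes the argument.
-- What the prefix search fixes is the list of queries of an accepting run, without the guessed
-- answers; the true answers are then fetched from the oracle. Accordingly, the progress measure
-- ranges over the rejecting runs under all oracles that agree with the table, not only under the
-- actual one. A reduction `≤pT` has to respect its time bound under every oracle, so the search is
-- analysed for an arbitrary `D`: its verdict excludes the runs of the opposite kind under `D`. Only
-- for `B` does overproductivity turn this into the right answer. P = NP is applied to a single
-- language: words made of a mode, `x`, a table and a string `σ` such that some lazy run of the kind
-- given by the mode emits a list of queries beginning with `σ`. With `σ` empty this is the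
-- existence test of a round, with growing `σ` it guides the search. The machine obtained for it is
-- known to be correct and fast only under the empty oracle; the search therefore interprets it,
-- answering its queries with no.

-- Finite sets, the future state sets

record Finite (A : Set) : Set where
  field
    size    : ℕ
    enc     : A → Fin size
    dec     : Fin size → A
    dec-enc : ∀ a → dec (enc a) ≡ a

-- A section is enough: a state is decoded only after it has been encoded, so surplus numbers may
-- decode to anything.
retract : {A B : Set} (f : A → B) (g : B → A) → (∀ a → g (f a) ≡ a) → Finite B → Finite A
retract f g gf F = record
  { size = size ; enc = enc ∘ f ; dec = g ∘ dec
  ; dec-enc = λ a → trans (cong g (dec-enc (f a))) (gf a) }
  where open Finite F

finite-Fin : ∀ n → Finite (Fin n)
finite-Fin n = record { size = n ; enc = id ; dec = id ; dec-enc = λ _ → refl }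

finite-⊤ : Finite ⊤
finite-⊤ = retract {B = Fin 1} (λ _ → zero) (λ _ → tt) (λ _ → refl) (finite-Fin 1)

infixr 1 _⊎ᶠ_
_⊎ᶠ_ : {A B : Set} → Finite A → Finite B → Finite (A ⊎ B)
_⊎ᶠ_ {A} {B} F G = record
  { size = F.size + G.size
  ; enc = λ s → join F.size G.size (encode s)
  ; dec = λ i → decode (splitAt F.size i)
  ; dec-enc = λ s → trans (cong decode (splitAt-join F.size G.size (encode s))) (decode-encode s) }
  where
  module F = Finite F
  module G = Finite G
  encode : A ⊎ B → Fin F.size ⊎ Fin G.size
  encode (inj₁ a) = inj₁ (F.enc a)
  encode (inj₂ b) = inj₂ (G.enc b)
  decode : Fin F.size ⊎ Fin G.size → A ⊎ B
  decode (inj₁ i) = inj₁ (F.dec i)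
  decode (inj₂ j) = inj₂ (G.dec j)
  decode-encode : ∀ s → decode (encode s) ≡ s
  decode-encode (inj₁ a) = cong inj₁ (F.dec-enc a)
  decode-encode (inj₂ b) = cong inj₂ (G.dec-enc b)

finite-ΣFin : ∀ n (F : Fin n → Set) → (∀ i → Finite (F i)) → Finite (Σ (Fin n) F)
finite-ΣFin zero    F fin = retract {B = Fin 0} proj₁ (λ ()) (λ ()) (finite-Fin 0)
finite-ΣFin (suc n) F fin = retract split unsplit unsplit-split
    (fin zero ⊎ᶠ finite-ΣFin n (F ∘ suc) (fin ∘ suc))
  where
  split : Σ (Fin (suc n)) F → F zero ⊎ Σ (Fin n) (F ∘ suc)
  split (zero  , x) = inj₁ x
  split (suc i , x) = inj₂ (i , x)
  unsplit : F zero ⊎ Σ (Fin n) (F ∘ suc) → Σ (Fin (suc n)) F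
  unsplit (inj₁ x)       = zero , x
  unsplit (inj₂ (i , x)) = suc i , x
  unsplit-split : ∀ s → unsplit (split s) ≡ s
  unsplit-split (zero  , x) = refl
  unsplit-split (suc i , x) = refl

finite-Σ : {A : Set} {B : A → Set} → Finite A → (∀ a → Finite (B a)) → Finite (Σ A B)
finite-Σ {A} {B} F G = retract
    (λ (a , b) → enc a , subst B (sym (dec-enc a)) b)
    (λ (i , b) → dec i , b)
    (λ (a , b) → back (dec-enc a) b)
    (finite-ΣFin size (B ∘ dec) (λ i → G (dec i)))
  where
  open Finite F
  back : ∀ {a a′} (eq : a′ ≡ a) (b : B a) → _≡_ {A = Σ A B} (a′ , subst B (sym eq) b) (a , b)
  back refl b = refl

infixr 2 _×ᶠ_
_×ᶠ_ : {A B : Set} → Finite A → Finite B → Finite (A × B)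
F ×ᶠ G = finite-Σ F (λ _ → G)

finite-Maybe : {A : Set} → Finite A → Finite (Maybe A)
finite-Maybe {A} F = retract to from from-to (finite-⊤ ⊎ᶠ F)
  where
  to : Maybe A → ⊤ ⊎ A
  to nothing  = inj₁ tt
  to (just a) = inj₂ a
  from : ⊤ ⊎ A → Maybe A
  from (inj₁ _) = nothing
  from (inj₂ a) = just a
  from-to : ∀ m → from (to m) ≡ m
  from-to nothing  = refl
  from-to (just a) = refl

finite-Bool : Finite Bool
finite-Bool = retract to from from-to (finite-⊤ ⊎ᶠ finite-⊤)
  where
  to : Bool → ⊤ ⊎ ⊤
  to false = inj₁ tt
  to true  = inj₂ tt
  from : ⊤ ⊎ ⊤ → Bool
  from (inj₁ _) = false
  from (inj₂ _) = true
  from-to : ∀ b → from (to b) ≡ b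
  from-to false = refl
  from-to true  = refl

finite-Sym : Finite Sym
finite-Sym = retract to from from-to (finite-Maybe finite-Bool)
  where
  to : Sym → Maybe Bool
  to blank   = nothing
  to (bit b) = just b
  from : Maybe Bool → Sym
  from nothing  = blank
  from (just b) = bit b
  from-to : ∀ s → from (to s) ≡ s
  from-to blank   = refl
  from-to (bit b) = refl

finite-Mb : Finite (Maybe Bool)
finite-Mb = finite-Maybe finite-Bool

-- Stack programs and their time-bounded semantics

-- Programs over bit stacks.  Stack zero is the query tape: its bottom is the
-- leftmost cell, so the word asked is the reversal of the stack.

Stacks : ℕ → Set
Stacks k = Vec (List Bool) (suc k)

-- Branches are functions, but on `Bool` or `Maybe Bool` only, and a loop runs through a finite set
-- of loop states and leaves with a value from a finite set. Hence every program has finitely many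
-- program points. `iter` is the only source of repetition.
data Cmd (k : ℕ) : Set → Set₁ where
  ret  : {R : Set} → R → Cmd k R
  push : {R : Set} → Fin (suc k) → Bool → Cmd k R → Cmd k R
  pop  : {R : Set} → Fin (suc k) → (Maybe Bool → Cmd k R) → Cmd k R
  ask  : {R : Set} → (Bool → Cmd k R) → Cmd k R
  halt : {R : Set} → Bool → Cmd k R
  iter : {A B R : Set} → Finite A → Finite B →
         (A → Cmd k (A ⊎ B)) → A → (B → Cmd k R) → Cmd k R

-- The loops enclosing the current command. The outermost result type is `⊥`, so a whole program can
-- end only by `halt`.
data Frames (k : ℕ) : Set → Set₁ where
  nil : Frames k ⊥
  frm : {A B R : Set} → Finite A → Finite B →
        (A → Cmd k (A ⊎ B)) → (B → Cmd k R) → Frames k R → Frames k (A ⊎ B)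

-- Br u F says how the two branches F of a query u have to succeed: the one
-- selected by an oracle, all of them, or some of them.
record Branching : Set₁ where
  field
    Br     : Word → (Bool → Set) → Set
    Br-map : ∀ {u} {F G : Bool → Set} → (∀ b → F b → G b) → Br u F → Br u G

byOracle : Lang → Branching
byOracle D = record { Br = λ u F → F (D u) ; Br-map = λ f → f _ }

everyAnswer : Branching
everyAnswer = record { Br = λ _ F → ∀ b → F b ; Br-map = λ f g b → f b (g b) }

someAnswer : Branching
someAnswer = record { Br = λ _ F → Σ Bool F ; Br-map = λ f (b , x) → b , f b x }

module Semantics (br : Branching) (P : Bool → Set) where
  open Branching br

  afterPop : ∀ {k} → Fin (suc k) → Stacks k → (Maybe Bool → Stacks k → Set) → List Bool → Set
  afterPop i v K []      = K nothing v
  afterPop i v K (b ∷ l) = K (just b) (v [ i ]≔ l)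

  Halts : ∀ {k R} → Cmd k R → Frames k R → Stacks k → ℕ → Set
  Halts c fr v zero = ⊥
  Halts (ret r)        nil                _ (suc t) = ⊥
  Halts (ret (inj₁ a)) (frm FA FB b c fr) v (suc t) = Halts (iter FA FB b a c) fr v t
  Halts (ret (inj₂ r)) (frm FA FB b c fr) v (suc t) = Halts (c r) fr v t
  Halts (push i b c)   fr v (suc t) = Halts c fr (v [ i ]≔ (b ∷ lookup v i)) t
  Halts (pop i f)      fr v (suc t) = afterPop i v (λ m v′ → Halts (f m) fr v′ t) (lookup v i)
  Halts (ask f)        fr v (suc t) = Br (reverse (head v)) (λ b → Halts (f b) fr v t)
  Halts (halt o)       fr v (suc t) = P o
  Halts (iter FA FB b a c) fr v (suc t) = Halts (b a) (frm FA FB b c fr) v t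

  afterPop-map : ∀ {k} (i : Fin (suc k)) v {K K′} → (∀ m v′ → K m v′ → K′ m v′) →
                 ∀ l → afterPop i v K l → afterPop i v K′ l
  afterPop-map i v f []      = f _ _
  afterPop-map i v f (b ∷ l) = f _ _

  Halts-mono : ∀ {k R} (c : Cmd k R) fr v {t t′} → t ≤ t′ → Halts c fr v t → Halts c fr v t′
  Halts-mono (ret (inj₁ a)) (frm FA FB b c fr) v (s≤s le) h = Halts-mono (iter FA FB b a c) fr v le h
  Halts-mono (ret (inj₂ r)) (frm FA FB b c fr) v (s≤s le) h = Halts-mono (c r) fr v le h
  Halts-mono (push i b c)   fr v (s≤s le) h = Halts-mono c fr _ le h
  Halts-mono (pop i f)      fr v (s≤s le) h =
    afterPop-map i v (λ m v′ → Halts-mono (f m) fr v′ le) (lookup v i) h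
  Halts-mono (ask f)        fr v (s≤s le) h = Br-map (λ b → Halts-mono (f b) fr v le) h
  Halts-mono (halt o)       fr v (s≤s le) h = h
  Halts-mono (iter FA FB b a c) fr v (s≤s le) h = Halts-mono (b a) _ v le h

-- Flattening programs to instructions at program points

data Instr (k : ℕ) (X : Set) : Set where
  onStack : Fin (suc k) → Maybe Bool → (Maybe Bool → X) → Instr k X
  ask     : (Bool → X) → Instr k X
  halt    : Bool → Instr k X
  tick    : X → Instr k X

-- A loop has one head per loop state, followed by the points of its bodies and of its exits. The
-- initial state does not enter, so a jump back to the head with another state stays within the same
-- set of points.
Pos : ∀ {k R} → Cmd k R → Set
Pos (ret r)            = ⊤
Pos (push i b c)       = Maybe (Pos c)
Pos (pop i f)          = Maybe (Σ (Maybe Bool) λ m → Pos (f m))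
Pos (ask f)            = Maybe (Σ Bool λ b → Pos (f b))
Pos (halt o)           = ⊤
Pos (iter {A} {B} FA FB b a c) = A ⊎ (Σ A λ a → Pos (b a)) ⊎ (Σ B λ r → Pos (c r))

finite-Pos : ∀ {k R} (c : Cmd k R) → Finite (Pos c)
finite-Pos (ret r)            = finite-⊤
finite-Pos (push i b c)       = finite-Maybe (finite-Pos c)
finite-Pos (pop i f)          = finite-Maybe (finite-Σ finite-Mb λ m → finite-Pos (f m))
finite-Pos (ask f)            = finite-Maybe (finite-Σ finite-Bool λ b → finite-Pos (f b))
finite-Pos (halt o)           = finite-⊤
finite-Pos (iter FA FB b a c) =
  FA ⊎ᶠ finite-Σ FA (λ a → finite-Pos (b a)) ⊎ᶠ finite-Σ FB (λ r → finite-Pos (c r))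

entry : ∀ {k R} (c : Cmd k R) → Pos c
entry (ret r)            = tt
entry (push i b c)       = nothing
entry (pop i f)          = nothing
entry (ask f)            = nothing
entry (halt o)           = tt
entry (iter FA FB b a c) = inj₁ a

-- The instruction at a program point, where ρ receives the returned values and
-- e embeds the points of the command into those of the whole program.
instr : ∀ {k R} {X : Set} (c : Cmd k R) → (R → X) → (Pos c → X) → Pos c → Instr k X
instr (ret r)      ρ e tt             = tick (ρ r)
instr (push i b c) ρ e nothing        = onStack i (just b) (λ _ → e (just (entry c)))
instr (push i b c) ρ e (just p)       = instr c ρ (e ∘ just) p
instr (pop i f)    ρ e nothing        = onStack i nothing (λ m → e (just (m , entry (f m))))
instr (pop i f)    ρ e (just (m , p)) = instr (f m) ρ (λ p → e (just (m , p))) p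
instr (ask f)      ρ e nothing        = ask (λ b → e (just (b , entry (f b))))
instr (ask f)      ρ e (just (b , p)) = instr (f b) ρ (λ p → e (just (b , p))) p
instr (halt o)     ρ e tt             = halt o
instr (iter FA FB b _ c) ρ e (inj₁ a) = tick (e (inj₂ (inj₁ (a , entry (b a)))))
instr (iter FA FB b _ c) ρ e (inj₂ (inj₁ (a , p))) =
  instr (b a) [ e ∘ inj₁ , (λ r → e (inj₂ (inj₂ (r , entry (c r))))) ]′
        (λ p → e (inj₂ (inj₁ (a , p)))) p
instr (iter FA FB b _ c) ρ e (inj₂ (inj₂ (r , p))) =
  instr (c r) ρ (λ p → e (inj₂ (inj₂ (r , p)))) p

module Flat (br : Branching) (P : Bool → Set) {k : ℕ} {X : Set} (I : X → Instr k X) where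
  open Branching br
  open Semantics br P

  stackStep : Fin (suc k) → Maybe Bool → (Maybe Bool → Stacks k → Set) → Stacks k → Set
  stackStep i (just b) K v = K nothing (v [ i ]≔ (b ∷ lookup v i))
  stackStep i nothing  K v = afterPop i v K (lookup v i)

  mutual
    HaltsF : X → Stacks k → ℕ → Set
    HaltsF x v zero    = ⊥
    HaltsF x v (suc t) = exec (I x) v t

    exec : Instr k X → Stacks k → ℕ → Set
    exec (onStack i w f) v t = stackStep i w (λ m v′ → HaltsF (f m) v′ t) v
    exec (ask f)         v t = Br (reverse (head v)) (λ b → HaltsF (f b) v t)
    exec (halt o)        v t = P o
    exec (tick x)        v t = HaltsF x v t

  Placed : ∀ {R} (c : Cmd k R) → (R → X) → (Pos c → X) → Set
  Placed c ρ e = ∀ p → I (e p) ≡ instr c ρ e p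

  Placed-iter : ∀ {A B R} {FA : Finite A} {FB : Finite B} {b : A → Cmd k (A ⊎ B)} {c : B → Cmd k R}
                {ρ : R → X} {e} a a′ → Placed (iter FA FB b a c) ρ e → Placed (iter FA FB b a′ c) ρ e
  Placed-iter a a′ pl (inj₁ _)              = pl (inj₁ _)
  Placed-iter a a′ pl (inj₂ (inj₁ (_ , p))) = pl (inj₂ (inj₁ (_ , p)))
  Placed-iter a a′ pl (inj₂ (inj₂ (_ , p))) = pl (inj₂ (inj₂ (_ , p)))

  -- Ties a frame to the return map under which the loop body was compiled: `inj₁` leads to a loop
  -- head, `inj₂` to the code after the loop.
  data FramesPlaced : ∀ {R} → Frames k R → (R → X) → Set₁ where
    nil : ∀ {ρ} → FramesPlaced nil ρ
    frm : ∀ {A B R} {FA : Finite A} {FB : Finite B} {b : A → Cmd k (A ⊎ B)} {c : B → Cmd k R} {fr ρ}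
          (e : A ⊎ (Σ A λ a → Pos (b a)) ⊎ (Σ B λ r → Pos (c r)) → X) →
          ∀ a → Placed (iter FA FB b a c) ρ e →
          FramesPlaced fr ρ →
          FramesPlaced (frm FA FB b c fr) [ e ∘ inj₁ , (λ r → e (inj₂ (inj₂ (r , entry (c r))))) ]′

  -- Each clause of `Halts` consumes one unit of time and matches exactly one instruction, `ret` and
  -- `iter` being a `tick`; so the time bound carries over unchanged.
  placed : ∀ {R} (c : Cmd k R) {fr v ρ e} → Placed c ρ e → FramesPlaced fr ρ →
           ∀ t → Halts c fr v t → HaltsF (e (entry c)) v t
  placed (ret (inj₁ a)) pl (frm {FA = FA} {FB} {b} {c} e a₀ pl′ fp) (suc t) h
    rewrite pl tt = placed (iter FA FB b a c) (Placed-iter {FA = FA} {FB} {b} {c} a₀ a pl′) fp t h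
  placed (ret (inj₂ r)) pl (frm {c = c} e a₀ pl′ fp) (suc t) h
    rewrite pl tt = placed (c r) (λ p → pl′ (inj₂ (inj₂ (r , p)))) fp t h
  placed (push i b c) pl fp (suc t) h
    rewrite pl nothing = placed c (pl ∘ just) fp t h
  placed (pop i f) {v = v} pl fp (suc t) h
    rewrite pl nothing = afterPop-map i v (λ m v′ → placed (f m) (λ p → pl (just (m , p))) fp t) (lookup v i) h
  placed (ask f) pl fp (suc t) h
    rewrite pl nothing = Br-map (λ b → placed (f b) (λ p → pl (just (b , p))) fp t) h
  placed (halt o) pl fp (suc t) h
    rewrite pl tt = h
  placed (iter FA FB b a c) {e = e} pl fp (suc t) h
    rewrite pl (inj₁ a) = placed (b a) (λ p → pl (inj₂ (inj₁ (a , p)))) (frm {FA = FA} {FB} {b} {c} e a pl fp) t h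

-- Stacks as interleaved tracks on tape 1, and stack zero on tape 2

-- Tape 1 as a function on positions; only what lies right of position zero is described.

nth : List Sym → ℕ → Sym
nth []      n       = blank
nth (s ∷ l) zero    = s
nth (s ∷ l) (suc n) = nth l n

record Holds (τ : Tape) (f : ℕ → Sym) (p : ℕ) : Set where
  constructor holds
  field
    fwd : ∀ n → nth (scan τ ∷ right τ) n ≡ f (p + n)
    bwd : ∀ n → n < p → nth (left τ) n ≡ f (p ∸ suc n)
open Holds

here-holds : ∀ {τ f p} → Holds τ f p → scan τ ≡ f p
here-holds {f = f} {p} H = trans (fwd H 0) (cong f (+-identityʳ p))

holds-R : ∀ {τ f p} → Holds τ f p → Holds (moveT R τ) f (suc p)
holds-R {tape l h []} {f} {p} H = holds fw bw
  where
  fw : ∀ n → nth (blank ∷ []) n ≡ f (suc p + n)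
  fw zero    = trans (fwd H 1) (cong f (+-suc p 0))
  fw (suc n) = trans (fwd H (suc (suc n))) (cong f (+-suc p (suc n)))
  bw : ∀ n → n < suc p → nth (h ∷ l) n ≡ f (suc p ∸ suc n)
  bw zero    _        = here-holds H
  bw (suc n) (s≤s lt) = bwd H n lt
holds-R {tape l h (s ∷ r)} {f} {p} H = holds fw bw
  where
  fw : ∀ n → nth (s ∷ r) n ≡ f (suc p + n)
  fw n = trans (fwd H (suc n)) (cong f (+-suc p n))
  bw : ∀ n → n < suc p → nth (h ∷ l) n ≡ f (suc p ∸ suc n)
  bw zero    _        = here-holds H
  bw (suc n) (s≤s lt) = bwd H n lt

holds-L : ∀ {τ f p} → Holds τ f (suc p) → Holds (moveT L τ) f p
holds-L {tape [] h r} {f} {p} H = holds fw bw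
  where
  fw : ∀ n → nth (blank ∷ h ∷ r) n ≡ f (p + n)
  fw zero    = trans (bwd H 0 (s≤s z≤n)) (cong f (sym (+-identityʳ p)))
  fw (suc n) = trans (fwd H n) (cong f (sym (+-suc p n)))
  bw : ∀ n → n < p → blank ≡ f (p ∸ suc n)
  bw n lt = bwd H (suc n) (s≤s lt)
holds-L {tape (s ∷ l) h r} {f} {p} H = holds fw bw
  where
  fw : ∀ n → nth (s ∷ h ∷ r) n ≡ f (p + n)
  fw zero    = trans (bwd H 0 (s≤s z≤n)) (cong f (sym (+-identityʳ p)))
  fw (suc n) = trans (fwd H n) (cong f (sym (+-suc p n)))
  bw : ∀ n → n < p → nth l n ≡ f (p ∸ suc n)
  bw n lt = bwd H (suc n) (s≤s lt)

holds-write : ∀ {τ f f′ p} s → Holds τ f p → f′ p ≡ s → (∀ q → q ≢ p → f′ q ≡ f q) →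
              Holds (write s τ) f′ p
holds-write {tape l h r} {f} {f′} {p} s H at-p off-p = holds fw bw
  where
  fw : ∀ n → nth (s ∷ r) n ≡ f′ (p + n)
  fw zero    = sym (trans (cong f′ (+-identityʳ p)) at-p)
  fw (suc n) = trans (fwd H (suc n)) (sym (off-p _ (λ eq → 1+n≢0 (+-cancelˡ-≡ p _ _ (trans eq (sym (+-identityʳ p)))))))
  bw : ∀ n → n < p → nth l n ≡ f′ (p ∸ suc n)
  bw n lt = trans (bwd H n lt) (sym (off-p _ (<⇒≢ (∸-monoʳ-< {p} {suc n} {0} (s≤s z≤n) lt))))

-- cell l j is the content of track l in block j; the bottom of the stack is in block 1.

cell′ : List Bool → ℕ → Sym
cell′ []      j = blank
cell′ (b ∷ l) j = if j ≡ᵇ length l then bit b else cell′ l j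

cell : List Bool → ℕ → Sym
cell l zero    = blank
cell l (suc j) = cell′ l j

≡ᵇ-refl : ∀ n → (n ≡ᵇ n) ≡ true
≡ᵇ-refl zero    = refl
≡ᵇ-refl (suc n) = ≡ᵇ-refl n

≢⇒≡ᵇ : ∀ m n → m ≢ n → (m ≡ᵇ n) ≡ false
≢⇒≡ᵇ zero    zero    ne = ⊥-elim (ne refl)
≢⇒≡ᵇ zero    (suc n) ne = refl
≢⇒≡ᵇ (suc m) zero    ne = refl
≢⇒≡ᵇ (suc m) (suc n) ne = ≢⇒≡ᵇ m n (ne ∘ cong suc)

cell-top : ∀ b l → cell (b ∷ l) (suc (length l)) ≡ bit b
cell-top b l rewrite ≡ᵇ-refl (length l) = refl

cell-rest : ∀ b l j → j ≢ suc (length l) → cell (b ∷ l) j ≡ cell l j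
cell-rest b l zero    ne = refl
cell-rest b l (suc j) ne rewrite ≢⇒≡ᵇ j (length l) (ne ∘ cong suc) = refl

cell-above : ∀ l j → length l < j → cell l j ≡ blank
cell-above []      (suc j) lt = refl
cell-above (b ∷ l) (suc j) (s≤s lt) =
  trans (cell-rest b l (suc j) (λ eq → <⇒≢ lt (sym (suc-injective eq))))
        (cell-above l (suc j) (<-trans (n<1+n _) (s≤s lt)))

cell-below : ∀ l j → 1 ≤ j → j ≤ length l → Σ Bool λ b → cell l j ≡ bit b
cell-below (b ∷ l) (suc j) 1≤ (s≤s le) with j ≟ length l
... | yes refl = b , cell-top b l
... | no ne with cell-below l (suc j) 1≤ (≤∧≢⇒< le ne)
...   | b′ , eq = b′ , trans (cell-rest b l (suc j) (ne ∘ suc-injective)) eq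
cell-below [] (suc j) 1≤ ()

-- `toℕ i` and `j` are the remainder and the quotient on division by `k`.
interleave-injective : ∀ {k} (i i′ : Fin k) j j′ → j * k + toℕ i ≡ j′ * k + toℕ i′ → (i ≡ i′) × (j ≡ j′)
interleave-injective {suc k} i i′ j j′ eq = i≡ , j≡
  where
  residue : ∀ i j → (j * suc k + toℕ i) % suc k ≡ toℕ {suc k} i
  residue i j = trans (cong (_% suc k) (+-comm (j * suc k) (toℕ i)))
                (trans ([m+kn]%n≡m%n (toℕ i) j (suc k)) (m<n⇒m%n≡m (toℕ<n i)))
  i≡ : i ≡ i′
  i≡ = toℕ-injective (trans (sym (residue i j)) (trans (cong (_% suc k) eq) (residue i′ j′)))
  j≡ : j ≡ j′
  j≡ = *-cancelʳ-≡ j j′ (suc k)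
         (+-cancelʳ-≡ (toℕ i) _ _ (trans eq (cong (λ x → j′ * suc k + toℕ x) (sym i≡))))

module Layout (k : ℕ) where

  pos : Fin k → ℕ → ℕ
  pos i j = j * k + toℕ i

  pos-suc : ∀ i j → pos i j + k ≡ pos i (suc j)
  pos-suc i j = trans (+-comm (pos i j) k) (sym (+-assoc k (j * k) (toℕ i)))

  Tracks : Vec (List Bool) k → (ℕ → Sym) → Set
  Tracks v f = ∀ i j → f (pos i j) ≡ cell (lookup v i) j

  setAt : ℕ → Sym → (ℕ → Sym) → ℕ → Sym
  setAt p s f q = if q ≡ᵇ p then s else f q

  setAt-here : ∀ p s f → setAt p s f p ≡ s
  setAt-here p s f rewrite ≡ᵇ-refl p = refl

  setAt-off : ∀ p s f q → q ≢ p → setAt p s f q ≡ f q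
  setAt-off p s f q ne rewrite ≢⇒≡ᵇ q p ne = refl

  -- The new list is arbitrary up to differing from the old one in a single cell, which covers a
  -- push (a new top is written) as well as a pop (the old top is blanked).
  tracks-set : ∀ v f i s l m → Tracks v f →
               cell l m ≡ s → (∀ j → j ≢ m → cell l j ≡ cell (lookup v i) j) →
               Tracks (v [ i ]≔ l) (setAt (pos i m) s f)
  tracks-set v f i s l m T top rest i′ j with i Data.Fin.≟ i′
  ... | no ne = trans (setAt-off _ s f _ (λ eq → ne (sym (proj₁ (interleave-injective i′ i j m eq)))))
               (trans (T i′ j) (cong (λ x → cell x j) (sym (lookup∘update′ (ne ∘ sym) v l))))
  ... | yes refl rewrite lookup∘update i v l with j ≟ m
  ...   | yes refl = trans (setAt-here (pos i j) s f) (sym top)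
  ...   | no ne = trans (setAt-off _ s f _ (λ eq → ne (proj₂ (interleave-injective i i j m eq))))
                  (trans (T i j) (sym (rest j ne)))

-- Tape 2 holds stack zero, left of the head.

QueryTape : List Bool → Tape → Set
QueryTape z τ = (Σ ℕ λ m → left τ ≡ map bit z ++ replicate m blank)
              × (scan τ ≡ blank) × (Σ ℕ λ m → right τ ≡ replicate m blank)

bitsOf-++ : ∀ l r → bitsOf (l ++ r) ≡ bitsOf l ++ bitsOf r
bitsOf-++ []          r = refl
bitsOf-++ (blank ∷ l) r = bitsOf-++ l r
bitsOf-++ (bit b ∷ l) r = cong (b ∷_) (bitsOf-++ l r)

bitsOf-blanks : ∀ m → bitsOf (replicate m blank) ≡ []
bitsOf-blanks zero    = refl
bitsOf-blanks (suc m) = bitsOf-blanks m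

bitsOf-ʳ++ : ∀ l r → bitsOf (l ʳ++ r) ≡ bitsOf l ʳ++ bitsOf r
bitsOf-ʳ++ []          r = refl
bitsOf-ʳ++ (blank ∷ l) r = bitsOf-ʳ++ l (blank ∷ r)
bitsOf-ʳ++ (bit b ∷ l) r = bitsOf-ʳ++ l (bit b ∷ r)

bitsOf-map : ∀ z → bitsOf (map bit z) ≡ z
bitsOf-map []      = refl
bitsOf-map (b ∷ z) = cong (b ∷_) (bitsOf-map z)

-- `contents` skips blanks, so the padding left behind by pops disappears; the left half is listed
-- nearest cell first, whence the reversal.
contents-queryTape : ∀ z τ → QueryTape z τ → contents τ ≡ reverse z
contents-queryTape z (tape _ _ _) ((m , refl) , refl , (m′ , refl)) = begin
  bitsOf (reverse l ++ (blank ∷ replicate m′ blank))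
    ≡⟨ cong bitsOf (sym (ʳ++-defn l)) ⟩
  bitsOf (l ʳ++ (blank ∷ replicate m′ blank))
    ≡⟨ bitsOf-ʳ++ l _ ⟩
  bitsOf l ʳ++ bitsOf (replicate m′ blank)
    ≡⟨ cong₂ _ʳ++_ bits-l (bitsOf-blanks m′) ⟩
  reverse z ∎
  where
  open ≡-Reasoning
  l : List Sym
  l = map bit z ++ replicate m blank
  bits-l : bitsOf l ≡ z
  bits-l = trans (bitsOf-++ (map bit z) _)
           (trans (cong₂ _++_ (bitsOf-map z) (bitsOf-blanks m)) (Data.List.Properties.++-identityʳ z))

queryTape-push : ∀ z τ b → QueryTape z τ → QueryTape (b ∷ z) (moveT R (write (bit b) τ))
queryTape-push z (tape _ _ _) b ((m , refl) , refl , (zero , refl))   = (m , refl) , refl , (0 , refl)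
queryTape-push z (tape _ _ _) b ((m , refl) , refl , (suc m′ , refl)) = (m , refl) , refl , (m′ , refl)

queryTape-top : ∀ b z τ → QueryTape (b ∷ z) τ → scan (moveT L (write (scan τ) τ)) ≡ bit b
queryTape-top b z (tape _ _ _) ((m , refl) , refl , (m′ , refl)) = refl

queryTape-pop : ∀ b z τ → QueryTape (b ∷ z) τ → QueryTape z (write blank (moveT L (write (scan τ) τ)))
queryTape-pop b z (tape _ _ _) ((m , refl) , refl , (m′ , refl)) = (m , refl) , refl , (suc m′ , refl)

queryTape-[]-top : ∀ τ → QueryTape [] τ → scan (moveT L (write (scan τ) τ)) ≡ blank
queryTape-[]-top (tape _ _ _) ((zero , refl) , refl , (m′ , refl))  = refl
queryTape-[]-top (tape _ _ _) ((suc m , refl) , refl , (m′ , refl)) = refl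

-- A pop from the empty stack looks one cell to the left and has to step back. This may create a
-- blank cell on the left, just as a successful pop leaves one on the right; `QueryTape` allows for
-- both.
queryTape-[] : ∀ τ → QueryTape [] τ → QueryTape [] (moveT R (write blank (moveT L (write (scan τ) τ))))
queryTape-[] (tape _ _ _) ((zero , refl) , refl , (m′ , refl))  = (1 , refl) , refl , (m′ , refl)
queryTape-[] (tape _ _ _) ((suc m , refl) , refl , (m′ , refl)) = (suc m , refl) , refl , (m′ , refl)

-- Compiling instructions to two-tape machines

data Act (Q : Set) : Set where
  move : Q → Sym → Sym → Dir → Dir → Act Q
  ask  : Q → Q → Act Q
  halt : Bool → Act Q

module Run (br : Branching) (P : Bool → Set) {Q : Set} (δ : Q → Sym → Sym → Act Q) where
  open Branching br

  mutual
    HaltsT : Q → Tape → Tape → ℕ → Set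
    HaltsT q τ₁ τ₂ zero    = ⊥
    HaltsT q τ₁ τ₂ (suc t) = perform (δ q (scan τ₁) (scan τ₂)) τ₁ τ₂ t

    perform : Act Q → Tape → Tape → ℕ → Set
    perform (move q w₁ w₂ d₁ d₂) τ₁ τ₂ t = HaltsT q (moveT d₁ (write w₁ τ₁)) (moveT d₂ (write w₂ τ₂)) t
    perform (ask qy qn) τ₁ τ₂ t = Br (contents τ₂) (λ b → HaltsT (if b then qy else qn) τ₁ τ₂ t)
    perform (halt o) τ₁ τ₂ t = P o

  mutual
    HaltsT-mono : ∀ q τ₁ τ₂ {t t′} → t ≤ t′ → HaltsT q τ₁ τ₂ t → HaltsT q τ₁ τ₂ t′
    HaltsT-mono q τ₁ τ₂ (s≤s le) h = perform-mono (δ q (scan τ₁) (scan τ₂)) τ₁ τ₂ le h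

    perform-mono : ∀ a τ₁ τ₂ {t t′} → t ≤ t′ → perform a τ₁ τ₂ t → perform a τ₁ τ₂ t′
    perform-mono (move q w₁ w₂ d₁ d₂) τ₁ τ₂ le h = HaltsT-mono q _ _ le h
    perform-mono (ask qy qn) τ₁ τ₂ le h = Br-map (λ b → HaltsT-mono _ τ₁ τ₂ le) h
    perform-mono (halt o) τ₁ τ₂ le h = h

  performs : ∀ {q τ₁ τ₂ t} a → δ q (scan τ₁) (scan τ₂) ≡ a → perform a τ₁ τ₂ t → HaltsT q τ₁ τ₂ (suc t)
  performs a refl h = h

-- The stages of one stack operation: `out` walks right to the first blank of the track, `peek` goes
-- back one block to read the top to be popped, `back` returns block by block carrying the result,
-- `home` covers the last cells to position zero, and `zread` is the second half of a pop on the
-- query tape. The `Fin` counts the cells left in the current walk.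
data Micro (B : ℕ) : Set where
  go zread  : Micro B
  out peek  : Fin B → Micro B
  back home : Maybe Bool → Fin B → Micro B

data State (X : Set) (B : ℕ) : Set where
  load : State X B
  run  : X → Micro B → State X B

finite-Micro : ∀ B → Finite (Micro B)
finite-Micro B = retract to from from-to
    (finite-Bool ⊎ᶠ (finite-Bool ×ᶠ finite-Fin B) ⊎ᶠ (finite-Bool ×ᶠ finite-Mb ×ᶠ finite-Fin B))
  where
  Code : Set
  Code = Bool ⊎ (Bool × Fin B) ⊎ (Bool × Maybe Bool × Fin B)
  to : Micro B → Code
  to go         = inj₁ true
  to zread      = inj₁ false
  to (out m)    = inj₂ (inj₁ (true , m))
  to (peek m)   = inj₂ (inj₁ (false , m))
  to (back r m) = inj₂ (inj₂ (true , r , m))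
  to (home r m) = inj₂ (inj₂ (false , r , m))
  from : Code → Micro B
  from (inj₁ true)                     = go
  from (inj₁ false)                    = zread
  from (inj₂ (inj₁ (true , m)))        = out m
  from (inj₂ (inj₁ (false , m)))       = peek m
  from (inj₂ (inj₂ (true , r , m)))    = back r m
  from (inj₂ (inj₂ (false , r , m)))   = home r m
  from-to : ∀ μ → from (to μ) ≡ μ
  from-to go         = refl
  from-to zread      = refl
  from-to (out m)    = refl
  from-to (peek m)   = refl
  from-to (back r m) = refl
  from-to (home r m) = refl

finite-State : ∀ {X} B → Finite X → Finite (State X B)
finite-State {X} B F = retract to from from-to (finite-⊤ ⊎ᶠ (F ×ᶠ finite-Micro B))
  where
  to : State X B → ⊤ ⊎ (X × Micro B)
  to load      = inj₁ tt
  to (run x μ) = inj₂ (x , μ)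
  from : ⊤ ⊎ (X × Micro B) → State X B
  from (inj₁ _)       = load
  from (inj₂ (x , μ)) = run x μ
  from-to : ∀ q → from (to q) ≡ q
  from-to load      = refl
  from-to (run x μ) = refl

-- An operation on track i walks right from position zero, block by block, to
-- the first blank of the track, and returns to the blank of block zero.

module Machine {k : ℕ} {X : Set} (I : X → Instr k X) (x₀ : X) where

  open Layout k

  -- The longest walk made without looking at the tape leads from position zero to block 1 of track
  -- `i` and has `k + toℕ i` cells.
  B : ℕ
  B = suc (k + k)

  one-block : Fin B
  one-block = fromℕ< (s≤s (m≤m+n k k))

  offset : Fin k → Fin B
  offset i = fromℕ< (s≤s (≤-trans (<⇒≤ (toℕ<n i)) (m≤m+n k k)))

  first-block : Fin k → Fin B
  first-block i = fromℕ< (s≤s (+-monoʳ-≤ k (<⇒≤ (toℕ<n i))))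

  Q : Set
  Q = State X B

  onTrack : Fin k → Maybe Bool → (Maybe Bool → X) → X → Micro B → Sym → Sym → Act Q
  onTrack i w f x go         s₁ s₂ = move (run x (out (first-block i))) s₁ s₂ S S
  onTrack i w f x (out (suc m)) s₁ s₂ = move (run x (out (inject₁ m))) s₁ s₂ R S
  onTrack i w        f x (out zero) (bit b) s₂ = move (run x (out one-block)) (bit b) s₂ S S
  onTrack i (just b) f x (out zero) blank   s₂ = move (run x (back nothing one-block)) (bit b) s₂ S S
  onTrack i nothing  f x (out zero) blank   s₂ = move (run x (peek one-block)) blank s₂ S S
  onTrack i w f x (peek (suc m)) s₁ s₂ = move (run x (peek (inject₁ m))) s₁ s₂ L S
  onTrack i w f x (peek zero) (bit b) s₂ = move (run x (back (just b) one-block)) blank s₂ S S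
  onTrack i w f x (peek zero) blank   s₂ = move (run x (home nothing (offset i))) blank s₂ S S
  onTrack i w f x (back r (suc m)) s₁ s₂ = move (run x (back r (inject₁ m))) s₁ s₂ L S
  onTrack i w f x (back r zero) (bit b) s₂ = move (run x (back r one-block)) (bit b) s₂ S S
  onTrack i w f x (back r zero) blank   s₂ = move (run x (home r (offset i))) blank s₂ S S
  onTrack i w f x (home r (suc m)) s₁ s₂ = move (run x (home r (inject₁ m))) s₁ s₂ L S
  onTrack i w f x (home r zero) s₁ s₂ = move (run (f r) go) s₁ s₂ S S
  onTrack i w f x zread s₁ s₂ = halt false

  onQueryTape : Maybe Bool → (Maybe Bool → X) → X → Micro B → Sym → Sym → Act Q
  onQueryTape (just b) f x go s₁ s₂ = move (run (f nothing) go) s₁ (bit b) S R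
  onQueryTape nothing  f x go s₁ s₂ = move (run x zread) s₁ s₂ S L
  onQueryTape _ f x zread s₁ (bit b) = move (run (f (just b)) go) s₁ blank S S
  onQueryTape _ f x zread s₁ blank   = move (run (f nothing) go) s₁ blank S R
  onQueryTape _ f x _     s₁ s₂      = halt false

  execute : Instr k X → X → Micro B → Sym → Sym → Act Q
  execute (onStack zero w f)    x μ s₁ s₂ = onQueryTape w f x μ s₁ s₂
  execute (onStack (suc i) w f) x μ s₁ s₂ = onTrack i w f x μ s₁ s₂
  execute (ask f)  x μ s₁ s₂ = ask (run (f true) go) (run (f false) go)
  execute (halt o) x μ s₁ s₂ = halt o
  execute (tick y) x μ s₁ s₂ = move (run y go) s₁ s₂ S S

  δ : Q → Sym → Sym → Act Q
  δ load (bit b) s₂ = move load blank (bit b) R R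
  δ load blank   s₂ = move (run x₀ go) blank s₂ S S
  δ (run x μ) s₁ s₂ = execute (I x) x μ s₁ s₂

  -- The summands follow the stages of a pop, for stacks of height at most `H`: the walk to block 1,
  -- at most `H` blocks outwards at `suc k` steps each, one block back to the top, one further block
  -- back, at most `H` blocks inwards, and the way home. A push fits into the same bound.
  opTime : ℕ → ℕ → ℕ
  opTime H t = suc ((k + k) + (H * suc k + suc (k + suc (k + (H * suc k + (suc k + suc t))))))

  totalTime : ℕ → ℕ → ℕ
  totalTime H zero    = zero
  totalTime H (suc t) = opTime H (totalTime H t)

  module Correct (br : Branching) (P : Bool → Set) where
    open Branching br
    open Semantics br P
    open Flat br P I
    open Run br P δ

    -- The rules for tape movements lead from halting after the walk to halting before it. In this
    -- form they hold for every branching and take the place of a reachability relation.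
    walk-R : ∀ {x i w f} → I x ≡ onStack (suc i) w f → ∀ n m → toℕ m ≡ n → ∀ {τ τ₂ g p t} → Holds τ g p →
             (∀ {τ} → Holds τ g (p + n) → HaltsT (run x (out zero)) τ τ₂ t) →
             HaltsT (run x (out m)) τ τ₂ (n + t)
    walk-R Ix zero zero _ {g = g} {p} H K = K (subst (Holds _ g) (sym (+-identityʳ p)) H)
    walk-R {x} {i} {w} {f} Ix (suc n) (suc m) eq {τ} {τ₂} {g} {p} H K =
      performs (move (run x (out (inject₁ m))) (scan τ) (scan τ₂) R S)
        (cong (λ ι → execute ι x (out (suc m)) (scan τ) (scan τ₂)) Ix)
        (walk-R Ix n (inject₁ m) (trans (toℕ-inject₁ m) (suc-injective eq)) (holds-R H)
          (λ H′ → K (subst (Holds _ g) (sym (+-suc p n)) H′)))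

    Leftward : X → (Fin B → Micro B) → Set
    Leftward x μ = ∀ m s₁ s₂ → δ (run x (μ (suc m))) s₁ s₂ ≡ move (run x (μ (inject₁ m))) s₁ s₂ L S

    walk-L : ∀ {x} μ → Leftward x μ → ∀ n m → toℕ m ≡ n → ∀ {τ τ₂ g p t} → Holds τ g (p + n) →
             (∀ {τ} → Holds τ g p → HaltsT (run x (μ zero)) τ τ₂ t) →
             HaltsT (run x (μ m)) τ τ₂ (n + t)
    walk-L μ Lw zero zero _ {g = g} {p} H K = K (subst (Holds _ g) (+-identityʳ p) H)
    walk-L {x} μ Lw (suc n) (suc m) eq {τ} {τ₂} {g} {p} H K =
      performs _ (Lw m (scan τ) (scan τ₂))
        (walk-L μ Lw n (inject₁ m) (trans (toℕ-inject₁ m) (suc-injective eq))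
          (holds-L (subst (Holds _ g) (+-suc p n) H)) K)

    leftward-peek : ∀ {x i w f} → I x ≡ onStack (suc i) w f → Leftward x peek
    leftward-peek {x} Ix m s₁ s₂ = cong (λ ι → execute ι x (peek (suc m)) s₁ s₂) Ix

    leftward-back : ∀ {x i w f} → I x ≡ onStack (suc i) w f → ∀ r → Leftward x (back r)
    leftward-back {x} Ix r m s₁ s₂ = cong (λ ι → execute ι x (back r (suc m)) s₁ s₂) Ix

    leftward-home : ∀ {x i w f} → I x ≡ onStack (suc i) w f → ∀ r → Leftward x (home r)
    leftward-home {x} Ix r m s₁ s₂ = cong (λ ι → execute ι x (home r (suc m)) s₁ s₂) Ix

    toℕ-one-block : toℕ one-block ≡ k
    toℕ-one-block = toℕ-fromℕ< (s≤s (m≤m+n k k))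

    toℕ-offset : ∀ i → toℕ (offset i) ≡ toℕ i
    toℕ-offset i = toℕ-fromℕ< (s≤s (≤-trans (<⇒≤ (toℕ<n i)) (m≤m+n k k)))

    toℕ-first-block : ∀ i → toℕ (first-block i) ≡ k + toℕ i
    toℕ-first-block i = toℕ-fromℕ< (s≤s (+-monoʳ-≤ k (<⇒≤ (toℕ<n i))))

    step : ∀ {x i w f} → I x ≡ onStack (suc i) w f → ∀ {μ τ τ₂ t} s → scan τ ≡ s →
           perform (onTrack i w f x μ s (scan τ₂)) τ τ₂ t → HaltsT (run x μ) τ τ₂ (suc t)
    step {x} Ix {μ} {τ} {τ₂} s refl h =
      performs _ (cong (λ ι → execute ι x μ (scan τ) (scan τ₂)) Ix) h

    stay : ∀ {τ g p} → Holds τ g p → ∀ {s} → g p ≡ s → Holds (moveT S (write s τ)) g p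
    stay H eq = holds-write _ H eq (λ _ _ → refl)

    scan-out : ∀ {x i w f} → I x ≡ onStack (suc i) w f → ∀ {v g} → Tracks v g →
               ∀ d j → 1 ≤ j → d + j ≡ suc (length (lookup v i)) → ∀ {τ τ₂ t} → Holds τ g (pos i j) →
               (∀ {τ} → Holds τ g (pos i (suc (length (lookup v i)))) → HaltsT (run x (out zero)) τ τ₂ t) →
               HaltsT (run x (out zero)) τ τ₂ (d * suc k + t)
    scan-out Ix T zero j 1≤j refl H K = K H
    scan-out {x} {i} Ix {v} {g} T (suc d) j 1≤j eq {τ} {τ₂} {t} H K
      with cell-below (lookup v i) j 1≤j (≤-trans (m≤n+m j d) (≤-reflexive (suc-injective eq)))
    ... | b , cb = subst (HaltsT (run x (out zero)) τ τ₂) (sym (cong suc (+-assoc k (d * suc k) t)))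
        (step Ix {τ₂ = τ₂} (bit b) (trans (here-holds H) gj)
          (walk-R Ix k one-block toℕ-one-block (stay H gj)
            (λ H′ → scan-out Ix {v} T d (suc j) (s≤s z≤n) (trans (+-suc d j) eq)
              (subst (Holds _ g) (pos-suc i j) H′) K)))
      where
      gj : g (pos i j) ≡ bit b
      gj = trans (T i j) cb

    scan-back : ∀ {x i w f} → I x ≡ onStack (suc i) w f → ∀ {v g} → Tracks v g → ∀ r →
                ∀ j → j ≤ length (lookup v i) → ∀ {τ τ₂ t} → Holds τ g (pos i j) →
                (∀ {τ} → Holds τ g 0 → HaltsT (run (f r) go) τ τ₂ t) →
                HaltsT (run x (back r zero)) τ τ₂ (j * suc k + (suc (toℕ i) + suc t))
    scan-back {x} {i} {f = f} Ix {v} {g} T r zero le {τ} {τ₂} {t} H K =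
      step Ix {τ₂ = τ₂} blank (trans (here-holds H) (T i 0))
        (walk-L (home r) (leftward-home Ix r) (toℕ i) (offset i) (toℕ-offset i) {p = 0} (stay H (T i 0))
          (λ {τ} H′ → step Ix {τ₂ = τ₂} (scan τ) refl (K (stay H′ (sym (here-holds H′))))))
    scan-back {x} {i} Ix {v} {g} T r (suc j) le {τ} {τ₂} {t} H K
      with cell-below (lookup v i) (suc j) (s≤s z≤n) le
    ... | b , cb = subst (HaltsT (run x (back r zero)) τ τ₂) (sym (cong suc (+-assoc k (j * suc k) _)))
        (step Ix {τ₂ = τ₂} (bit b) (trans (here-holds H) gj)
          (walk-L (back r) (leftward-back Ix r) k one-block toℕ-one-block
            (subst (Holds _ g) (sym (pos-suc i j)) (stay H gj))
            (λ H′ → scan-back Ix {v} T r j (≤-trans (n≤1+n j) le) H′ K)))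
      where
      gj : g (pos i (suc j)) ≡ bit b
      gj = trans (T i (suc j)) cb

    start : ∀ {x i w f} → I x ≡ onStack (suc i) w f → ∀ {v g} → Tracks v g → ∀ {τ τ₂ t} → Holds τ g 0 →
            (∀ {τ} → Holds τ g (pos i (suc (length (lookup v i)))) → HaltsT (run x (out zero)) τ τ₂ t) →
            HaltsT (run x go) τ τ₂ (suc ((k + toℕ i) + (length (lookup v i) * suc k + t)))
    start {x} {i} Ix {v} {g} T {τ} {τ₂} H K = step Ix {τ₂ = τ₂} (scan τ) refl
      (walk-R Ix (k + toℕ i) (first-block i) (toℕ-first-block i) (stay H (sym (here-holds H)))
        (λ H′ → scan-out Ix {v} T (length (lookup v i)) 1 (s≤s z≤n) (+-comm _ 1)
          (subst (λ n → Holds _ g (n + toℕ i)) (sym (+-identityʳ k)) H′) K))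

    push-track : ∀ {x i b f} → I x ≡ onStack (suc i) (just b) f → ∀ {v g} → Tracks v g → ∀ {τ τ₂ t H} →
                 length (lookup v i) ≤ H → Holds τ g 0 →
                 (∀ {τ g} → Tracks (v [ i ]≔ (b ∷ lookup v i)) g → Holds τ g 0 → HaltsT (run (f nothing) go) τ τ₂ t) →
                 HaltsT (run x go) τ τ₂ (opTime H t)
    push-track {x} {i} {b} {f} Ix {v} {g} T {τ} {τ₂} {t} {H} h≤H Hτ K =
      HaltsT-mono (run x go) τ τ₂ time
        (start Ix {v} T Hτ (λ H₁ →
          step Ix {τ₂ = τ₂} blank (trans (here-holds H₁) (trans (T i (suc h)) (cell-above (lookup v i) (suc h) ≤-refl)))
            (walk-L (back nothing) (leftward-back Ix nothing) k one-block toℕ-one-block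
              (subst (Holds _ g′) (sym (pos-suc i h)) (holds-write (bit b) H₁ (setAt-here _ _ g) (setAt-off _ _ g)))
              (λ H₂ → scan-back Ix {v [ i ]≔ l} T′ nothing h h≤ H₂ (K T′)))))
      where
      h = length (lookup v i)
      l = b ∷ lookup v i
      g′ : ℕ → Sym
      g′ = setAt (pos i (suc h)) (bit b) g
      T′ : Tracks (v [ i ]≔ l) g′
      T′ = tracks-set v g i (bit b) l (suc h) T (cell-top b (lookup v i)) (cell-rest b (lookup v i))
      h≤ : h ≤ length (lookup (v [ i ]≔ l) i)
      h≤ rewrite lookup∘update i v l = n≤1+n h
      i≤k = <⇒≤ (toℕ<n i)
      time : suc ((k + toℕ i) + (h * suc k + suc (k + (h * suc k + (suc (toℕ i) + suc t))))) ≤ opTime H t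
      time = s≤s (+-mono-≤ (+-monoʳ-≤ k i≤k) (+-mono-≤ (*-monoˡ-≤ (suc k) h≤H)
        (s≤s (≤-trans (+-monoʳ-≤ k (+-mono-≤ (*-monoˡ-≤ (suc k) h≤H) (s≤s (+-monoˡ-≤ (suc t) i≤k))))
                      (+-monoʳ-≤ k (≤-trans (m≤n+m _ k) (n≤1+n _)))))))

    -- The list is a separate argument so that case analysis on `lookup v i` selects the
    -- continuation that is required.
    Popped : Fin k → Vec (List Bool) k → (Maybe Bool → X) → Tape → ℕ → List Bool → Set
    Popped i v f τ₂ t [] =
      ∀ {τ g} → Tracks v g → Holds τ g 0 → HaltsT (run (f nothing) go) τ τ₂ t
    Popped i v f τ₂ t (b ∷ l) =
      ∀ {τ g} → Tracks (v [ i ]≔ l) g → Holds τ g 0 → HaltsT (run (f (just b)) go) τ τ₂ t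

    pop-track : ∀ {x i f} → I x ≡ onStack (suc i) nothing f → ∀ {v g} → Tracks v g → ∀ {τ τ₂ t H} →
                length (lookup v i) ≤ H → Holds τ g 0 →
                Popped i v f τ₂ t (lookup v i) →
                HaltsT (run x go) τ τ₂ (opTime H t)
    pop-track {x} {i} {f} Ix {v} {g} T {τ} {τ₂} {t} {H} h≤H Hτ K with lookup v i in eq
    ... | [] = HaltsT-mono (run x go) τ τ₂ time
        (start Ix {v} T Hτ (λ H₁ →
          step Ix {τ₂ = τ₂} blank (trans (here-holds H₁) (trans (T i (suc h)) (cell-above (lookup v i) (suc h) ≤-refl)))
            (walk-L peek (leftward-peek Ix) k one-block toℕ-one-block
              (subst (Holds _ g) (sym (pos-suc i h)) (stay H₁ (trans (T i (suc h)) (cell-above (lookup v i) (suc h) ≤-refl))))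
              (λ H₂ → step Ix {τ₂ = τ₂} blank (trans (here-holds H₂) at-0)
                (walk-L (home nothing) (leftward-home Ix nothing) (toℕ i) (offset i) (toℕ-offset i) {p = 0}
                  (subst (Holds _ g) pos-0 (stay H₂ at-0))
                  (λ {τ} H₃ → step Ix {τ₂ = τ₂} (scan τ) refl (K T (stay H₃ (sym (here-holds H₃))))))))))
      where
      h = length (lookup v i)
      h≡0 : h ≡ 0
      h≡0 = cong length eq
      pos-0 : pos i h ≡ toℕ i
      pos-0 = cong (pos i) h≡0
      at-0 : g (pos i h) ≡ blank
      at-0 = trans (cong g pos-0) (T i 0)
      i≤k = <⇒≤ (toℕ<n i)
      time : suc ((k + toℕ i) + (h * suc k + suc (k + suc (toℕ i + suc t)))) ≤ opTime H t
      time = s≤s (+-mono-≤ (+-monoʳ-≤ k i≤k) (+-mono-≤ (*-monoˡ-≤ (suc k) (≤-trans (≤-reflexive h≡0) (z≤n {H})))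
        (s≤s (+-monoʳ-≤ k (s≤s (≤-trans (+-monoˡ-≤ (suc t) i≤k)
          (≤-trans (≤-trans (n≤1+n _) (m≤n+m _ (H * suc k))) (m≤n+m _ k))))))))
    ... | b ∷ l = HaltsT-mono (run x go) τ τ₂ time
        (start Ix {v} T Hτ (λ H₁ →
          step Ix {τ₂ = τ₂} blank (trans (here-holds H₁) (trans (T i (suc h)) (cell-above (lookup v i) (suc h) ≤-refl)))
            (walk-L peek (leftward-peek Ix) k one-block toℕ-one-block
              (subst (Holds _ g) (sym (pos-suc i h)) (stay H₁ (trans (T i (suc h)) (cell-above (lookup v i) (suc h) ≤-refl))))
              (λ H₂ → step Ix {τ₂ = τ₂} (bit b) (trans (here-holds H₂) at-h)
                (walk-L (back (just b)) (leftward-back Ix (just b)) k one-block toℕ-one-block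
                  (subst (Holds _ g′) (trans (cong (pos i) h≡) (sym (pos-suc i (length l))))
                    (holds-write blank H₂ (setAt-here _ _ g) (setAt-off _ _ g)))
                  (λ H₃ → scan-back Ix {v [ i ]≔ l} T′ (just b) (length l) h≤ H₃ (K T′)))))))
      where
      h = length (lookup v i)
      h≡ : h ≡ suc (length l)
      h≡ = cong length eq
      at-h : g (pos i h) ≡ bit b
      at-h = trans (T i h) (trans (cong₂ cell eq h≡) (cell-top b l))
      g′ : ℕ → Sym
      g′ = setAt (pos i h) blank g
      T′ : Tracks (v [ i ]≔ l) g′
      T′ = tracks-set v g i blank l h T (cell-above l h (≤-reflexive (sym h≡)))
             (λ j ne → sym (trans (cong (λ z → cell z j) eq) (cell-rest b l j (λ j≡ → ne (trans j≡ (sym h≡))))))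
      h≤ : length l ≤ length (lookup (v [ i ]≔ l) i)
      h≤ rewrite lookup∘update i v l = ≤-refl
      i≤k = <⇒≤ (toℕ<n i)
      time : suc ((k + toℕ i) + (h * suc k + suc (k + suc (k + (length l * suc k + (suc (toℕ i) + suc t)))))) ≤ opTime H t
      time = s≤s (+-mono-≤ (+-monoʳ-≤ k i≤k) (+-mono-≤ (*-monoˡ-≤ (suc k) (≤-trans (≤-reflexive h≡) h≤H))
        (s≤s (+-monoʳ-≤ k (s≤s (+-monoʳ-≤ k
          (+-mono-≤ (*-monoˡ-≤ (suc k) (≤-trans (n≤1+n _) h≤H)) (s≤s (+-monoˡ-≤ (suc t) i≤k)))))))))

    -- Height plus remaining time does not increase, since an instruction raises a stack by at most
    -- one and uses up one unit of time. The initial value thus bounds all heights of the run, and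
    -- with them the length of every walk.
    Low : ℕ → ℕ → Vec (List Bool) k → Set
    Low H t v = ∀ i → length (lookup v i) + t ≤ H

    low-set : ∀ {H t v} i l → length l ≤ suc (length (lookup v i)) → Low H (suc t) v → Low H t (v [ i ]≔ l)
    low-set {H} {t} {v} i l le low i′ with i′ Data.Fin.≟ i
    ... | yes refl rewrite lookup∘update i v l =
          ≤-trans (+-monoˡ-≤ t le) (≤-trans (≤-reflexive (sym (+-suc _ t))) (low i))
    ... | no ne rewrite lookup∘update′ ne v l =
          ≤-trans (+-monoʳ-≤ _ (n≤1+n t)) (low i′)

    low-same : ∀ {H t v} → Low H (suc t) v → Low H t v
    low-same low i = ≤-trans (+-monoʳ-≤ _ (n≤1+n _)) (low i)

    low-height : ∀ {H t v} → Low H t v → ∀ i → length (lookup v i) ≤ H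
    low-height low i = m+n≤o⇒m≤o _ (low i)

    two≤opTime : ∀ H t → suc (suc t) ≤ opTime H t
    two≤opTime H t = s≤s (grow (k + k) (grow (H * suc k) (≤-trans (grow k (≤-trans (grow k
        (grow (H * suc k) (m≤n+m (suc t) (suc k)))) (n≤1+n _))) (n≤1+n _))))
      where
      grow : ∀ {m n} l → m ≤ n → m ≤ l + n
      grow l le = ≤-trans le (m≤n+m _ l)

    mutual
      simulate : ∀ {H} t x {z v g τ τ₂} → HaltsF x (z ∷ v) t → Low H t v → Tracks v g → Holds τ g 0 →
                 QueryTape z τ₂ → HaltsT (run x go) τ τ₂ (totalTime H t)
      simulate (suc t) x h low T Hτ qt = simulate-instr t x (I x) refl h low T Hτ qt

      simulate-instr : ∀ {H} t x ι → I x ≡ ι → ∀ {z v g τ τ₂} → exec ι (z ∷ v) t → Low H (suc t) v →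
                       Tracks v g → Holds τ g 0 → QueryTape z τ₂ →
                       HaltsT (run x go) τ τ₂ (opTime H (totalTime H t))
      simulate-instr {H} t x (onStack zero (just b) f) Ix {z} {v} {g} {τ} {τ₂} h low T Hτ qt =
        HaltsT-mono (run x go) τ τ₂ (≤-trans (n≤1+n _) (two≤opTime H _))
          (performs _ (cong (λ ι → execute ι x go (scan τ) (scan τ₂)) Ix)
            (simulate t (f nothing) h (low-same {v = v} low) T (stay Hτ (sym (here-holds Hτ)))
              (queryTape-push z τ₂ b qt)))
      simulate-instr {H} t x (onStack zero nothing f) Ix {[]} {v} {g} {τ} {τ₂} h low T Hτ qt =
        HaltsT-mono (run x go) τ τ₂ (two≤opTime H _)
          (performs _ (cong (λ ι → execute ι x go (scan τ) (scan τ₂)) Ix)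
            (performs _ (trans (cong (λ ι → execute ι x zread (scan τ) _) Ix)
                               (cong (onQueryTape nothing f x zread (scan τ)) (queryTape-[]-top τ₂ qt)))
              (simulate t (f nothing) h (low-same {v = v} low) T (stay Hτ (sym (here-holds Hτ)))
                (queryTape-[] τ₂ qt))))
      simulate-instr {H} t x (onStack zero nothing f) Ix {b ∷ z} {v} {g} {τ} {τ₂} h low T Hτ qt =
        HaltsT-mono (run x go) τ τ₂ (two≤opTime H _)
          (performs _ (cong (λ ι → execute ι x go (scan τ) (scan τ₂)) Ix)
            (performs _ (trans (cong (λ ι → execute ι x zread (scan τ) _) Ix)
                               (cong (onQueryTape nothing f x zread (scan τ)) (queryTape-top b z τ₂ qt)))
              (simulate t (f (just b)) h (low-same {v = v} low) T (stay Hτ (sym (here-holds Hτ)))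
                (queryTape-pop b z τ₂ qt))))
      simulate-instr {H} t x (onStack (suc i) (just b) f) Ix {z} {v} h low T Hτ qt =
        push-track Ix {v} T (low-height {v = v} low i) Hτ
          (λ T′ Hτ′ → simulate t (f nothing) h (low-set {v = v} i _ ≤-refl low) T′ Hτ′ qt)
      simulate-instr {H} t x (onStack (suc i) nothing f) Ix {z} {v} {τ₂ = τ₂} h low T Hτ qt =
        pop-track Ix {v} T (low-height {v = v} low i) Hτ (popped (lookup v i) refl h)
        where
        popped : ∀ l → lookup v i ≡ l → afterPop (suc i) (z ∷ v) (λ m v′ → HaltsF (f m) v′ t) l →
                 Popped i v f τ₂ (totalTime H t) l
        popped []      eq h T′ Hτ′ = simulate t (f nothing) h (low-same {v = v} low) T′ Hτ′ qt
        popped (b ∷ l) eq h T′ Hτ′ = simulate t (f (just b)) h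
          (low-set {v = v} i l (≤-trans (n≤1+n _) (≤-trans (≤-reflexive (cong length (sym eq))) (n≤1+n _))) low) T′ Hτ′ qt
      simulate-instr {H} t x (ask f) Ix {z} {v} {g} {τ} {τ₂} h low T Hτ qt =
        HaltsT-mono (run x go) τ τ₂ (≤-trans (n≤1+n _) (two≤opTime H _))
          (performs _ (cong (λ ι → execute ι x go (scan τ) (scan τ₂)) Ix)
            (subst (λ u → Br u (λ b → HaltsT (if b then run (f true) go else run (f false) go) τ τ₂ (totalTime H t))) (sym (contents-queryTape z τ₂ qt))
              (Br-map (λ { true  h′ → simulate t (f true) h′ (low-same {v = v} low) T Hτ qt
                         ; false h′ → simulate t (f false) h′ (low-same {v = v} low) T Hτ qt }) h)))
      simulate-instr {H} t x (halt o) Ix {z} {v} {g} {τ} {τ₂} h low T Hτ qt =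
        HaltsT-mono (run x go) τ τ₂ {1} (s≤s z≤n)
          (performs _ (cong (λ ι → execute ι x go (scan τ) (scan τ₂)) Ix) h)
      simulate-instr {H} t x (tick y) Ix {z} {v} {g} {τ} {τ₂} h low T Hτ qt =
        HaltsT-mono (run x go) τ τ₂ (≤-trans (n≤1+n _) (two≤opTime H _))
          (performs _ (cong (λ ι → execute ι x go (scan τ) (scan τ₂)) Ix)
            (simulate t y h (low-same {v = v} low) T (stay Hτ (sym (here-holds Hτ))) qt′))
        where
        qt′ : QueryTape z (moveT S (write (scan τ₂) τ₂))
        qt′ = qt

    wordTape : ℕ → Word → Tape
    wordTape n []      = tape (replicate n blank) blank []
    wordTape n (b ∷ x) = tape (replicate n blank) (bit b) (map bit x)

    wordTape-next : ∀ n b x → moveT R (write blank (wordTape n (b ∷ x))) ≡ wordTape (suc n) x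
    wordTape-next n b []      = refl
    wordTape-next n b (c ∷ x) = refl

    load-input : ∀ x n {z τ₂ t} → QueryTape z τ₂ →
                 (∀ {τ τ₂} → Tracks (Vec.replicate k []) (λ _ → blank) → Holds τ (λ _ → blank) 0 →
                    QueryTape (x ʳ++ z) τ₂ → HaltsT (run x₀ go) τ τ₂ t) →
                 HaltsT load (wordTape n x) τ₂ (suc (length x) + t)
    load-input [] n {z} {τ₂ = tape _ _ _} qt@(_ , refl , _) K = K tracks (holds fw (λ _ ())) qt
      where
      fw : ∀ m → nth (blank ∷ []) m ≡ blank
      fw zero    = refl
      fw (suc m) = refl
      tracks : Tracks (Vec.replicate k []) (λ _ → blank)
      tracks i zero    = refl
      tracks i (suc j) = cong (λ l → cell′ l j) (sym (lookup-replicate i []))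
    load-input (b ∷ x) n {z} {τ₂} {t} qt K =
      subst (λ τ → HaltsT load τ (moveT R (write (bit b) τ₂)) (suc (length x) + t)) (sym (wordTape-next n b x))
        (load-input x (suc n) (queryTape-push z τ₂ b qt) K)

-- The underscore is the local function of inputTape, which has no name here.
mutual
  inputTape-right : ∀ b x → right (inputTape (b ∷ x)) ≡ map bit x
  inputTape-right b []      = refl
  -- The local function also depends on the variables of its enclosing clause; abstracting `c ∷ x`
  -- separates this fixed tail from the list that shrinks.
  inputTape-right b (c ∷ x) with c ∷ x
  ... | w = cong (bit c ∷_) (map-bit b w x)

  map-bit : ∀ b w x → _ ≡ map bit x
  map-bit b w []      = refl
  map-bit b w (c ∷ x) = cong (bit c ∷_) (map-bit b w x)

-- Polynomials

record IsPoly (f : ℕ → ℕ) : Set where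
  constructor isPoly
  field
    poly  : Poly
    evals : ∀ n → f n ≡ evalP poly n
open IsPoly public

poly-cong : ∀ {f g} → (∀ n → f n ≡ g n) → IsPoly g → IsPoly f
poly-cong eq (isPoly p gp) = isPoly p λ n → trans (eq n) (gp n)

poly-evalP : ∀ p → IsPoly (evalP p)
poly-evalP p = isPoly p λ _ → refl

poly-const : ∀ c → IsPoly (λ _ → c)
poly-const c = isPoly (c ∷ []) λ n → sym (trans (cong (c +_) (*-zeroʳ n)) (+-identityʳ c))

poly-id : IsPoly id
poly-id = isPoly (0 ∷ 1 ∷ []) λ n → sym (trans (cong (n *_) (cong suc (*-zeroʳ n))) (*-identityʳ n))

addP : Poly → Poly → Poly
addP []       q        = q
addP (a ∷ p)  []       = a ∷ p
addP (a ∷ p)  (b ∷ q)  = a + b ∷ addP p q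

eval-addP : ∀ p q n → evalP p n + evalP q n ≡ evalP (addP p q) n
eval-addP []      q       n = refl
eval-addP (a ∷ p) []      n = +-identityʳ _
eval-addP (a ∷ p) (b ∷ q) n =
  trans (solve 5 (λ a b n x y → (a :+ n :* x) :+ (b :+ n :* y) := (a :+ b) :+ n :* (x :+ y)) refl a b n (evalP p n) (evalP q n))
        (cong (λ z → a + b + n * z) (eval-addP p q n))
  where open +-*-Solver

scaleP : ℕ → Poly → Poly
scaleP c = map (c *_)

eval-scaleP : ∀ c p n → c * evalP p n ≡ evalP (scaleP c p) n
eval-scaleP c []      n = *-zeroʳ c
eval-scaleP c (a ∷ p) n =
  trans (solve 4 (λ c a n x → c :* (a :+ n :* x) := c :* a :+ n :* (c :* x)) refl c a n (evalP p n))
        (cong (λ z → c * a + n * z) (eval-scaleP c p n))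
  where open +-*-Solver

mulP : Poly → Poly → Poly
mulP []      q = []
mulP (a ∷ p) q = addP (scaleP a q) (0 ∷ mulP p q)

eval-mulP : ∀ p q n → evalP p n * evalP q n ≡ evalP (mulP p q) n
eval-mulP []      q n = refl
eval-mulP (a ∷ p) q n =
  trans (solve 4 (λ a n x y → (a :+ n :* x) :* y := a :* y :+ n :* (x :* y)) refl a n (evalP p n) (evalP q n))
        (trans (cong₂ (λ y z → y + n * z) (eval-scaleP a q n) (eval-mulP p q n))
               (eval-addP (scaleP a q) (0 ∷ mulP p q) n))
  where open +-*-Solver

composeP : Poly → Poly → Poly
composeP []      q = []
composeP (a ∷ p) q = addP (a ∷ []) (mulP q (composeP p q))

eval-composeP : ∀ p q n → evalP p (evalP q n) ≡ evalP (composeP p q) n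
eval-composeP []      q n = refl
eval-composeP (a ∷ p) q n =
  trans (cong₂ _+_ (evals (poly-const a) n)
                   (trans (cong (evalP q n *_) (eval-composeP p q n)) (eval-mulP q (composeP p q) n)))
        (eval-addP (a ∷ []) (mulP q (composeP p q)) n)

infixl 6 _+ᵖ_
infixl 7 _*ᵖ_
_+ᵖ_ : ∀ {f g} → IsPoly f → IsPoly g → IsPoly (λ n → f n + g n)
isPoly p fp +ᵖ isPoly q gq = isPoly (addP p q) λ n → trans (cong₂ _+_ (fp n) (gq n)) (eval-addP p q n)

_*ᵖ_ : ∀ {f g} → IsPoly f → IsPoly g → IsPoly (λ n → f n * g n)
isPoly p fp *ᵖ isPoly q gq = isPoly (mulP p q) λ n → trans (cong₂ _*_ (fp n) (gq n)) (eval-mulP p q n)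

poly-∘ : ∀ {f g} → IsPoly f → IsPoly g → IsPoly (λ n → f (g n))
poly-∘ {f} (isPoly p fp) (isPoly q gq) = isPoly (composeP p q) λ n → trans (cong f (gq n)) (trans (fp _) (eval-composeP p q n))

evalP-mono : ∀ p {m n} → m ≤ n → evalP p m ≤ evalP p n
evalP-mono []      le = z≤n
evalP-mono (a ∷ p) le = +-monoʳ-≤ a (*-mono-≤ le (evalP-mono p le))

-- Deterministic and nondeterministic Turing machines from finite state sets

module Number {Q : Set} (F : Finite Q) (δ : Q → Sym → Sym → Act Q) (q₀ : Q) where
  open Finite F

  numberD : Act Q → Action size Bool
  numberD (move q w₁ w₂ d₁ d₂) = move (enc q) w₁ w₂ d₁ d₂
  numberD (ask qy qn)          = ask (enc qy) (enc qn)
  numberD (halt o)             = halt o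

  toDOTM : DOTM
  toDOTM = record { nst = size ; start = enc q₀ ; δ = λ q s₁ s₂ → numberD (δ (dec q) s₁ s₂) }

  verdict : Bool → Outcome
  verdict true  = acc
  verdict false = rej

  -- Queries become free choices.
  numberN : Act Q → Sym → Sym → List (Action size Outcome)
  numberN (move q w₁ w₂ d₁ d₂) s₁ s₂ = move (enc q) w₁ w₂ d₁ d₂ ∷ []
  numberN (ask qy qn)          s₁ s₂ = move (enc qy) s₁ s₂ S S ∷ move (enc qn) s₁ s₂ S S ∷ []
  numberN (halt o)             s₁ s₂ = halt (verdict o) ∷ []

  toNOTM : NOTM
  toNOTM = record { nst = size ; start = enc q₀ ; δ = λ q s₁ s₂ → numberN (δ (dec q) s₁ s₂) s₁ s₂ }

  runD-halts : ∀ D P q τ₁ τ₂ t → Run.HaltsT (byOracle D) P δ q τ₁ τ₂ t →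
               Σ Bool λ o → P o × runD toDOTM D (cfg (enc q) τ₁ τ₂) t ≡ just o
  runD-halts D P q τ₁ τ₂ (suc t) h rewrite dec-enc q with δ q (scan τ₁) (scan τ₂)
  ... | move q′ w₁ w₂ d₁ d₂ = runD-halts D P q′ _ _ t h
  ... | halt o = o , h , refl
  ... | ask qy qn with D (contents τ₂)
  ...   | true  = runD-halts D P qy _ _ t h
  ...   | false = runD-halts D P qn _ _ t h

  module Free (D : Lang) where

    haltsWithin : ∀ P q τ₁ τ₂ t → Run.HaltsT everyAnswer P δ q τ₁ τ₂ t →
                  HaltsWithin toNOTM D (cfg (enc q) τ₁ τ₂) t
    haltsWithin P q τ₁ τ₂ (suc t) h = hw nonempty all
      where
      c = cfg (enc q) τ₁ τ₂
      acts≡ : acts toNOTM D c ≡ numberN (δ q (scan τ₁) (scan τ₂)) (scan τ₁) (scan τ₂)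
      acts≡ = cong (λ q → numberN (δ q (scan τ₁) (scan τ₂)) (scan τ₁) (scan τ₂)) (dec-enc q)
      nonempty : acts toNOTM D c ≢ []
      nonempty eq with δ q (scan τ₁) (scan τ₂) | trans (sym acts≡) eq
      ... | move _ _ _ _ _ | ()
      ... | ask _ _        | ()
      ... | halt _         | ()
      all : All (λ a → NextHalts toNOTM D t (stepAct D c a)) (acts toNOTM D c)
      all rewrite dec-enc q with δ q (scan τ₁) (scan τ₂)
      ... | move q′ w₁ w₂ d₁ d₂ = cont (haltsWithin P q′ _ _ t h) ∷ []
      ... | halt o = done ∷ []
      ... | ask qy qn = cont (haltsWithin P qy _ _ t (h true)) ∷ cont (haltsWithin P qn _ _ t (h false)) ∷ []

    acts-≡ : ∀ q τ₁ τ₂ {act} → δ q (scan τ₁) (scan τ₂) ≡ act →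
             acts toNOTM D (cfg (enc q) τ₁ τ₂) ≡ numberN act (scan τ₁) (scan τ₂)
    acts-≡ q τ₁ τ₂ refl = cong (λ q → numberN (δ q (scan τ₁) (scan τ₂)) (scan τ₁) (scan τ₂)) (dec-enc q)

    yields-acc : ∀ q τ₁ τ₂ t → Run.HaltsT someAnswer (_≡ true) δ q τ₁ τ₂ t →
                 Yields toNOTM D (cfg (enc q) τ₁ τ₂) acc
    yields-acc q τ₁ τ₂ (suc t) h with δ q (scan τ₁) (scan τ₂) in eq
    yields-acc q τ₁ τ₂ (suc t) h | move q′ w₁ w₂ d₁ d₂ =
      there (subst (move (enc q′) w₁ w₂ d₁ d₂ ∈_) (sym (acts-≡ q τ₁ τ₂ eq)) (∈-here refl)) refl (yields-acc q′ _ _ t h)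
    yields-acc q τ₁ τ₂ (suc t) refl | halt true =
      here (subst (halt acc ∈_) (sym (acts-≡ q τ₁ τ₂ eq)) (∈-here refl)) refl
    yields-acc q τ₁ τ₂ (suc t) (true , h) | ask qy qn =
      there (subst (move (enc qy) (scan τ₁) (scan τ₂) S S ∈_) (sym (acts-≡ q τ₁ τ₂ eq)) (∈-here refl)) refl (yields-acc qy _ _ t h)
    yields-acc q τ₁ τ₂ (suc t) (false , h) | ask qy qn =
      there (subst (move (enc qn) (scan τ₁) (scan τ₂) S S ∈_) (sym (acts-≡ q τ₁ τ₂ eq)) (∈-there (∈-here refl))) refl (yields-acc qn _ _ t h)

    mutual
      -- `Yields` carries no time; the bound comes from the halting of all branches, whose time
      -- decreases along the given accepting branch.
      acc-reached : ∀ P q τ₁ τ₂ t → Run.HaltsT everyAnswer P δ q τ₁ τ₂ t →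
                    Yields toNOTM D (cfg (enc q) τ₁ τ₂) acc → Run.HaltsT someAnswer (_≡ true) δ q τ₁ τ₂ t
      acc-reached P q τ₁ τ₂ (suc t) h (here a∈ eq) =
        acc-now P _ τ₁ τ₂ t (subst (_ ∈_) (acts-≡ q τ₁ τ₂ refl) a∈) eq
      acc-reached P q τ₁ τ₂ (suc t) h (there a∈ eq y) =
        acc-later P _ τ₁ τ₂ t h (subst (_ ∈_) (acts-≡ q τ₁ τ₂ refl) a∈) eq y

      acc-now : ∀ P act τ₁ τ₂ t {a q} → a ∈ numberN act (scan τ₁) (scan τ₂) →
                stepAct D (cfg q τ₁ τ₂) a ≡ inj₂ acc → Run.perform someAnswer (_≡ true) δ act τ₁ τ₂ t
      acc-now P (halt true) τ₁ τ₂ t (∈-here refl) eq = refl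
      acc-now P (halt false) τ₁ τ₂ t (∈-here refl) ()
      acc-now P (move _ _ _ _ _) τ₁ τ₂ t (∈-here refl) ()
      acc-now P (ask _ _) τ₁ τ₂ t (∈-here refl) ()
      acc-now P (ask _ _) τ₁ τ₂ t (∈-there (∈-here refl)) ()

      acc-later : ∀ P act τ₁ τ₂ t {a q c} → Run.perform everyAnswer P δ act τ₁ τ₂ t →
                  a ∈ numberN act (scan τ₁) (scan τ₂) →
                  stepAct D (cfg q τ₁ τ₂) a ≡ inj₁ c → Yields toNOTM D c acc →
                  Run.perform someAnswer (_≡ true) δ act τ₁ τ₂ t
      acc-later P (halt _) τ₁ τ₂ t h (∈-here refl) () y
      acc-later P (move _ _ _ _ _) τ₁ τ₂ t h (∈-here refl) refl y = acc-reached P _ _ _ t h y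
      acc-later P (ask _ _) τ₁ τ₂ t h (∈-here refl) refl y = true , acc-reached P _ _ _ t (h true) y
      acc-later P (ask _ _) τ₁ τ₂ t h (∈-there (∈-here refl)) refl y = false , acc-reached P _ _ _ t (h false) y

  -- Within a time bound the tree of free choices is finite, so acceptance is decided by searching
  -- it. This yields the characteristic function of the accepted language.
  someAnswer? : ∀ q τ₁ τ₂ t → Dec (Run.HaltsT someAnswer (_≡ true) δ q τ₁ τ₂ t)
  someAnswer? q τ₁ τ₂ zero = no λ ()
  someAnswer? q τ₁ τ₂ (suc t) with δ q (scan τ₁) (scan τ₂)
  ... | move q′ w₁ w₂ d₁ d₂ = someAnswer? q′ _ _ t
  ... | halt o = o ≟ᵇ true
  ... | ask qy qn = map′ (λ { (inj₁ h) → true , h ; (inj₂ h) → false , h })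
                         (λ { (true , h) → inj₁ h ; (false , h) → inj₂ h })
                         (someAnswer? qy τ₁ τ₂ t ⊎-dec someAnswer? qn τ₁ τ₂ t)

  mutual
    -- The accepting branch may come with any time bound `t′`. As all branches end within `t` with a
    -- verdict satisfying `P`, this one does so too.
    some-within : ∀ P q τ₁ τ₂ t t′ → Run.HaltsT everyAnswer P δ q τ₁ τ₂ t →
                  Run.HaltsT someAnswer (_≡ true) δ q τ₁ τ₂ t′ →
                  Run.HaltsT someAnswer (_≡ true) δ q τ₁ τ₂ t × P true
    some-within P q τ₁ τ₂ (suc t) (suc t′) h h′ = some-within′ P (δ q (scan τ₁) (scan τ₂)) τ₁ τ₂ t t′ h h′

    some-within′ : ∀ P act τ₁ τ₂ t t′ → Run.perform everyAnswer P δ act τ₁ τ₂ t →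
                   Run.perform someAnswer (_≡ true) δ act τ₁ τ₂ t′ →
                   Run.perform someAnswer (_≡ true) δ act τ₁ τ₂ t × P true
    some-within′ P (move q w₁ w₂ d₁ d₂) τ₁ τ₂ t t′ h h′ = some-within P q _ _ t t′ h h′
    some-within′ P (halt true) τ₁ τ₂ t t′ h refl = refl , h
    some-within′ P (ask qy qn) τ₁ τ₂ t t′ h (b , h′) =
      let h″ , p = some-within P _ τ₁ τ₂ t t′ (h b) h′ in (b , h″) , p

  -- `total` does double duty: it bounds the length of all branches, and it makes every verdict `o`
  -- satisfy `P x o`, from which soundness of acceptance follows.
  module Nondeterministic (time : Poly) (P : Word → Bool → Set)
           (total : ∀ x → Run.HaltsT everyAnswer (P x) δ q₀ (inputTape x) emptyTape (evalP time (length x))) where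

    budget : Word → ℕ
    budget x = evalP time (length x)

    accepts? : ∀ x → Dec (Run.HaltsT someAnswer (_≡ true) δ q₀ (inputTape x) emptyTape (budget x))
    accepts? x = someAnswer? q₀ (inputTape x) emptyTape (budget x)

    language : Lang
    language x = does (accepts? x)

    inNP : InNP language
    inNP = toNOTM , (time , λ D x → Free.haltsWithin D (P x) q₀ (inputTape x) emptyTape (budget x) (total x)) , accepts
      where
      accepts : AcceptsL toNOTM ∅ language
      accepts x with accepts? x
      ... | yes h = mk⇔ (λ _ → Free.yields-acc ∅ q₀ (inputTape x) emptyTape (budget x) h) (λ _ → refl)
      ... | no ¬h = mk⇔ (λ ()) (λ y → ⊥-elim (¬h (Free.acc-reached ∅ (P x) q₀ (inputTape x) emptyTape (budget x) (total x) y)))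

    language-sound : ∀ x → language x ≡ true → P x true
    language-sound x eq with accepts? x
    ... | yes h = proj₂ (some-within (P x) q₀ (inputTape x) emptyTape (budget x) (budget x) (total x) h)
    language-sound x () | no ¬h

    language-complete : ∀ x t → Run.HaltsT someAnswer (_≡ true) δ q₀ (inputTape x) emptyTape t → language x ≡ true
    language-complete x t h with accepts? x
    ... | yes _ = refl
    ... | no ¬h = ⊥-elim (¬h (proj₁ (some-within (P x) q₀ (inputTape x) emptyTape (budget x) t (total x) h)))

-- Compiled programs and their polynomial running time

module Program {k : ℕ} (root : Cmd k ⊥) where

  I : Pos root → Instr k (Pos root)
  I = instr root ⊥-elim id

  open Machine I (entry root) public
  open Number (finite-State B (finite-Pos root)) δ load public

  initial : Word → Stacks k
  initial x = (x ʳ++ []) ∷ Vec.replicate k []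

  -- Loading the input takes `suc n` steps. The tracks start empty, so the program time `t` also
  -- bounds the heights of their stacks.
  runTime : ℕ → ℕ → ℕ
  runTime n t = suc n + totalTime t t

  opCost : ℕ → ℕ
  opCost H = H * (2 * suc k) + (5 + 5 * k)

  opTime-≡ : ∀ H t → opTime H t ≡ opCost H + t
  opTime-≡ H t = solve 3 (λ k H t →
      con 1 :+ ((k :+ k) :+ (H :* (con 1 :+ k) :+ (con 1 :+ (k :+ (con 1 :+ (k :+ (H :* (con 1 :+ k) :+ (con 1 :+ k :+ (con 1 :+ t)))))))))
      := (H :* (con 2 :* (con 1 :+ k)) :+ (con 5 :+ con 5 :* k)) :+ t) refl k H t
    where open +-*-Solver

  totalTime-≡ : ∀ H t → totalTime H t ≡ t * opCost H
  totalTime-≡ H zero    = refl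
  totalTime-≡ H (suc t) = trans (opTime-≡ H _) (cong (opCost H +_) (totalTime-≡ H t))

  poly-opCost : IsPoly opCost
  poly-opCost = poly-id *ᵖ poly-const (2 * suc k) +ᵖ poly-const (5 + 5 * k)

  poly-runTime : ∀ {T} → IsPoly T → IsPoly (λ n → runTime n (T n))
  poly-runTime {T} pT = poly-cong (λ n → cong (suc n +_) (totalTime-≡ (T n) (T n)))
    (poly-const 1 +ᵖ poly-id +ᵖ pT *ᵖ poly-∘ poly-opCost pT)

  module _ (br : Branching) (P : Bool → Set) where
    open Correct br P
    open Run br P δ

    compiled : ∀ x t → Semantics.Halts br P root nil (initial x) t →
               HaltsT load (inputTape x) emptyTape (runTime (length x) t)
    compiled x t h = subst (λ τ → HaltsT load τ emptyTape (runTime (length x) t)) (wordTape≡ x)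
        (load-input x 0 {z = []} ((0 , refl) , refl , (0 , refl))
          (λ T Hτ qt → simulate t (entry root) (Flat.placed br P I root (λ _ → refl) Flat.nil t h) low T Hτ qt))
      where
      wordTape≡ : ∀ x → wordTape 0 x ≡ inputTape x
      wordTape≡ []      = refl
      wordTape≡ (b ∷ x) = cong (tape [] (bit b)) (sym (inputTape-right b x))
      low : Low t t (Vec.replicate k [])
      low i = ≤-reflexive (cong (λ l → length l + t) (lookup-replicate i []))

    polyCompiled : ∀ {T} (pT : IsPoly T) x → Semantics.Halts br P root nil (initial x) (T (length x)) →
                   HaltsT load (inputTape x) emptyTape (evalP (poly (poly-runTime pT)) (length x))
    polyCompiled pT x h = subst (HaltsT load (inputTape x) emptyTape) (evals (poly-runTime pT) (length x)) (compiled x _ h)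

  -- The time bound is established under every oracle together with a property of the verdict; this
  -- property has to imply correctness for `B` only.
  reduces : ∀ {T A B} → IsPoly T → (Good : Lang → Word → Bool → Set) →
            (∀ D x → Semantics.Halts (byOracle D) (Good D x) root nil (initial x) (T (length x))) →
            (∀ x o → Good B x o → o ≡ A x) → A ≤pT B
  reduces {T} {A} {B} pT Good halts right = toDOTM , time ,
      (λ D x → proj₁ (result D x) , proj₂ (proj₂ (result D x))) ,
      (λ x → trans (proj₂ (proj₂ (result B x))) (cong just (right x _ (proj₁ (proj₂ (result B x))))))
    where
    time : Poly
    time = poly (poly-runTime pT)
    result : ∀ D x → Σ Bool λ o → Good D x o × runD toDOTM D (initD toDOTM x) (evalP time (length x)) ≡ just o
    result D x = runD-halts D (Good D x) load (inputTape x) emptyTape (evalP time (length x)) (polyCompiled (byOracle D) (Good D x) pT x (halts D x))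

-- Program macros and their execution rules

-- The flag lies above its bit, so one or two pops read a symbol. The exhausted stack reads as a
-- blank under `popSym`, which matches a tape half that is extended on demand.
code : List Sym → List Bool
code []          = []
code (blank ∷ l) = false ∷ code l
code (bit b ∷ l) = true ∷ b ∷ code l

Loop : ∀ {k R} → Cmd k (⊤ ⊎ ⊤) → Cmd k R → Cmd k R
Loop b c = iter finite-⊤ finite-⊤ (λ _ → b) tt (λ _ → c)

transfer-body : ∀ {k} → Fin (suc k) → (Bool → Cmd k (⊤ ⊎ ⊤) → Cmd k (⊤ ⊎ ⊤)) → Maybe Bool → Cmd k (⊤ ⊎ ⊤)
transfer-body i w nothing  = ret (inj₂ tt)
transfer-body i w (just b) = w b (ret (inj₁ tt))

transfer : ∀ {k R} → Fin (suc k) → (Bool → Cmd k (⊤ ⊎ ⊤) → Cmd k (⊤ ⊎ ⊤)) → Cmd k R → Cmd k R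
transfer i w c = Loop (pop i (transfer-body i w)) c

pushSym : ∀ {k R} → Fin (suc k) → Sym → Cmd k R → Cmd k R
pushSym i blank   c = push i false c
pushSym i (bit b) c = push i b (push i true c)

popBit : ∀ {k R} → (Sym → Cmd k R) → Maybe Bool → Cmd k R
popBit f nothing  = f blank
popBit f (just b) = f (bit b)

popSym′ : ∀ {k R} → Fin (suc k) → Cmd k R → (Sym → Cmd k R) → Maybe Bool → Cmd k R
popSym′ i c f nothing      = c
popSym′ i c f (just false) = f blank
popSym′ i c f (just true)  = pop i (popBit f)

popSym : ∀ {k R} → Fin (suc k) → (Sym → Cmd k R) → Cmd k R
popSym i f = pop i (popSym′ i (f blank) f)

shift : ∀ {k R} → Dir → Fin (suc k) → Fin (suc k) → Sym → (Sym → Cmd k R) → Cmd k R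
shift S i j s f = f s
shift R i j s f = pushSym i s (popSym j f)
shift L i j s f = pushSym j s (popSym i f)

symTransfer : ∀ {k R} → Fin (suc k) → (Sym → Cmd k (⊤ ⊎ ⊤) → Cmd k (⊤ ⊎ ⊤)) → Cmd k R → Cmd k R
symTransfer i w c = Loop (pop i (popSym′ i (ret (inj₂ tt)) (λ s → w s (ret (inj₁ tt))))) c

-- A lens onto one stack: `W` describes the whole configuration as a function of stack `i`. For
-- explicit vectors both laws hold by `refl`, so that the rules below can be shared by all programs.
record Slot {k} (i : Fin (suc k)) (W : List Bool → Stacks k) : Set where
  constructor slot
  field
    get : ∀ a → lookup (W a) i ≡ a
    set : ∀ a a′ → W a [ i ]≔ a′ ≡ W a′

module Rules (br : Branching) (P : Bool → Set) where
  open Branching br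
  open Semantics br P

  -- Halts, packed so that its arguments can be inferred.
  record Runs {k R} (c : Cmd k R) (fr : Frames k R) (v : Stacks k) (t : ℕ) : Set where
    constructor runs
    field unpack : Halts c fr v t
  open Runs public

  mono : ∀ {k R} {c : Cmd k R} {fr v t t′} → t ≤ t′ → Runs c fr v t → Runs c fr v t′
  mono {c = c} {fr} {v} le (runs h) = runs (Halts-mono c fr v le h)

  push! : ∀ {k R i b} {c : Cmd k R} {fr v t} → Runs c fr (v [ i ]≔ (b ∷ lookup v i)) t → Runs (push i b c) fr v (suc t)
  push! (runs h) = runs h

  pop-∷ : ∀ {k R i} {f : Maybe Bool → Cmd k R} {fr v t b l} → lookup v i ≡ b ∷ l →
          Runs (f (just b)) fr (v [ i ]≔ l) t → Runs (pop i f) fr v (suc t)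
  pop-∷ {i = i} {f} {fr} {v} {t} eq (runs h) =
    runs (subst (afterPop i v (λ m v′ → Halts (f m) fr v′ t)) (sym eq) h)

  pop-[] : ∀ {k R i} {f : Maybe Bool → Cmd k R} {fr v t} → lookup v i ≡ [] →
           Runs (f nothing) fr v t → Runs (pop i f) fr v (suc t)
  pop-[] {i = i} {f} {fr} {v} {t} eq (runs h) =
    runs (subst (afterPop i v (λ m v′ → Halts (f m) fr v′ t)) (sym eq) h)

  iter! : ∀ {k A B R} {FA : Finite A} {FB : Finite B} {b a} {c : B → Cmd k R} {fr v t} →
          Runs (b a) (frm FA FB b c fr) v t → Runs (iter FA FB b a c) fr v (suc t)
  iter! (runs h) = runs h

  again! : ∀ {k A B R} {FA : Finite A} {FB : Finite B} {b a} {c : B → Cmd k R} {fr v t} →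
           Runs (iter FA FB b a c) fr v t → Runs (ret (inj₁ a)) (frm FA FB b c fr) v (suc t)
  again! (runs h) = runs h

  exit! : ∀ {k A B R} {FA : Finite A} {FB : Finite B} {b r} {c : B → Cmd k R} {fr v t} →
          Runs (c r) fr v t → Runs (ret (inj₂ r)) (frm {A = A} FA FB b c fr) v (suc t)
  exit! (runs h) = runs h

  halt! : ∀ {k R o} {fr : Frames k R} {v t} → P o → Runs (halt o) fr v (suc t)
  halt! p = runs p

  module _ {k} {i : Fin (suc k)} {W : List Bool → Stacks k} (sl : Slot i W) where
    open Slot sl

    slot-push : ∀ {R b a} {c : Cmd k R} {fr t} → Runs c fr (W (b ∷ a)) t → Runs (push i b c) fr (W a) (suc t)
    slot-push {b = b} {a} {c} {fr} {t} h =
      push! (subst (λ v → Runs c fr v t) (sym (trans (cong (λ l → W a [ i ]≔ (b ∷ l)) (get a)) (set a (b ∷ a)))) h)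

    slot-pop-[] : ∀ {R} {f : Maybe Bool → Cmd k R} {fr t} → Runs (f nothing) fr (W []) t → Runs (pop i f) fr (W []) (suc t)
    slot-pop-[] h = pop-[] (get []) h

    slot-pop : ∀ {R b a} {f : Maybe Bool → Cmd k R} {fr t} → Runs (f (just b)) fr (W a) t → Runs (pop i f) fr (W (b ∷ a)) (suc t)
    slot-pop {b = b} {a} {f} {fr} {t} h =
      pop-∷ (get (b ∷ a)) (subst (λ v → Runs (f (just b)) fr v t) (sym (set (b ∷ a) a)) h)

    run-pushSym : ∀ {R} {c : Cmd k R} {fr} s l {t} → Runs c fr (W (code (s ∷ l))) t →
                  Runs (pushSym i s c) fr (W (code l)) (2 + t)
    run-pushSym blank   l h = mono (n≤1+n _) (slot-push h)
    run-pushSym (bit b) l h = slot-push (slot-push h)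

    run-popSym′ : ∀ {R} {c : Cmd k R} {f fr} s l {t} → Runs (f s) fr (W (code l)) t →
                  Runs (pop i (popSym′ i c f)) fr (W (code (s ∷ l))) (2 + t)
    run-popSym′ blank   l h = mono (n≤1+n _) (slot-pop h)
    run-popSym′ (bit b) l h = slot-pop (slot-pop h)

    run-popSym-[] : ∀ {R} {f : Sym → Cmd k R} {fr t} → Runs (f blank) fr (W []) t → Runs (popSym i f) fr (W []) (2 + t)
    run-popSym-[] h = mono (n≤1+n _) (slot-pop-[] h)

  module _ {k} {i : Fin (suc k)} {St : Set} {W : List Bool → St → Stacks k} (sl : ∀ s → Slot i (λ a → W a s)) where

    regroup : ∀ n x t → n + suc (x + (3 + t)) ≡ suc ((n + x) + (3 + t))
    regroup n x t = trans (+-suc n _) (cong suc (sym (+-assoc n x _)))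

    -- `eff` is the effect of the loop body on the other stacks. The time is stated for a bound `m`
    -- on the length, so that costs do not depend on the data.
    run-transfer : (w : Bool → Cmd k (⊤ ⊎ ⊤) → Cmd k (⊤ ⊎ ⊤)) (eff : St → Bool → St) (n : ℕ) →
      (∀ {c fr b a s t} → Runs c fr (W a (eff s b)) t → Runs (w b c) fr (W a s) (n + t)) →
      ∀ {R} {c : Cmd k R} {fr} l s m {t} → length l ≤ m → Runs c fr (W [] (foldl eff s l)) t →
      Runs (transfer i w c) fr (W l s) (m * (3 + n) + (3 + t))
    run-transfer w eff n spec [] s m le h =
      mono (m≤n+m _ (m * (3 + n))) (iter! (slot-pop-[] (sl s) (exit! h)))
    run-transfer w eff n spec (b ∷ l) s (suc m) {t} (s≤s le) h =
      iter! (slot-pop (sl s) (subst (Runs _ _ _) (regroup n (m * (3 + n)) t)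
        (spec (again! (run-transfer w eff n spec l (eff s b) m le h)))))

    run-symTransfer : (w : Sym → Cmd k (⊤ ⊎ ⊤) → Cmd k (⊤ ⊎ ⊤)) (eff : St → Sym → St) (n : ℕ) →
      (∀ {c fr b a s t} → Runs c fr (W a (eff s b)) t → Runs (w b c) fr (W a s) (n + t)) →
      ∀ {R} {c : Cmd k R} {fr} l s m {t} → length l ≤ m → Runs c fr (W [] (foldl eff s l)) t →
      Runs (symTransfer i w c) fr (W (code l) s) (m * (4 + n) + (3 + t))
    run-symTransfer w eff n spec [] s m le h =
      mono (m≤n+m _ (m * (4 + n))) (iter! (slot-pop-[] (sl s) (exit! h)))
    run-symTransfer w eff n spec (b ∷ l) s (suc m) {t} (s≤s le) h =
      iter! (run-popSym′ (sl s) b l (subst (Runs _ _ _) (regroup n (m * (4 + n)) t)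
        (spec (again! (run-symTransfer w eff n spec l (eff s b) m le h)))))

  module _ {k} {i j : Fin (suc k)} {W : List Bool → List Bool → Stacks k}
           (sli : ∀ b → Slot i (λ a → W a b)) (slj : ∀ a → Slot j (W a)) where

    tapeAt : Tape → Stacks k
    tapeAt (tape l h r) = W (code l) (code r)

    run-shift : ∀ {R} d s {f : Sym → Cmd k R} {fr} τ {t} →
                Runs (f (Tape.here (moveT d (write s τ)))) fr (tapeAt (moveT d (write s τ))) t →
                Runs (shift d i j s f) fr (tapeAt τ) (4 + t)
    run-shift S s τ h = mono (m≤n+m _ 4) h
    run-shift R s (tape l _ []) h =
      run-pushSym (sli []) s l (run-popSym-[] (slj (code (s ∷ l))) h)
    run-shift R s (tape l _ (x ∷ r)) h =
      run-pushSym (sli (code (x ∷ r))) s l (run-popSym′ (slj (code (s ∷ l))) x r h)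
    run-shift L s (tape [] _ r) h =
      run-pushSym (slj []) s r (run-popSym-[] (sli (code (s ∷ r))) h)
    run-shift L s (tape (x ∷ l) _ r) h =
      run-pushSym (slj (code (x ∷ l))) s r (run-popSym′ (sli (code (s ∷ r))) x l h)

-- Lazy runs over tables of oracle answers

_≟ʷ_ : (u w : Word) → Dec (u ≡ w)
_≟ʷ_ = ≡-dec _≟ᵇ_

record Tables : Set₁ where
  field
    Table     : Set
    lk        : Table → Word → Maybe Bool
    ext       : Word → Bool → Table → Table
    ext-same  : ∀ u b T → lk (ext u b T) u ≡ just b
    ext-other : ∀ u b T {w} → w ≢ u → lk (ext u b T) w ≡ lk T w

module Certificates (tables : Tables) (N : NOTM) where
  open Tables tables
  open NOTM N
  open Config using () renaming (tape₂ to queryTape)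

  choices : Config nst → List (Action nst Outcome)
  choices c = δ (Config.state c) (Tape.here (Config.tape₁ c)) (Tape.here (Config.tape₂ c))

  moved : Fin nst → Sym → Sym → Dir → Dir → Config nst → Config nst
  moved q w₁ w₂ d₁ d₂ (cfg _ t₁ t₂) = cfg q (moveT d₁ (write w₁ t₁)) (moveT d₂ (write w₂ t₂))

  goto : Fin nst → Config nst → Config nst
  goto q (cfg _ t₁ t₂) = cfg q t₁ t₂

  asked : Config nst → Word
  asked c = contents (queryTape c)

  -- `Yields` with its sequence of queries made visible, as the counting argument is about the
  -- queries on rejecting runs.
  data Path (D : Lang) : Config nst → List Word → Outcome → Set where
    halts : ∀ {c o} → halt o ∈ choices c → Path D c [] o
    moves : ∀ {c q w₁ w₂ d₁ d₂ us o} → move q w₁ w₂ d₁ d₂ ∈ choices c →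
            Path D (moved q w₁ w₂ d₁ d₂ c) us o → Path D c us o
    asks  : ∀ {c qy qn us o} → ask qy qn ∈ choices c →
            Path D (goto (if D (asked c) then qy else qn) c) us o → Path D c (asked c ∷ us) o

  -- A run that consults the table and answers freely the queries unknown to
  -- it; the list collects these queries with their answers.
  data Lazy : Table → Config nst → List (Word × Bool) → Outcome → Set where
    halts : ∀ {T c o} → halt o ∈ choices c → Lazy T c [] o
    moves : ∀ {T c q w₁ w₂ d₁ d₂ E o} → move q w₁ w₂ d₁ d₂ ∈ choices c →
            Lazy T (moved q w₁ w₂ d₁ d₂ c) E o → Lazy T c E o
    known : ∀ {T c qy qn E o} b → ask qy qn ∈ choices c → lk T (asked c) ≡ just b →
            Lazy T (goto (if b then qy else qn) c) E o → Lazy T c E o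
    fresh : ∀ {T c qy qn E o} b → ask qy qn ∈ choices c → lk T (asked c) ≡ nothing →
            Lazy (ext (asked c) b T) (goto (if b then qy else qn) c) E o → Lazy T c ((asked c , b) ∷ E) o

  path : ∀ {D c o} → Yields N D c o → ∃ λ us → Path D c us o
  path (here {move _ _ _ _ _} a∈ ())
  path (here {ask _ _} a∈ ())
  path (here {halt o} a∈ refl) = [] , halts a∈
  path (there {move q w₁ w₂ d₁ d₂} a∈ refl y) = let us , p = path y in us , moves a∈ p
  path (there {ask qy qn} a∈ refl y) = let us , p = path y in _ , asks a∈ p
  path (there {halt o} a∈ () y)

  yields : ∀ {D c us o} → Path D c us o → Yields N D c o
  yields (halts a∈)   = here a∈ refl
  yields (moves a∈ p) = there a∈ refl (yields p)
  yields (asks a∈ p)  = there a∈ refl (yields p)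

  path-length : ∀ {D c us o t} → HaltsWithin N D c t → Path D c us o → length us ≤ t
  path-length (hw _ all) (halts a∈) = z≤n
  path-length (hw _ all) (moves a∈ p) with All.lookup all a∈
  ... | cont h = ≤-trans (path-length h p) (n≤1+n _)
  path-length (hw _ all) (asks a∈ p) with All.lookup all a∈
  ... | cont h = s≤s (path-length h p)

  Agree : Lang → Table → Set
  Agree D T = ∀ u b → lk T u ≡ just b → D u ≡ b

  Answers : Lang → List (Word × Bool) → Set
  Answers D = All λ (u , b) → D u ≡ b

  agree-ext : ∀ {D T} u b → Agree D T → D u ≡ b → Agree D (ext u b T)
  agree-ext {D} {T} u b ag eq w b′ lk≡ with w ≟ʷ u
  ... | yes refl = trans eq (just-injective (trans (sym (ext-same u b T)) lk≡))
  ... | no ne = ag w b′ (trans (sym (ext-other u b T ne)) lk≡)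

  agree-unext : ∀ {D T u b} → lk T u ≡ nothing → Agree D (ext u b T) → Agree D T × D u ≡ b
  agree-unext {D} {T} {u} {b} new ag = agree , ag u b (ext-same u b T)
    where
    agree : Agree D T
    agree w b′ lk≡ with w ≟ʷ u
    ... | yes refl = contradiction (trans (sym new) lk≡) λ ()
    ... | no ne = ag w b′ (trans (ext-other u b T ne) lk≡)

  lazy⇒path : ∀ {D T c E o} → Lazy T c E o → Agree D T → Answers D E → ∃ λ us → Path D c us o
  lazy⇒path (halts a∈) ag as = [] , halts a∈
  lazy⇒path (moves a∈ l) ag as = let us , p = lazy⇒path l ag as in us , moves a∈ p
  lazy⇒path {D} {c = c} {o = o} (known {qy = qy} {qn} b a∈ eq l) ag as =
    let us , p = lazy⇒path l ag as in
    _ , asks a∈ (subst (λ b → Path D (goto (if b then qy else qn) c) us o) (sym (ag _ _ eq)) p)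
  lazy⇒path {D} {c = c} {o = o} (fresh {qy = qy} {qn} b a∈ eq l) ag (a ∷ as) =
    let us , p = lazy⇒path l (agree-ext _ b ag a) as in
    _ , asks a∈ (subst (λ b → Path D (goto (if b then qy else qn) c) us o) (sym a) p)

  path⇒lazy : ∀ {D T c us o} → Path D c us o → Agree D T → ∃ λ E → Lazy T c E o
  path⇒lazy (halts a∈) ag = [] , halts a∈
  path⇒lazy (moves a∈ p) ag = let E , l = path⇒lazy p ag in E , moves a∈ l
  path⇒lazy {D} {T} {c} {o = o} (asks {qy = qy} {qn} a∈ p) ag with lk T (asked c) in eq
  ... | just b  = let E , l = path⇒lazy p ag in
        E , known b a∈ eq (subst (λ b → Lazy T (goto (if b then qy else qn) c) E o) (ag _ _ eq) l)
  ... | nothing = let E , l = path⇒lazy p (agree-ext (asked c) (D (asked c)) ag refl) in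
        _ , fresh (D (asked c)) a∈ eq l

  keys : List (Word × Bool) → List Word
  keys = map proj₁

  lazy-fresh : ∀ {T c E o} → Lazy T c E o → All (λ u → lk T u ≡ nothing) (keys E)
  lazy-fresh (halts _) = []
  lazy-fresh (moves _ l) = lazy-fresh l
  lazy-fresh (known _ _ _ l) = lazy-fresh l
  lazy-fresh {T} {c} (fresh b _ eq l) = eq ∷ All.map unext (lazy-fresh l)
    where
    unext : ∀ {u} → lk (ext (asked c) b T) u ≡ nothing → lk T u ≡ nothing
    unext {u} new with u ≟ʷ asked c
    ... | yes refl = contradiction (trans (sym new) (ext-same _ b T)) λ ()
    ... | no ne = trans (sym (ext-other _ b T ne)) new

  patch : List (Word × Bool) → Lang → Lang
  patch []            D w = D w
  patch ((u , b) ∷ E) D w with w ≟ʷ u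
  ... | yes _ = b
  ... | no _  = patch E D w

  patch-here : ∀ u b E D → patch ((u , b) ∷ E) D u ≡ b
  patch-here u b E D with u ≟ʷ u
  ... | yes _ = refl
  ... | no ne = contradiction refl ne

  patch-there : ∀ {u b E D w} → w ≢ u → patch ((u , b) ∷ E) D w ≡ patch E D w
  patch-there {u} {w = w} ne with w ≟ʷ u
  ... | yes eq = contradiction eq ne
  ... | no _   = refl

  patch-other : ∀ E D {w} → w ∉ keys E → patch E D w ≡ D w
  patch-other []            D w∉ = refl
  patch-other ((u , b) ∷ E) D {w} w∉ =
    trans (patch-there {u} {b} {E} {D} {w} (λ eq → w∉ (∈-here eq))) (patch-other E D (λ w∈ → w∉ (∈-there w∈)))

  -- An answered query enters the table, so later fresh queries differ from it: the keys of a lazy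
  -- run are distinct, and no entry of the patch hides another.
  patch-answers : ∀ {T c E o} D → Lazy T c E o → Answers (patch E D) E
  patch-answers D (halts _) = []
  patch-answers D (moves _ l) = patch-answers D l
  patch-answers D (known _ _ _ l) = patch-answers D l
  patch-answers {T} {c} D (fresh {E = E} b _ eq l) =
    patch-here (asked c) b E D ∷ lift (lazy-fresh l) (patch-answers D l)
    where
    lift : ∀ {E′} → All (λ u → lk (ext (asked c) b T) u ≡ nothing) (keys E′) →
           Answers (patch E D) E′ → Answers (patch ((asked c , b) ∷ E) D) E′
    lift {[]} _ _ = []
    lift {(u , b′) ∷ E′} (new ∷ news) (a ∷ as) = trans (patch-there {asked c} {b} {E} {D} differ) a ∷ lift news as
      where
      differ : u ≢ asked c
      differ refl = contradiction (trans (sym new) (ext-same u b T)) λ ()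

  path-cong : ∀ {D D′ c us o} → Path D c us o → (∀ {u} → u ∈ us → D′ u ≡ D u) → Path D′ c us o
  path-cong (halts a∈) same = halts a∈
  path-cong (moves a∈ p) same = moves a∈ (path-cong p same)
  path-cong {D′ = D′} {c} {_ ∷ us} {o} (asks {qy = qy} {qn} a∈ p) same =
    asks a∈ (subst (λ b → Path D′ (goto (if b then qy else qn) c) us o) (sym (same (∈-here refl)))
               (path-cong p (λ u∈ → same (∈-there u∈))))

  patch-agree : ∀ {D T c E o} → Lazy T c E o → Agree D T → Agree (patch E D) T
  patch-agree {D} {E = E} l ag w b lk≡ = trans (patch-other E D (λ w∈ →
    contradiction (trans (sym (All.lookup (lazy-fresh l) w∈)) lk≡) λ ())) (ag w b lk≡)

  -- An accepting and a rejecting run without a common unknown query would both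
  -- occur under one oracle.
  conflict : ∀ {D T c E us} → (∀ D → ¬ (Yields N D c acc × Yields N D c rej)) →
             Lazy T c E acc → Agree D T → Path D c us rej →
             ∃ λ u → u ∈ us × u ∈ keys E
  conflict {D} {T} {c} {E} {us} under l ag p with any? (_∈? keys E) us
  ... | yes common = find common
    where
    find : ∀ {us} → Any (_∈ keys E) us → ∃ λ u → u ∈ us × u ∈ keys E
    find (∈-here u∈) = _ , ∈-here refl , u∈
    find (∈-there a) = let u , u∈ , u∈E = find a in u , ∈-there u∈ , u∈E
  -- The common oracle is `patch E D`. It agrees with `T` because the keys of `E` are unknown to
  -- `T`, it gives the answers guessed in the accepting run, and it leaves the rejecting path alone,
  -- which asks no key of `E`.
  ... | no disjoint = contradiction
        ( yields (proj₂ (lazy⇒path l (patch-agree l ag) (patch-answers D l)))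
        , yields (path-cong p (λ u∈ → patch-other E D (λ u∈E → disjoint (lose u∈ u∈E)))))
        (under (patch E D))
    where
    lose : ∀ {u us} → u ∈ us → u ∈ keys E → Any (_∈ keys E) us
    lose (∈-here refl) u∈E = ∈-here u∈E
    lose (∈-there u∈)  u∈E = ∈-there (lose u∈ u∈E)

  -- Counts distinct words: a counted word is entered into the table, with the arbitrary answer
  -- `true`, so that its repetitions are passed over.
  unknown : Table → List Word → ℕ
  unknown T []       = 0
  unknown T (u ∷ us) with lk T u
  ... | just _  = unknown T us
  ... | nothing = suc (unknown (ext u true T) us)

  unknown≤ : ∀ T us → unknown T us ≤ length us
  unknown≤ T []       = z≤n
  unknown≤ T (u ∷ us) with lk T u
  ... | just _  = ≤-trans (unknown≤ T us) (n≤1+n _)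
  ... | nothing = s≤s (unknown≤ _ us)

  -- Compares which words are known and ignores the answers, in keeping with the arbitrary answers
  -- entered by `unknown`.
  _⊑_ : Table → Table → Set
  T ⊑ T′ = ∀ u → lk T′ u ≡ nothing → lk T u ≡ nothing

  ext-mono : ∀ {T T′} u b b′ → T ⊑ T′ → ext u b T ⊑ ext u b′ T′
  ext-mono {T} {T′} u b b′ sub w new with w ≟ʷ u
  ... | yes refl = contradiction (trans (sym new) (ext-same u b′ T′)) λ ()
  ... | no ne = trans (ext-other u b T ne) (sub w (trans (sym (ext-other u b′ T′ ne)) new))

  ext-⊑ : ∀ {T} u b → T ⊑ ext u b T
  ext-⊑ {T} u b w new with w ≟ʷ u
  ... | yes refl = contradiction (trans (sym new) (ext-same u b T)) λ ()
  ... | no ne = trans (sym (ext-other u b T ne)) new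

  ext-known : ∀ {T T′ u b b′} → T ⊑ T′ → lk T′ u ≡ just b′ → ext u b T ⊑ T′
  ext-known {T} {T′} {u} {b} sub eq w new with w ≟ʷ u
  ... | yes refl = contradiction (trans (sym new) eq) λ ()
  ... | no ne = trans (ext-other u b T ne) (sub w new)

  unknown-mono : ∀ {T T′} us → T ⊑ T′ → unknown T′ us ≤ unknown T us
  unknown-mono [] sub = z≤n
  unknown-mono {T} {T′} (u ∷ us) sub with lk T u in eq | lk T′ u in eq′
  ... | just _  | just _  = unknown-mono us sub
  ... | just _  | nothing = contradiction (trans (sym (sub u eq′)) eq) λ ()
  ... | nothing | just _  = ≤-trans (unknown-mono us (ext-known sub eq′)) (n≤1+n _)
  ... | nothing | nothing = s≤s (unknown-mono us (ext-mono u true true sub))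

  unknown-strict : ∀ {T T′ w b} us → T ⊑ T′ → w ∈ us → lk T w ≡ nothing → lk T′ w ≡ just b →
                   unknown T′ us < unknown T us
  unknown-strict {T} {T′} (u ∷ us) sub (∈-here refl) new old with lk T u in eq | lk T′ u in eq′
  ... | nothing | just _ = s≤s (unknown-mono us (ext-known sub eq′))
  unknown-strict {T} {T′} {w} (u ∷ us) sub (∈-there w∈) new old with lk T u in eq | lk T′ u in eq′
  ... | just _  | just _  = unknown-strict us sub w∈ new old
  ... | just _  | nothing = contradiction (trans (sym (sub u eq′)) eq) λ ()
  ... | nothing | nothing = s≤s (unknown-strict us (ext-mono u true true sub) w∈
          (trans (ext-other u true T differ) new) (trans (ext-other u true T′ differ) old))
    where
    differ : w ≢ u
    differ refl = contradiction (trans (sym eq′) old) λ ()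
  ... | nothing | just _ with w ≟ʷ u
  ...   | yes refl = s≤s (unknown-mono us (ext-known sub eq′))
  ...   | no ne = m≤n⇒m≤1+n (unknown-strict us (ext-known sub eq′) w∈ (trans (ext-other u true T ne) new) old)

  learn : Lang → List Word → Table → Table
  learn D []       T = T
  learn D (u ∷ us) T = learn D us (ext u (D u) T)

  learn-agree : ∀ {D} us {T} → Agree D T → Agree D (learn D us T)
  learn-agree []       ag = ag
  learn-agree (u ∷ us) ag = learn-agree us (agree-ext u _ ag refl)

  learn-⊑ : ∀ {D} us {T} → T ⊑ learn D us T
  learn-⊑ []       w new = new
  learn-⊑ {D} (u ∷ us) {T} w new = ext-⊑ {T} u (D u) w (learn-⊑ us w new)

  learn-knows : ∀ {D u} us {T} → u ∈ us → ∃ λ b → lk (learn D us T) u ≡ just b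
  learn-knows {D} {u} (w ∷ us) {T} u∈ with lk (learn D us (ext w (D w) T)) u in eq
  ... | just b = b , refl
  learn-knows {D} {u} (w ∷ us) {T} (∈-here refl) | nothing =
    contradiction (trans (sym (learn-⊑ us u eq)) (ext-same u (D u) T)) λ ()
  learn-knows {D} {u} (w ∷ us) {T} (∈-there u∈) | nothing =
    contradiction (trans (sym eq) (proj₂ (learn-knows us u∈))) λ ()

finite-⊥ : Finite ⊥
finite-⊥ = record { size = 0 ; enc = λ () ; dec = λ () ; dec-enc = λ () }

-- Tables as bit strings

-- Tables: a list of entries, each consisting of the answer and the reversed query.

-- Each bit is announced by `true`, so a `false` in the place of an announcement ends the word:
-- followed by `false`, this is a self-delimiting code.
pairs : List Bool → List Bool
pairs []      = []
pairs (c ∷ l) = true ∷ c ∷ pairs l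

same : Bool → Bool → Bool
same true  c = c
same false true  = false
same false false = true

same-≡ : ∀ c c′ → same c c′ ≡ true → c ≡ c′
same-≡ true  true  _ = refl
same-≡ false false _ = refl

same-refl : ∀ c → same c c ≡ true
same-refl true  = refl
same-refl false = refl

mutual
  find : List Bool → List Bool → Maybe Bool
  find []      q = nothing
  find (b ∷ T) q = compare T b true q []

  -- Written the way the machine scans the table, so that `run-compare` can follow it clause by
  -- clause: `q` is the rest of the wanted query and `q₂` its compared part reversed, put back
  -- before the next entry. The verifier meets arbitrary bit strings as tables; a malformed rest
  -- reads as unknown, and the laws of `Tables` hold for all strings.
  compare : List Bool → Bool → Bool → List Bool → List Bool → Maybe Bool
  compare []              b ok    q       q₂ = nothing
  compare (false ∷ T)     b true  []      q₂ = just b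
  compare (false ∷ T)     b true  (c ∷ q) q₂ = find T (q₂ ʳ++ (c ∷ q))
  compare (false ∷ T)     b false q       q₂ = find T (q₂ ʳ++ q)
  compare (true ∷ [])     b ok    q       q₂ = nothing
  compare (true ∷ c ∷ T)  b true  []      q₂ = compare T b false [] q₂
  compare (true ∷ c ∷ T)  b true  (d ∷ q) q₂ = compare T b (same c d) q (d ∷ q₂)
  compare (true ∷ c ∷ T)  b false q       q₂ = compare T b false q q₂

compare-same : ∀ T b v q₂ → compare (pairs v ++ false ∷ T) b true v q₂ ≡ just b
compare-same T b []      q₂ = refl
compare-same T b (c ∷ v) q₂ rewrite same-refl c = compare-same T b v (c ∷ q₂)

compare-failed : ∀ T b v q q₂ → compare (pairs v ++ false ∷ T) b false q q₂ ≡ find T (q₂ ʳ++ q)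
compare-failed T b []      q q₂ = refl
compare-failed T b (c ∷ v) q q₂ = compare-failed T b v q q₂

compare-other : ∀ T b v q q₂ → q ≢ v → compare (pairs v ++ false ∷ T) b true q q₂ ≡ find T (q₂ ʳ++ q)
compare-other T b []      []      q₂ ne = contradiction refl ne
compare-other T b []      (d ∷ q) q₂ ne = refl
compare-other T b (c ∷ v) []      q₂ ne = compare-failed T b v [] q₂
compare-other T b (c ∷ v) (d ∷ q) q₂ ne with same c d in eq
... | true  = compare-other T b v q (d ∷ q₂) (λ q≡v → ne (cong₂ _∷_ (sym (same-≡ c d eq)) q≡v))
... | false = compare-failed T b v q (d ∷ q₂)

extend : Word → Bool → List Bool → List Bool
extend u b T = b ∷ pairs (u ʳ++ []) ++ false ∷ T

bitTables : Tables
bitTables = record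
  { Table = List Bool ; lk = λ T u → find T (reverse u) ; ext = extend
  ; ext-same = λ u b T → compare-same T b (reverse u) []
  ; ext-other = λ u b T {w} ne → compare-other T b (reverse u) (reverse w) [] (λ eq → ne (reverse-injective eq)) }

length-pairs : ∀ l → length (pairs l) ≡ length l * 2
length-pairs []      = refl
length-pairs (c ∷ l) = cong (2 +_) (length-pairs l)

length-extend : ∀ u b T → length (extend u b T) ≡ length T + (length u * 2 + 2)
length-extend u b T = begin
  suc (length (pairs (u ʳ++ []) ++ false ∷ T))    ≡⟨ cong suc (length-++ (pairs (u ʳ++ []))) ⟩
  suc (length (pairs (u ʳ++ [])) + suc (length T)) ≡⟨ cong (λ x → suc (x + suc (length T))) (trans (length-pairs (u ʳ++ [])) (cong (_* 2) (length-reverse u))) ⟩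
  suc (length u * 2 + suc (length T))              ≡⟨ solve 2 (λ x y → con 1 :+ (x :+ (con 1 :+ y)) := y :+ (x :+ con 2)) refl (length u * 2) (length T) ⟩
  length T + (length u * 2 + 2) ∎
  where
  open ≡-Reasoning
  open +-*-Solver

-- The verifier: lazy runs checked against a prescribed output

-- emits o σ: the rest of the prescribed output σ after producing o; an
-- exhausted σ prescribes nothing.
emits : List Bool → List Bool → Maybe (List Bool)
emits []          σ           = just σ
emits (c ∷ o)     []          = emits o []
emits (true ∷ o)  (true ∷ σ)  = emits o σ
emits (true ∷ o)  (false ∷ σ) = nothing
emits (false ∷ o) (true ∷ σ)  = nothing
emits (false ∷ o) (false ∷ σ) = emits o σ

-- Quantifying over the later output `o` lets the effects of consecutive emissions compose by
-- chaining equations.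
After : List Bool → List Bool → List Bool → Set
After w σ σ′ = ∀ o → emits (w ++ o) σ ≡ emits o σ′

Never : List Bool → List Bool → Set
Never w σ = ∀ o → emits (w ++ o) σ ≡ nothing

-- What the verifier emits: the queries of a lazy run, without their answers.
emission : List (Word × Bool) → List Bool
emission []            = false ∷ []
emission ((u , b) ∷ E) = true ∷ pairs u ++ false ∷ emission E

fieldCode : List Bool → List Bool
fieldCode x = pairs x ++ false ∷ []

-- The stacks of the verifier: Z is the query tape, I the input, L and R the two
-- halves of the tapes of N, T the table, Q the current query; T₂ and Q₂ are scratch.
pattern iZ  = zero
pattern iI  = suc iZ
pattern iL₁ = suc iI
pattern iR₁ = suc iL₁
pattern iL₂ = suc iR₁
pattern iR₂ = suc iL₂
pattern iT  = suc iR₂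
pattern iT₂ = suc iT
pattern iQ  = suc iT₂
pattern iQ₂ = suc iQ

Prog : Set → Set₁
Prog = Cmd 9

st : (z i l₁ r₁ l₂ r₂ t t₂ q q₂ : List Bool) → Stacks 9
st z i l₁ r₁ l₂ r₂ t t₂ q q₂ = z ∷ i ∷ l₁ ∷ r₁ ∷ l₂ ∷ r₂ ∷ t ∷ t₂ ∷ q ∷ q₂ ∷ []

emitted : ∀ {R} → Bool → Prog R → Maybe Bool → Prog R
emitted _     c nothing      = c
emitted true  c (just true)  = c
emitted true  c (just false) = halt false
emitted false c (just true)  = halt false
emitted false c (just false) = c

emit : ∀ {R} → Bool → Prog R → Prog R
emit b c = pop iI (emitted b c)

noteBit : ∀ {R} → Sym → Prog R → Prog R
noteBit blank   c = c
noteBit (bit b) c = push iQ b c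

moveTo : ∀ {R} → Fin 10 → Bool → Prog R → Prog R
moveTo i b c = push i b c

moveSym : ∀ {R} → Fin 10 → Sym → Prog R → Prog R
moveSym i s c = pushSym i s c

moveNote : ∀ {R} → Fin 10 → Sym → Prog R → Prog R
moveNote i s c = pushSym i s (noteBit s c)

discard : ∀ {R} → Bool → Prog R → Prog R
discard b c = c

-- The query has to be read without being destroyed. Passing the left half through scratch and back
-- meets its cells from the leftmost one on; then come the head and the right half. The bits are
-- thus noted in reading order, which leaves the query reversed on `iQ`, the form in which tables
-- store it.
readQuery : ∀ {R} → Sym → Prog R → Prog R
readQuery h c =
  symTransfer iL₂ (moveSym iT₂)
  (symTransfer iT₂ (moveNote iL₂)
  (noteBit h
  (symTransfer iR₂ (moveNote iT₂)
  (symTransfer iT₂ (moveSym iR₂) c))))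

-- nothing: at the start of an entry; just (b , ok): inside an entry with answer
-- b, where ok tells whether its query matches so far.
Scan : Set
Scan = Maybe (Bool × Bool)

finite-Scan : Finite Scan
finite-Scan = finite-Maybe (finite-Bool ×ᶠ finite-Bool)

nextEntry : Prog (Scan ⊎ Maybe Bool)
nextEntry = transfer iQ₂ (moveTo iQ) (ret (inj₁ nothing))

scanStart : Maybe Bool → Prog (Scan ⊎ Maybe Bool)
scanStart nothing  = ret (inj₂ nothing)
scanStart (just b) = push iT₂ b (ret (inj₁ (just (b , true))))

entryEnd : Bool → Bool → Maybe Bool → Prog (Scan ⊎ Maybe Bool)
entryEnd b true  nothing  = ret (inj₂ (just b))
entryEnd b false nothing  = nextEntry
entryEnd b ok    (just c) = push iQ c nextEntry

compareBit : Bool → Bool → Maybe Bool → Prog (Scan ⊎ Maybe Bool)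
compareBit b c nothing  = ret (inj₁ (just (b , false)))
compareBit b c (just d) = push iQ₂ d (ret (inj₁ (just (b , same c d))))

entryBit : Bool → Bool → Maybe Bool → Prog (Scan ⊎ Maybe Bool)
entryBit b ok    nothing  = ret (inj₂ nothing)
entryBit b true  (just c) = push iT₂ c (pop iQ (compareBit b c))
entryBit b false (just c) = push iT₂ c (ret (inj₁ (just (b , false))))

scanEntry : Bool → Bool → Maybe Bool → Prog (Scan ⊎ Maybe Bool)
scanEntry b ok nothing      = ret (inj₂ nothing)
scanEntry b ok (just false) = push iT₂ false (pop iQ (entryEnd b ok))
scanEntry b ok (just true)  = push iT₂ true (pop iT (entryBit b ok))

scanBody : Scan → Prog (Scan ⊎ Maybe Bool)
scanBody nothing         = pop iT scanStart
scanBody (just (b , ok)) = pop iT (scanEntry b ok)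

scanTable : ∀ {R} → Scan → (Maybe Bool → Prog R) → Prog R
scanTable s c = iter finite-Scan finite-Mb scanBody s c

-- One pass serves both orders: the query is emitted in reading order, while pushing reverses it for
-- the table.
recordBit : Bool → Prog (⊤ ⊎ ⊤) → Prog (⊤ ⊎ ⊤)
recordBit b c = push iT b (push iT true (emit true (emit b c)))

recordQuery : ∀ {R} → Prog R → Prog R
recordQuery c = transfer iQ₂ recordBit c

-- The `ask` is a guess of the unknown answer, as queries of the compiled verifier become free
-- choices. The guess enters the table but is not emitted.
answer : ∀ {R} → (Bool → Prog R) → Maybe Bool → Prog R
answer c (just b) = transfer iQ discard (c b)
answer c nothing  = push iT false (emit true (transfer iQ (moveTo iQ₂)
                      (recordQuery (emit false (ask (λ b → push iT b (c b)))))))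

lookUp : ∀ {R} → Sym → (Bool → Prog R) → Prog R
lookUp h c = readQuery h (scanTable nothing (λ r →
  transfer iQ₂ (moveTo iQ) (transfer iT₂ (moveTo iT) (answer c r))))

-- `n` bounds the tape halves and the query, `τ` the table. The summands are, in order, the four
-- passes of `readQuery` with the head symbol, the scan of the table, the restoring of query and
-- table, and the recording of a fresh query; the branch of a known query is shorter.
askTime : ℕ → ℕ → ℕ → ℕ
askTime n τ t = n * 6 + (3 + (n * 7 + (3 + (1 + (n * 7 + (3 + (n * 6 + (3 +
  (τ * 9 + (5 + (n * 4 + (3 + (τ * 4 + (3 +
  (1 + (2 + (n * 4 + (3 + (n * 9 + (3 + (2 + (1 + (1 + t)))))))))))))))))))))))

record Fits (l r : List Sym) (u T : List Bool) (n τ : ℕ) : Set where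
  constructor fits
  field
    left≤  : length l ≤ n
    right≤ : length r ≤ n
    query≤ : length u ≤ n
    table≤ : length T ≤ τ

module VerifierRules (br : Branching) (P : Bool → Set) where
  open Branching br
  open Rules br P

  ask! : ∀ {k R} {f : Bool → Cmd k R} {fr v t} → Br (reverse (Vec.head v)) (λ b → Runs (f b) fr v t) →
         Runs (ask f) fr v (suc t)
  ask! h = runs (Br-map (λ b → Runs.unpack) h)

  -- `P false` is demanded only when `σ` rules out the emitted bit. One rule thereby serves
  -- soundness, where rejecting is always allowed, and completeness, where such a mismatch has to be
  -- refuted.
  run-emit : ∀ {R b z l₁ r₁ l₂ r₂ T t₂ q q₂ t} {c : Prog R} {fr} σ →
    (∀ σ′ → After (b ∷ []) σ σ′ → Runs c fr (st z σ′ l₁ r₁ l₂ r₂ T t₂ q q₂) t) →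
    (Never (b ∷ []) σ → P false) →
    Runs (emit b c) fr (st z σ l₁ r₁ l₂ r₂ T t₂ q q₂) (2 + t)
  run-emit []                      K F = pop-[] refl (mono (n≤1+n _) (K [] (λ _ → refl)))
  run-emit {b = true}  (true ∷ σ)  K F = pop-∷ refl (mono (n≤1+n _) (K σ (λ _ → refl)))
  run-emit {b = true}  (false ∷ σ) K F = pop-∷ refl (halt! (F (λ _ → refl)))
  run-emit {b = false} (true ∷ σ)  K F = pop-∷ refl (halt! (F (λ _ → refl)))
  run-emit {b = false} (false ∷ σ) K F = pop-∷ refl (mono (n≤1+n _) (K σ (λ _ → refl)))

  run-record : ∀ {R z l₁ r₁ l₂ r₂ T t₂ q t} {c : Prog R} {fr} u v σ m → length u ≤ m →
    (∀ σ′ → After (pairs u) σ σ′ → Runs c fr (st z σ′ l₁ r₁ l₂ r₂ (pairs (u ʳ++ v) ++ T) t₂ q []) t) →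
    (Never (pairs u) σ → P false) →
    Runs (recordQuery c) fr (st z σ l₁ r₁ l₂ r₂ (pairs v ++ T) t₂ q u) (m * 9 + (3 + t))
  run-record [] v σ m le K F = mono (m≤n+m _ (m * 9)) (iter! (pop-[] refl (exit! (K σ (λ _ → refl)))))
  run-record (b ∷ u) v σ (suc m) (s≤s le) K F =
    iter! (pop-∷ refl (push! (push! (run-emit σ
      (λ σ₁ a₁ → run-emit σ₁
        (λ σ₂ a₂ → again! (run-record u (b ∷ v) σ₂ m le
          (λ σ₃ a₃ → K σ₃ (λ o → trans (a₁ (b ∷ pairs u ++ o)) (trans (a₂ (pairs u ++ o)) (a₃ o))))
          (λ nv → F (λ o → trans (a₁ (b ∷ pairs u ++ o)) (trans (a₂ (pairs u ++ o)) (nv o))))))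
        (λ nv → F (λ o → trans (a₁ (b ∷ pairs u ++ o)) (nv (pairs u ++ o)))))
      (λ nv → F (λ o → nv (b ∷ pairs u ++ o)))))))

  notePush : Sym → List Bool → List Bool
  notePush blank   q = q
  notePush (bit b) q = b ∷ q

  collect : List Sym × List Bool → Sym → List Sym × List Bool
  collect (l , q) s = s ∷ l , notePush s q

  collected : ∀ l a q → foldl collect (a , q) l ≡ (l ʳ++ a , bitsOf l ʳ++ q)
  collected []          a q = refl
  collected (blank ∷ l) a q = collected l (blank ∷ a) q
  collected (bit b ∷ l) a q = collected l (bit b ∷ a) (b ∷ q)

  run-readQuery : ∀ {R z i l₁ r₁ T t} {c : Prog R} {fr} l h r n → length l ≤ n → length r ≤ n →
    Runs c fr (st z i l₁ r₁ (code l) (code r) T [] (reverse (contents (tape l h r))) []) t →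
    Runs (readQuery h c) fr (st z i l₁ r₁ (code l) (code r) T [] [] [])
      (n * 6 + (3 + (n * 7 + (3 + (1 + (n * 7 + (3 + (n * 6 + (3 + t)))))))))
  run-readQuery {_} {z} {i} {l₁} {r₁} {T} {t} {c} {fr} l h r n l≤ r≤ K =
    run-symTransfer {W = λ a s → st z i l₁ r₁ a (code r) T (code s) [] []} (λ _ → slot (λ _ → refl) (λ _ _ → refl))
      (moveSym iT₂) (flip _∷_) 2 (λ { {b = blank} x → mono (n≤1+n _) (push! x) ; {b = bit _} x → push! (push! x) }) l [] n l≤
    (run-symTransfer {W = λ a s → st z i l₁ r₁ (code (proj₁ s)) (code r) T a (proj₂ s) []} (λ _ → slot (λ _ → refl) (λ _ _ → refl))
      (moveNote iL₂) collect 3 (λ { {b = blank} x → mono (m≤n+m _ 2) (push! x) ; {b = bit _} x → push! (push! (push! x)) })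
      (l ʳ++ []) ([] , []) n (≤-trans (≤-reflexive (length-reverse l)) l≤)
    (subst (λ s → Runs (noteBit h _) fr (st z i l₁ r₁ (code (proj₁ s)) (code r) T [] (proj₂ s) []) _)
      (sym (trans (collected (l ʳ++ []) [] []) (cong (_, bitsOf (l ʳ++ []) ʳ++ []) (reverse-involutive l))))
    (run-note h
    (run-symTransfer {W = λ a s → st z i l₁ r₁ (code l) a T (code (proj₁ s)) (proj₂ s) []} (λ _ → slot (λ _ → refl) (λ _ _ → refl))
      (moveNote iT₂) collect 3 (λ { {b = blank} x → mono (m≤n+m _ 2) (push! x) ; {b = bit _} x → push! (push! (push! x)) })
      r ([] , notePush h (bitsOf (l ʳ++ []) ʳ++ [])) n r≤
    (subst (λ s → Runs (symTransfer iT₂ (moveSym iR₂) c) fr (st z i l₁ r₁ (code l) [] T (code (proj₁ s)) (proj₂ s) []) _)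
      (sym (collected r [] (notePush h (bitsOf (l ʳ++ []) ʳ++ []))))
    (run-symTransfer {W = λ a s → st z i l₁ r₁ (code l) (code s) T a (bitsOf r ʳ++ notePush h (bitsOf (l ʳ++ []) ʳ++ [])) []}
      (λ _ → slot (λ _ → refl) (λ _ _ → refl))
      (moveSym iR₂) (flip _∷_) 2 (λ { {b = blank} x → mono (n≤1+n _) (push! x) ; {b = bit _} x → push! (push! x) })
      (r ʳ++ []) [] n (≤-trans (≤-reflexive (length-reverse r)) r≤)
    (subst₂ (λ r′ q → Runs c fr (st z i l₁ r₁ (code l) (code r′) T [] q []) t)
      (sym (reverse-involutive r)) (query-≡ h) K)))))))
    where
    query-≡ : ∀ h → reverse (contents (tape l h r)) ≡ bitsOf r ʳ++ notePush h (bitsOf (l ʳ++ []) ʳ++ [])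
    query-≡ h = trans (cong reverse (bitsOf-++ (reverse l) (h ∷ r)))
                (trans (++-ʳ++ (bitsOf (reverse l)) {bitsOf (h ∷ r)} {[]}) (last h))
      where
      last : ∀ h → bitsOf (h ∷ r) ʳ++ (bitsOf (l ʳ++ []) ʳ++ []) ≡ bitsOf r ʳ++ notePush h (bitsOf (l ʳ++ []) ʳ++ [])
      last blank   = refl
      last (bit b) = refl
    run-note : ∀ h {R} {c : Prog R} {fr z i l₁ r₁ l₂ r₂ T t₂ q t} →
      Runs c fr (st z i l₁ r₁ l₂ r₂ T t₂ (notePush h q) []) t →
      Runs (noteBit h c) fr (st z i l₁ r₁ l₂ r₂ T t₂ q []) (1 + t)
    run-note blank   x = mono (n≤1+n _) x
    run-note (bit b) x = push! x

  module _ {R : Set} {c : Maybe Bool → Prog R} {fr : Frames 9 R} {z i l₁ r₁ l₂ r₂ : List Bool} {t : ℕ} where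

    -- A potential: each bit of the table pays 9 steps, and each compared bit of the query keeps 4
    -- in reserve for its return to the query stack.
    scanTime : List Bool → List Bool → ℕ
    scanTime T q₂ = length T * 9 + (length q₂ * 4 + (5 + t))

    -- Where the scan stops is left open. What counts is that moving the scratch stacks back
    -- restores the table and the query.
    Scanned : List Bool → List Bool → Maybe Bool → Set
    Scanned T₀ q₀ r = ∀ T t₂ q q₂ → t₂ ʳ++ T ≡ T₀ → q₂ ʳ++ q ≡ q₀ → Runs (c r) fr (st z i l₁ r₁ l₂ r₂ T t₂ q q₂) t

    run-nextEntry : ∀ {T t₂ q} q₂ {t′} →
      Runs (scanTable nothing c) fr (st z i l₁ r₁ l₂ r₂ T t₂ (q₂ ʳ++ q) []) t′ →
      Runs nextEntry (frm finite-Scan finite-Mb scanBody c fr)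
        (st z i l₁ r₁ l₂ r₂ T t₂ q q₂) (length q₂ * 4 + (3 + (1 + t′)))
    run-nextEntry {T} {t₂} {q} q₂ x =
      run-transfer {W = λ a s → st z i l₁ r₁ l₂ r₂ T t₂ s a} (λ _ → slot (λ _ → refl) (λ _ _ → refl))
        (moveTo iQ) (flip _∷_) 1 push! q₂ q (length q₂) ≤-refl (again! x)

    entry-slack : ∀ x y → 5 + (y + (3 + (1 + (x + (5 + t))))) ≤ 9 + (x + (y + (5 + t)))
    entry-slack x y = ≤-reflexive (solve 3 (λ x y t → con 5 :+ (y :+ (con 3 :+ (con 1 :+ (x :+ (con 5 :+ t)))))
                        := con 9 :+ (x :+ (y :+ (con 5 :+ t)))) refl x y t)
      where open +-*-Solver

    bit-slack : ∀ x y → 8 + (x + ((4 + y) + (5 + t))) ≤ 18 + (x + (y + (5 + t)))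
    bit-slack x y = ≤-trans (m≤n+m _ 6) (≤-reflexive (solve 3 (λ x y t →
                        con 6 :+ (con 8 :+ (x :+ ((con 4 :+ y) :+ (con 5 :+ t))))
                        := con 18 :+ (x :+ (y :+ (con 5 :+ t)))) refl x y t))
      where open +-*-Solver

    mutual
      run-scan : ∀ T t₂ q → Scanned (t₂ ʳ++ T) q (find T q) →
        Runs (scanTable nothing c) fr (st z i l₁ r₁ l₂ r₂ T t₂ q []) (scanTime T [])
      run-scan [] t₂ q K = mono (m≤n+m _ 2) (iter! (pop-[] refl (exit! (K [] t₂ q [] refl refl))))
      run-scan (b ∷ T) t₂ q K =
        mono (m≤n+m _ 5) (iter! (pop-∷ refl (push! (again! (run-compare T (b ∷ t₂) b true q [] K)))))

      run-compare : ∀ T t₂ b ok q q₂ → Scanned (t₂ ʳ++ T) (q₂ ʳ++ q) (compare T b ok q q₂) →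
        Runs (scanTable (just (b , ok)) c) fr (st z i l₁ r₁ l₂ r₂ T t₂ q q₂) (scanTime T q₂)
      run-compare [] t₂ b ok q q₂ K =
        mono (≤-trans (m≤n+m _ 2) (m≤n+m _ (length q₂ * 4)))
          (iter! (pop-[] refl (exit! (K [] t₂ q q₂ refl refl))))
      run-compare (false ∷ T) t₂ b true [] q₂ K =
        mono (≤-trans (≤-trans (m≤n+m _ (length T * 9 + length q₂ * 4)) (≤-reflexive (+-assoc (length T * 9) _ _))) (m≤n+m _ 9))
          (iter! (pop-∷ refl (push! (pop-[] refl (exit! (K T (false ∷ t₂) [] q₂ refl refl))))))
      run-compare (false ∷ T) t₂ b true (d ∷ q) q₂ K =
        mono (entry-slack (length T * 9) (length q₂ * 4))
          (iter! (pop-∷ refl (push! (pop-∷ refl (push! (run-nextEntry q₂ (run-scan T (false ∷ t₂) (q₂ ʳ++ (d ∷ q)) K)))))))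
      run-compare (false ∷ T) t₂ b false [] q₂ K =
        mono (≤-trans (n≤1+n _) (entry-slack (length T * 9) (length q₂ * 4)))
          (iter! (pop-∷ refl (push! (pop-[] refl (run-nextEntry q₂ (run-scan T (false ∷ t₂) (q₂ ʳ++ []) K))))))
      run-compare (false ∷ T) t₂ b false (d ∷ q) q₂ K =
        mono (entry-slack (length T * 9) (length q₂ * 4))
          (iter! (pop-∷ refl (push! (pop-∷ refl (push! (run-nextEntry q₂ (run-scan T (false ∷ t₂) (q₂ ʳ++ (d ∷ q)) K)))))))
      run-compare (true ∷ []) t₂ b ok q q₂ K =
        mono (≤-trans (m≤n+m _ (length q₂ * 4)) (m≤n+m _ 9))
          (iter! (pop-∷ refl (push! (pop-[] refl (exit! (K [] (true ∷ t₂) q q₂ refl refl))))))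
      run-compare (true ∷ e ∷ T) t₂ b true [] q₂ K =
        mono (m≤n+m _ 11)
          (iter! (pop-∷ refl (push! (pop-∷ refl (push! (pop-[] refl (again! (run-compare T (e ∷ true ∷ t₂) b false [] q₂ K))))))))
      run-compare (true ∷ e ∷ T) t₂ b true (d ∷ q) q₂ K =
        mono (bit-slack (length T * 9) (length q₂ * 4))
          (iter! (pop-∷ refl (push! (pop-∷ refl (push! (pop-∷ refl (push! (again!
            (run-compare T (e ∷ true ∷ t₂) b (same e d) q (d ∷ q₂) K)))))))))
      run-compare (true ∷ e ∷ T) t₂ b false q q₂ K =
        mono (m≤n+m _ 12)
          (iter! (pop-∷ refl (push! (pop-∷ refl (push! (again! (run-compare T (e ∷ true ∷ t₂) b false q q₂ K)))))))

  module _ {R : Set} {c : Bool → Prog R} {fr : Frames 9 R} {z l₁ r₁ : List Bool} {n τ : ℕ} where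

    run-lookUp : ∀ l h r T σ r₀ {t} → Fits l r (contents (tape l h r)) T n τ →
      find T (reverse (contents (tape l h r))) ≡ r₀ →
      Runs (answer c r₀) fr (st z σ l₁ r₁ (code l) (code r) T [] (reverse (contents (tape l h r))) []) t →
      Runs (lookUp h c) fr (st z σ l₁ r₁ (code l) (code r) T [] [] [])
        (n * 6 + (3 + (n * 7 + (3 + (1 + (n * 7 + (3 + (n * 6 + (3 +
          (τ * 9 + (5 + (n * 4 + (3 + (τ * 4 + (3 + t)))))))))))))))
    run-lookUp l h r T σ r₀ {t} (fits l≤ r≤ u≤ T≤) refl K =
      run-readQuery l h r n l≤ r≤
        (mono (+-monoˡ-≤ _ (*-monoˡ-≤ 9 T≤))
          (run-scan T [] u (λ T′ t₂ q q₂ T≡ q≡ →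
            run-transfer {W = λ a s → st z σ l₁ r₁ (code l) (code r) T′ t₂ s a} (λ _ → slot (λ _ → refl) (λ _ _ → refl))
              (moveTo iQ) (flip _∷_) 1 push! q₂ q n (q₂≤ q q₂ q≡)
              (run-transfer {W = λ a s → st z σ l₁ r₁ (code l) (code r) s a (q₂ ʳ++ q) []} (λ _ → slot (λ _ → refl) (λ _ _ → refl))
                (moveTo iT) (flip _∷_) 1 push! t₂ T′ τ (t₂≤ T′ t₂ T≡)
                (subst₂ (λ T₁ q₁ → Runs (answer c (find T u)) fr (st z σ l₁ r₁ (code l) (code r) T₁ [] q₁ []) t)
                  (sym T≡) (sym q≡) K)))))
      where
      u = reverse (contents (tape l h r))
      q₂≤ : ∀ q q₂ → q₂ ʳ++ q ≡ u → length q₂ ≤ n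
      q₂≤ q q₂ eq = ≤-trans (m≤m+n _ (length q)) (≤-trans (≤-reflexive (trans (sym (length-ʳ++ q₂)) (trans (cong length eq) (length-reverse (contents (tape l h r)))))) u≤)
      t₂≤ : ∀ T′ t₂ → t₂ ʳ++ T′ ≡ T → length t₂ ≤ τ
      t₂≤ T′ t₂ eq = ≤-trans (m≤m+n _ (length T′)) (≤-trans (≤-reflexive (trans (sym (length-ʳ++ t₂)) (cong length eq))) T≤)

    run-known : ∀ l h r T σ b {t} → Fits l r (contents (tape l h r)) T n τ →
      find T (reverse (contents (tape l h r))) ≡ just b →
      Runs (c b) fr (st z σ l₁ r₁ (code l) (code r) T [] [] []) t →
      Runs (lookUp h c) fr (st z σ l₁ r₁ (code l) (code r) T [] [] []) (askTime n τ t)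
    run-known l h r T σ b {t} f@(fits _ _ u≤ _) eq K =
      run-lookUp l h r T σ (just b) f eq (mono (≤-trans
          (+-mono-≤ (*-monoʳ-≤ n (n≤1+n 3)) (s≤s (s≤s (s≤s (≤-trans (m≤n+m t 7) (m≤n+m _ (n * 9)))))))
          (m≤n+m _ 3))
        (run-transfer {W = λ a (s : ⊤) → st z σ l₁ r₁ (code l) (code r) T [] a []} (λ _ → slot (λ _ → refl) (λ _ _ → refl))
          discard (λ s _ → s) 0 id (reverse u) tt n (≤-trans (≤-reflexive (length-reverse u)) u≤) K))
      where
      u = contents (tape l h r)

    run-fresh : ∀ l h r T σ {t} → Fits l r (contents (tape l h r)) T n τ →
      find T (reverse (contents (tape l h r))) ≡ nothing →
      (∀ σ′ → After (true ∷ pairs (contents (tape l h r)) ++ false ∷ []) σ σ′ →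
        Br (reverse z) (λ b → Runs (c b) fr (st z σ′ l₁ r₁ (code l) (code r) (extend (contents (tape l h r)) b T) [] [] []) t)) →
      (Never (true ∷ pairs (contents (tape l h r)) ++ false ∷ []) σ → P false) →
      Runs (lookUp h c) fr (st z σ l₁ r₁ (code l) (code r) T [] [] []) (askTime n τ t)
    run-fresh l h r T σ f@(fits _ _ u≤ _) eq K F =
      run-lookUp l h r T σ nothing f eq (push! (run-emit σ
        (λ σ₁ a₁ →
          run-transfer {W = λ a s → st z σ₁ l₁ r₁ (code l) (code r) (false ∷ T) [] a s} (λ _ → slot (λ _ → refl) (λ _ _ → refl))
            (moveTo iQ₂) (flip _∷_) 1 push! (reverse u) [] n (≤-trans (≤-reflexive (length-reverse u)) u≤)
          (subst (λ q₂ → Runs (recordQuery _) fr (st z σ₁ l₁ r₁ (code l) (code r) (false ∷ T) [] [] q₂) _) (sym (reverse-involutive u))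
          (run-record u [] σ₁ n u≤
            (λ σ₂ a₂ → run-emit σ₂
              (λ σ₃ a₃ → ask! (Br-map (λ b → push!)
                (K σ₃ (λ o → trans (a₁ _) (trans (cong (λ w → emits w σ₁) (++-assoc (pairs u) (false ∷ []) o))
                               (trans (a₂ (false ∷ o)) (a₃ o)))))))
              (λ nv → F (λ o → trans (a₁ _) (trans (cong (λ w → emits w σ₁) (++-assoc (pairs u) (false ∷ []) o))
                               (trans (a₂ (false ∷ o)) (nv o))))))
            (λ nv → F (λ o → trans (a₁ _) (trans (cong (λ w → emits w σ₁) (++-assoc (pairs u) (false ∷ []) o)) (nv (false ∷ o))))))))
        (λ nv → F (λ o → nv _))))
      where
      u = contents (tape l h r)

bound-Fin : ∀ n (f : Fin n → ℕ) → ∃ λ m → ∀ i → f i ≤ m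
bound-Fin zero    f = 0 , λ ()
bound-Fin (suc n) f = let m , le = bound-Fin n (f ∘ suc) in
  f zero + m , λ { zero → m≤m+n _ _ ; (suc i) → ≤-trans (le i) (m≤n+m _ _) }

bound-Sym : (f : Sym → ℕ) → ∃ λ m → ∀ s → f s ≤ m
bound-Sym f = f blank + (f (bit true) + f (bit false)) , λ
  { blank       → m≤m+n _ _
  ; (bit true)  → ≤-trans (m≤m+n _ _) (m≤n+m _ (f blank))
  ; (bit false) → ≤-trans (m≤n+m _ (f (bit true))) (m≤n+m _ (f blank)) }

length-bitsOf : ∀ l → length (bitsOf l) ≤ length l
length-bitsOf []          = z≤n
length-bitsOf (blank ∷ l) = m≤n⇒m≤1+n (length-bitsOf l)
length-bitsOf (bit b ∷ l) = s≤s (length-bitsOf l)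

length-contents : ∀ τ → length (contents τ) ≤ suc (length (left τ) + length (right τ))
length-contents (tape l h r) = ≤-trans (length-bitsOf (reverse l ++ (h ∷ r))) (≤-reflexive
  (trans (length-++ (reverse l)) (trans (cong (_+ suc (length r)) (length-reverse l)) (+-suc _ _))))

wanted : Bool → Outcome → Bool
wanted true  acc = true
wanted false rej = true
wanted _     _   = false

module Verify (N : NOTM) where
  open NOTM N
  open Certificates bitTables N

  Regs : Set
  Regs = Fin nst × Sym × Sym

  finite-Regs : Finite Regs
  finite-Regs = finite-Fin nst ×ᶠ finite-Sym ×ᶠ finite-Sym

  ending : Maybe Bool → Prog (Regs ⊎ ⊥)
  ending nothing  = halt true
  ending (just _) = halt false

  -- After the end mark the prescription must be used up; as an exhausted `σ` prescribes nothing,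
  -- acceptance means that `σ` is a prefix of the emission.
  finish : Bool → Prog (Regs ⊎ ⊥)
  finish true  = emit false (pop iI ending)
  finish false = halt false

  act : Bool → Sym → Sym → Action nst Outcome → Prog (Regs ⊎ ⊥)
  act md h₁ h₂ (move q w₁ w₂ d₁ d₂) =
    shift d₁ iL₁ iR₁ w₁ (λ h₁ → shift d₂ iL₂ iR₂ w₂ (λ h₂ → ret (inj₁ (q , h₁ , h₂))))
  act md h₁ h₂ (ask qy qn) = lookUp h₂ (λ b → ret (inj₁ ((if b then qy else qn) , h₁ , h₂)))
  act md h₁ h₂ (halt o)    = finish (wanted md o)

  chosen : {R : Set} → Prog R → Prog R → Bool → Prog R
  chosen c c′ true  = c
  chosen c c′ false = c′

  choose : Bool → Sym → Sym → List (Action nst Outcome) → Prog (Regs ⊎ ⊥)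
  choose md h₁ h₂ []       = halt false
  choose md h₁ h₂ (a ∷ as) = ask (chosen (act md h₁ h₂ a) (choose md h₁ h₂ as))

  simBody : Bool → Regs → Prog (Regs ⊎ ⊥)
  simBody md (q , h₁ , h₂) = choose md h₁ h₂ (δ q h₁ h₂)

  sim : Bool → Regs → Prog ⊥
  sim md r = iter finite-Regs finite-⊥ (simBody md) r ⊥-elim

  regs : Config nst → Regs
  regs (cfg q t₁ t₂) = q , scan t₁ , scan t₂

  stC : Config nst → List Bool → List Bool → Stacks 9
  stC (cfg q t₁ t₂) σ T = st [] σ (code (left t₁)) (code (right t₁)) (code (left t₂)) (code (right t₂)) T [] [] []

  span : Config nst → ℕ
  span c = length (left (Config.tape₂ c)) + length (right (Config.tape₂ c))

  span-moved : ∀ q w₁ w₂ d₁ d₂ c → span (moved q w₁ w₂ d₁ d₂ c) ≤ suc (span c)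
  span-moved q w₁ w₂ d₁ S (cfg _ _ t₂) = n≤1+n _
  span-moved q w₁ w₂ d₁ L (cfg _ _ (tape [] h r))      = ≤-refl
  span-moved q w₁ w₂ d₁ L (cfg _ _ (tape (s ∷ l) h r)) = ≤-trans (≤-reflexive (+-suc _ _)) (n≤1+n _)
  span-moved q w₁ w₂ d₁ R (cfg _ _ (tape l h []))      = ≤-refl
  span-moved q w₁ w₂ d₁ R (cfg _ _ (tape l h (s ∷ r))) = s≤s (+-monoʳ-≤ (length l) (n≤1+n _))

  fits-config : ∀ c T {n τ} → suc (span c) ≤ n → length T ≤ τ →
                Fits (left (Config.tape₂ c)) (right (Config.tape₂ c)) (contents (Config.tape₂ c)) T n τ
  fits-config c T le T≤ = fits
    (≤-trans (m≤m+n _ _) (≤-trans (n≤1+n _) le)) (≤-trans (m≤n+m _ (length (left (Config.tape₂ c)))) (≤-trans (n≤1+n _) le))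
    (≤-trans (length-contents (Config.tape₂ c)) le) T≤

  entrySize : ℕ → ℕ
  entrySize n = n * 2 + 2

  branching : ∃ λ A → ∀ q h₁ h₂ → length (δ q h₁ h₂) ≤ A
  branching =
    let A , le = bound-Fin nst (λ q → proj₁ (bound-Sym (λ h₁ → proj₁ (bound-Sym (λ h₂ → length (δ q h₁ h₂)))))) in
    A , λ q h₁ h₂ → ≤-trans (proj₂ (bound-Sym (λ h₂ → length (δ q h₁ h₂))) h₂)
                   (≤-trans (proj₂ (bound-Sym (λ h₁ → proj₁ (bound-Sym (λ h₂ → length (δ q h₁ h₂))))) h₁) (le q))

  A : ℕ
  A = proj₁ branching

  simTime : ℕ → ℕ → ℕ → ℕ
  simTime n τ zero    = 0
  simTime n τ (suc t) = suc (A + askTime n τ (suc (simTime n τ t)))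

  askCost : ℕ → ℕ → ℕ
  askCost n τ = n * 43 + τ * 13 + 37

  askTime-≡ : ∀ n τ t → askTime n τ t ≡ askCost n τ + t
  askTime-≡ = solve 3 (λ n τ t →
      n :* con 6 :+ (con 3 :+ (n :* con 7 :+ (con 3 :+ (con 1 :+ (n :* con 7 :+ (con 3 :+ (n :* con 6 :+ (con 3 :+
      (τ :* con 9 :+ (con 5 :+ (n :* con 4 :+ (con 3 :+ (τ :* con 4 :+ (con 3 :+
      (con 1 :+ (con 2 :+ (n :* con 4 :+ (con 3 :+ (n :* con 9 :+ (con 3 :+ (con 2 :+ (con 1 :+ (con 1 :+ t)))))))))))))))))))))))
      := n :* con 43 :+ τ :* con 13 :+ con 37 :+ t) refl
    where open +-*-Solver

  simTime-≡ : ∀ n τ t → simTime n τ t ≡ t * (2 + A + askCost n τ)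
  simTime-≡ n τ zero    = refl
  simTime-≡ n τ (suc t) = trans (cong (λ x → suc (A + x)) (trans (askTime-≡ n τ _) (cong (λ x → askCost n τ + suc x) (simTime-≡ n τ t))))
    (solve 3 (λ a b x → con 1 :+ (a :+ (b :+ (con 1 :+ x))) := con 2 :+ a :+ b :+ x) refl A (askCost n τ) (t * (2 + A + askCost n τ)))
    where open +-*-Solver

  simTime-mono : ∀ n τ {t t′} → t ≤ t′ → simTime n τ t ≤ simTime n τ t′
  simTime-mono n τ {t} {t′} le = subst₂ _≤_ (sym (simTime-≡ n τ t)) (sym (simTime-≡ n τ t′)) (*-monoˡ-≤ _ le)

  enough : ∀ n τ t → 37 + t ≤ askTime n τ t
  enough n τ t = ≤-trans (+-monoˡ-≤ t (m≤n+m 37 (n * 43 + τ * 13))) (≤-reflexive (sym (askTime-≡ n τ t)))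

  module SimRules (br : Branching) (P : Bool → Set) where
    open Rules br P
    open VerifierRules br P

    run-move : ∀ md q w₁ w₂ d₁ d₂ c σ T {fr t} →
      Runs (sim md (regs (moved q w₁ w₂ d₁ d₂ c))) fr (stC (moved q w₁ w₂ d₁ d₂ c) σ T) t →
      Runs (act md (scan (Config.tape₁ c)) (scan (Config.tape₂ c)) (move q w₁ w₂ d₁ d₂))
        (frm finite-Regs finite-⊥ (simBody md) ⊥-elim fr) (stC c σ T) (9 + t)
    run-move md q w₁ w₂ d₁ d₂ (cfg _ t₁ t₂) σ T x =
      run-shift {W = λ a b → st [] σ a b (code (left t₂)) (code (right t₂)) T [] [] []}
        (λ _ → slot (λ _ → refl) (λ _ _ → refl)) (λ _ → slot (λ _ → refl) (λ _ _ → refl)) d₁ w₁ t₁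
      (run-shift {W = λ a b → st [] σ (code (left (moveT d₁ (write w₁ t₁)))) (code (right (moveT d₁ (write w₁ t₁)))) a b T [] [] []}
        (λ _ → slot (λ _ → refl) (λ _ _ → refl)) (λ _ → slot (λ _ → refl) (λ _ _ → refl)) d₂ w₂ t₂
      (again! x))

    run-finish : ∀ md o c σ T {fr t} → (wanted md o ≡ true → emits (false ∷ []) σ ≡ just [] → P true) →
      (P false ⊎ (wanted md o ≡ true × emits (false ∷ []) σ ≡ just [])) →
      Runs (finish (wanted md o)) fr (stC c σ T) (4 + t)
    run-finish md o (cfg _ _ _) σ T G F with wanted md o
    run-finish md o (cfg _ _ _) σ T G (inj₁ F) | false = halt! F
    run-finish md o (cfg _ _ _) σ T G (inj₂ (() , _)) | false
    ... | true = run-emit σ (λ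
        { [] a → pop-[] refl (halt! (G refl (a [])))
        ; (s ∷ σ′) a → pop-∷ refl (halt! (failed F (λ eq → contradiction (trans (sym (a [])) eq) λ ()))) })
        (λ nv → failed F (λ eq → contradiction (trans (sym (nv [])) eq) λ ()))
      where
      failed : P false ⊎ (true ≡ true × emits (false ∷ []) σ ≡ just []) → (emits (false ∷ []) σ ≡ just [] → ⊥) → P false
      failed (inj₁ F) ne = F
      failed (inj₂ (_ , eq)) ne = ⊥-elim (ne eq)

    run-chosen : ∀ {R} {c c′ : Prog R} {fr v t} b → (b ≡ true → Runs c fr v t) → (b ≡ false → Runs c′ fr v t) →
                 Runs (chosen c c′ b) fr v t
    run-chosen true  x y = x refl
    run-chosen false x y = y refl

  -- A lazy run commits itself to answers as it goes. Each guess narrows the oracles under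
  -- consideration to those that give it, so the time bound survives a fresh query.
  HaltingFor : List Bool → Config nst → ℕ → Set
  HaltingFor T c t = ∀ D → Agree D T → HaltsWithin N D c t

  -- Witnesses that some oracle agrees with `T`, so that `HaltingFor T c 0` is absurd.
  fromTable : List Bool → Lang
  fromTable T u = fromMaybe false (find T (reverse u))

  agree-fromTable : ∀ T → Agree (fromTable T) T
  agree-fromTable T u b eq = cong (fromMaybe false) eq

  next-move : ∀ {D c t q w₁ w₂ d₁ d₂} → HaltsWithin N D c (suc t) → move q w₁ w₂ d₁ d₂ ∈ choices c →
              HaltsWithin N D (moved q w₁ w₂ d₁ d₂ c) t
  next-move (hw _ all) a∈ with All.lookup all a∈
  ... | cont h = h

  next-ask : ∀ {D c t qy qn} → HaltsWithin N D c (suc t) → ask qy qn ∈ choices c →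
             HaltsWithin N D (goto (if D (asked c) then qy else qn) c) t
  next-ask (hw _ all) a∈ with All.lookup all a∈
  ... | cont h = h

  Certified : Bool → List Bool → Config nst → List Bool → Set
  Certified md T c σ = ∃ λ E → ∃ λ o → Lazy T c E o × wanted md o ≡ true × emits (emission E) σ ≡ just []

  table-room : ∀ {u : Word} {b T n t τ} → length u ≤ n → length T + suc t * entrySize n ≤ τ →
               length (extend u b T) + t * entrySize n ≤ τ
  table-room {u} {b} {T} {n} {t} u≤ le = ≤-trans (≤-reflexive (trans (cong (_+ t * entrySize n) (length-extend u b T)) (+-assoc (length T) _ _)))
    (≤-trans (+-monoʳ-≤ (length T) (+-monoˡ-≤ (t * entrySize n) (+-monoˡ-≤ 2 (*-monoˡ-≤ 2 u≤)))) le)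

  emission-∷ : ∀ u b E → emission ((u , b) ∷ E) ≡ (true ∷ pairs u ++ false ∷ []) ++ emission E
  emission-∷ u b E = cong (true ∷_) (sym (++-assoc (pairs u) (false ∷ []) (emission E)))

  module Sound (P : Bool → Set) (rejecting : P false) where
    open Rules everyAnswer P
    open VerifierRules everyAnswer P
    open SimRules everyAnswer P

    run-choose : ∀ md h₁ h₂ as {fr v t} → (∀ {a} → a ∈ as → Runs (act md h₁ h₂ a) fr v (suc t)) →
                 Runs (choose md h₁ h₂ as) fr v (length as + suc t)
    run-choose md h₁ h₂ []       K = halt! rejecting
    run-choose md h₁ h₂ (a ∷ as) K = ask! λ b → run-chosen b
      (λ _ → mono (m≤n+m _ (length as)) (K (∈-here refl))) (λ _ → run-choose md h₁ h₂ as (λ a∈ → K (∈-there a∈)))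

    -- Two quantities stay bounded: tape span plus remaining time, which limits the length of the
    -- queries, and table length plus room for one entry per remaining step. Their bounds `n` and
    -- `τ` give a uniform cost per simulated step.
    run-sim : ∀ md n τ t c σ T {fr} → HaltingFor T c t → span c + t ≤ n → length T + t * entrySize n ≤ τ →
              (Certified md T c σ → P true) →
              Runs (sim md (regs c)) fr (stC c σ T) (simTime n τ t)
    run-sim md n τ zero c σ T H _ _ G = ⊥-elim (impossible (H (fromTable T) (agree-fromTable T)))
      where
      impossible : ∀ {D c} → HaltsWithin N D c 0 → ⊥
      impossible ()
    run-sim md n τ (suc t) c@(cfg q t₁ t₂) σ T {fr} H span≤ table≤ G =
      iter! (mono (+-monoˡ-≤ _ (proj₂ branching q (scan t₁) (scan t₂))) (choosing (askTime n τ (suc T′)) refl))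
      where
      T′ = simTime n τ t
      span< : suc (span c) ≤ n
      span< = ≤-trans (≤-trans (s≤s (m≤m+n _ t)) (≤-reflexive (sym (+-suc _ t)))) span≤
      fit : Fits (left t₂) (right t₂) (contents t₂) T n τ
      fit = fits-config c T span< (m+n≤o⇒m≤o _ table≤)

      perform-ask : ∀ {qy qn} → ask qy qn ∈ choices c → ∀ r → find T (reverse (contents t₂)) ≡ r →
                    Runs (act md (scan t₁) (scan t₂) (ask qy qn)) (frm finite-Regs finite-⊥ (simBody md) ⊥-elim fr) (stC c σ T) (askTime n τ (suc T′))
      perform-ask {qy} {qn} a∈ (just b) eq = run-known (left t₂) (scan t₂) (right t₂) T σ b fit eq
            (again! (run-sim md n τ t (goto (if b then qy else qn) c) σ T
              (λ D ag → subst (λ b → HaltsWithin N D (goto (if b then qy else qn) c) t) (ag _ _ eq) (next-ask (H D ag) a∈))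
              (≤-trans (+-monoʳ-≤ (span c) (n≤1+n t)) span≤)
              (≤-trans (+-monoʳ-≤ (length T) (m≤n+m _ (entrySize n))) table≤)
              (λ (E , o , l , w , e) → G (E , o , known b a∈ eq l , w , e))))
      perform-ask {qy} {qn} a∈ nothing eq = run-fresh (left t₂) (scan t₂) (right t₂) T σ fit eq
            (λ σ′ a b → again! (run-sim md n τ t (goto (if b then qy else qn) c) σ′ (extend (contents t₂) b T)
              (λ D ag → let ag′ , Du = agree-unext {u = contents t₂} {b} eq ag in
                subst (λ b → HaltsWithin N D (goto (if b then qy else qn) c) t) Du (next-ask (H D ag′) a∈))
              (≤-trans (+-monoʳ-≤ (span c) (n≤1+n t)) span≤)
              (table-room {contents t₂} {b} {T} {n} {t} (Fits.query≤ fit) table≤)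
              (λ (E , o , l , w , e) → G ((contents t₂ , b) ∷ E , o , fresh b a∈ eq l , w ,
                trans (cong (λ w → emits w σ) (emission-∷ (contents t₂) b E)) (trans (a (emission E)) e)))))
            (λ _ → rejecting)

      perform : ∀ {a} → a ∈ choices c →
                Runs (act md (scan t₁) (scan t₂) a) (frm finite-Regs finite-⊥ (simBody md) ⊥-elim fr) (stC c σ T) (askTime n τ (suc T′))
      perform {move q w₁ w₂ d₁ d₂} a∈ =
        mono (≤-trans (≤-trans (+-monoʳ-≤ 9 (n≤1+n T′)) (+-monoˡ-≤ (suc T′) {9} {37} (m≤m+n 9 28))) (enough n τ (suc T′)))
        (run-move md q w₁ w₂ d₁ d₂ c σ T
          (run-sim md n τ t (moved q w₁ w₂ d₁ d₂ c) σ T (λ D ag → next-move (H D ag) a∈)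
            (≤-trans (+-monoˡ-≤ t (span-moved q w₁ w₂ d₁ d₂ c)) (≤-trans (≤-reflexive (sym (+-suc (span c) t))) span≤))
            (≤-trans (+-monoʳ-≤ (length T) (m≤n+m _ (entrySize n))) table≤)
            (λ (E , o , l , w , e) → G (E , o , moves a∈ l , w , e))))
      perform {halt o} a∈ =
        mono (≤-trans (≤-trans (m≤m+n 4 (suc T′)) (+-monoˡ-≤ (suc T′) {4} {37} (m≤m+n 4 33))) (enough n τ (suc T′)))
        (run-finish md o c σ T {t = 0} (λ w e → G ([] , o , halts a∈ , w , e)) (inj₁ rejecting))
      perform {ask qy qn} a∈ = perform-ask a∈ _ refl

      -- The closing `halt false` of `choose` takes a step of its own; matching on `x` exhibits
      -- `askTime` as a successor.
      choosing : ∀ x → x ≡ askTime n τ (suc T′) →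
                 Runs (choose md (scan t₁) (scan t₂) (choices c)) (frm finite-Regs finite-⊥ (simBody md) ⊥-elim fr) (stC c σ T)
                   (length (choices c) + x)
      choosing zero    eq = ⊥-elim (n≮0 (subst (1 ≤_) (sym eq) (≤-trans (s≤s z≤n) (enough n τ (suc T′)))))
      choosing (suc x) eq = run-choose md (scan t₁) (scan t₂) (choices c)
        (λ a∈ → subst (Runs _ _ _) (sym eq) (perform a∈))

  emits-split : ∀ w σ → (∃ λ σ′ → After w σ σ′) ⊎ Never w σ
  emits-split []          σ           = inj₁ (σ , λ _ → refl)
  emits-split (b ∷ w)     []          = emits-split w []
  emits-split (true ∷ w)  (true ∷ σ)  = emits-split w σ
  emits-split (true ∷ w)  (false ∷ σ) = inj₂ λ _ → refl
  emits-split (false ∷ w) (true ∷ σ)  = inj₂ λ _ → refl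
  emits-split (false ∷ w) (false ∷ σ) = emits-split w σ

  module Complete where
    open Rules someAnswer (_≡ true)
    open VerifierRules someAnswer (_≡ true)
    open SimRules someAnswer (_≡ true)

    run-choose : ∀ md h₁ h₂ as {a} → a ∈ as → ∀ {fr v t} → Runs (act md h₁ h₂ a) fr v t →
                 Runs (choose md h₁ h₂ as) fr v (length as + t)
    run-choose md h₁ h₂ (a ∷ as) (∈-here refl) x = ask! (true , mono (m≤n+m _ (length as)) x)
    run-choose md h₁ h₂ (a ∷ as) (∈-there a∈)  x = ask! (false , run-choose md h₁ h₂ as a∈ x)

    -- Any time will do here: `language-complete` replaces it by the bound that soundness
    -- establishes for all branches.
    run-sim : ∀ md c σ T {E o fr} → Lazy T c E o → wanted md o ≡ true → emits (emission E) σ ≡ just [] →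
              ∃ λ t → Runs (sim md (regs c)) fr (stC c σ T) t
    run-sim md c@(cfg q t₁ t₂) σ T (halts {o = o} a∈) w e =
      _ , iter! (run-choose md (scan t₁) (scan t₂) (choices c) a∈ (run-finish md o c σ T {t = 0} (λ _ _ → refl) (inj₂ (w , e))))
    run-sim md c@(cfg q t₁ t₂) σ T (moves {q = q′} {w₁} {w₂} {d₁} {d₂} a∈ l) w e =
      let t , x = run-sim md (moved q′ w₁ w₂ d₁ d₂ c) σ T l w e in
      _ , iter! (run-choose md (scan t₁) (scan t₂) (choices c) a∈ (run-move md q′ w₁ w₂ d₁ d₂ c σ T x))
    run-sim md c@(cfg q t₁ t₂) σ T (known {qy = qy} {qn} b a∈ eq l) w e =
      let t , x = run-sim md (goto (if b then qy else qn) c) σ T l w e in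
      _ , iter! (run-choose md (scan t₁) (scan t₂) (choices c) a∈
            (run-known (left t₂) (scan t₂) (right t₂) T σ b (fits-config c T ≤-refl ≤-refl) eq (again! x)))
    run-sim md c@(cfg q t₁ t₂) σ T {fr = fr} (fresh {qy = qy} {qn} {E} {o} b a∈ eq l) w e =
      emitted-query (emits-split (true ∷ pairs (contents t₂) ++ false ∷ []) σ)
      where
      split : emits ((true ∷ pairs (contents t₂) ++ false ∷ []) ++ emission E) σ ≡ just []
      split = trans (cong (λ w → emits w σ) (sym (emission-∷ (contents t₂) b E))) e
      emitted-query : (∃ λ σ′ → After (true ∷ pairs (contents t₂) ++ false ∷ []) σ σ′) ⊎ Never (true ∷ pairs (contents t₂) ++ false ∷ []) σ →
                      ∃ λ t → Runs (sim md (regs c)) fr (stC c σ T) t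
      emitted-query (inj₂ never) = contradiction (trans (sym (never (emission E))) split) λ ()
      emitted-query (inj₁ (σ₀ , after)) =
        let t , x = run-sim md (goto (if b then qy else qn) c) σ₀ (extend (contents t₂) b T) l w
                      (trans (sym (after (emission E))) split)
        in _ , iter! (run-choose md (scan t₁) (scan t₂) (choices c) a∈
              (run-fresh (left t₂) (scan t₂) (right t₂) T σ (fits-config c T ≤-refl ≤-refl) eq
                -- Emitting nothing more reads off the remainder of `σ` from `after` and from `a`,
                -- so that `σ₀` and `σ′` coincide.
                (λ σ′ a → b , again! (subst (λ σ → Runs (sim md (regs (goto (if b then qy else qn) c))) fr
                                                (stC (goto (if b then qy else qn) c) σ (extend (contents t₂) b T)) t)
                                        (just-injective (trans (sym (after [])) (a []))) x))
                (λ never → contradiction (trans (sym (after [])) (never [])) λ ())))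

-- Parsing the verifier's input, and the resulting NP language

parsedBit : (Bool → Prog (⊤ ⊎ ⊤) → Prog (⊤ ⊎ ⊤)) → Maybe Bool → Prog (⊤ ⊎ ⊤)
parsedBit w nothing  = halt false
parsedBit w (just b) = w b (ret (inj₁ tt))

parsed : (Bool → Prog (⊤ ⊎ ⊤) → Prog (⊤ ⊎ ⊤)) → Maybe Bool → Prog (⊤ ⊎ ⊤)
parsed w nothing      = halt false
parsed w (just false) = ret (inj₂ tt)
parsed w (just true)  = pop iI (parsedBit w)

parse : ∀ {R} → (Bool → Prog (⊤ ⊎ ⊤) → Prog (⊤ ⊎ ⊤)) → Prog R → Prog R
parse w c = Loop (pop iI (parsed w)) c

field-injective : ∀ x y r r′ → fieldCode x ++ r ≡ fieldCode y ++ r′ → x ≡ y × r ≡ r′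
field-injective []      []      r r′ eq = refl , ∷-injectiveʳ eq
field-injective []      (b ∷ y) r r′ ()
field-injective (b ∷ x) []      r r′ ()
field-injective (b ∷ x) (c ∷ y) r r′ eq =
  let xy , rr = field-injective x y r r′ (∷-injectiveʳ (∷-injectiveʳ eq))
  in cong₂ _∷_ (∷-injectiveˡ (∷-injectiveʳ eq)) xy , rr

-- Parsing pushes a field bit by bit and thereby reverses it, so `x` and `T` are stored reversed.
-- `σ` comes last, without a delimiter, and is consumed in place by `emit`.
input : Bool → Word → List Bool → List Bool → Word
input md x T σ = md ∷ fieldCode (reverse x) ++ fieldCode (reverse T) ++ σ

length-field : ∀ x → length (fieldCode x) ≡ length x * 2 + 1
length-field x = trans (length-++ (pairs x)) (cong (_+ 1) (length-pairs x))

length-input : ∀ md x T σ → length (input md x T σ) ≡ 1 + ((length x * 2 + 1) + ((length T * 2 + 1) + length σ))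
length-input md x T σ = cong suc (trans (length-++ (fieldCode (reverse x))) (cong₂ _+_
  (trans (length-field (reverse x)) (cong (λ n → n * 2 + 1) (length-reverse x)))
  (trans (length-++ (fieldCode (reverse T))) (cong (_+ length σ)
    (trans (length-field (reverse T)) (cong (λ n → n * 2 + 1) (length-reverse T)))))))

module ParseRules (br : Branching) (P : Bool → Set) where
  open Rules br P

  run-parse : ∀ {St : Set} {W : List Bool → St → Stacks 9} (sl : ∀ s → Slot iI (λ a → W a s))
    (w : Bool → Prog (⊤ ⊎ ⊤) → Prog (⊤ ⊎ ⊤)) (eff : St → Bool → St) n →
    (∀ {c fr b a s t} → Runs c fr (W a (eff s b)) t → Runs (w b c) fr (W a s) (n + t)) →
    ∀ {R} {c : Prog R} {fr t} i s m → length i ≤ m →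
    (∀ x r → i ≡ fieldCode x ++ r → Runs c fr (W r (foldl eff s x)) t) →
    ((∀ x r → i ≢ fieldCode x ++ r) → P false) →
    Runs (parse w c) fr (W i s) (m * (4 + n) + (4 + t))
  run-parse sl w eff n spec [] s m le K F =
    mono (≤-trans (m≤m+n 3 _) (m≤n+m _ (m * (4 + n)))) (iter! (slot-pop-[] (sl s) (halt! {t = 0} (F λ { [] r () ; (_ ∷ _) r () }))))
  run-parse sl w eff n spec {t = t} (false ∷ i) s (suc m) le K F =
    mono (≤-trans (m≤n+m _ 1) (m≤n+m _ (suc m * (4 + n)))) (iter! (slot-pop (sl s) (exit! (K [] i refl))))
  run-parse sl w eff n spec (true ∷ []) s (suc m) le K F =
    mono (≤-trans (m≤m+n 4 _) (m≤n+m _ (suc m * (4 + n))))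
      (iter! (slot-pop (sl s) (slot-pop-[] (sl s) (halt! {t = 0} (F λ { [] r () ; (_ ∷ _) r () })))))
  run-parse sl w eff n spec {t = t} (true ∷ b ∷ i) s (suc (suc m)) (s≤s (s≤s le)) K F =
    mono (≤-trans (≤-reflexive (sym (+-assoc (4 + n) (m * (4 + n)) (4 + t))))
           (+-monoˡ-≤ (4 + t) (+-monoʳ-≤ (4 + n) (m≤n+m (m * (4 + n)) (4 + n)))))
      (iter! (slot-pop (sl s) (slot-pop (sl s) (subst (Runs _ _ _) (+-suc n _) (spec (again!
        (run-parse sl w eff n spec i (eff s b) m le
          (λ x r eq → K (b ∷ x) r (cong (λ i → true ∷ b ∷ i) eq))
          (λ nf → F λ { [] r () ; (_ ∷ x) r eq → nf x r (∷-injectiveʳ (∷-injectiveʳ eq)) }))))))))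

module _ (N : NOTM) where
  open Verify N
  open Certificates bitTables N using (Lazy)

  pushPair : Bool → Prog (⊤ ⊎ ⊤) → Prog (⊤ ⊎ ⊤)
  pushPair b c = push iR₁ b (push iR₁ true c)

  withMode : Maybe Bool → Prog ⊥
  withMode nothing   = halt false
  withMode (just md) = parse pushPair (parse (moveTo iT) (popSym iR₁ λ h → sim md (NOTM.start N , h , blank)))

  verifier : Prog ⊥
  verifier = transfer iZ (moveTo iI) (pop iI withMode)

  initial : Word → Stacks 9
  initial w = st (w ʳ++ []) [] [] [] [] [] [] [] [] []

  Good : Word → Set
  Good w = ∃ λ md → ∃ λ x → ∃ λ T → ∃ λ σ → w ≡ input md x T σ × Certified md T (initN N x) σ

  verifierTime : ℕ → ℕ → ℕ
  verifierTime m s = m * 4 + (3 + (1 + (m * 6 + (4 + (m * 5 + (4 + (2 + s)))))))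

  module VRules (br : Branching) (P : Bool → Set) where
    open Rules br P
    open ParseRules br P

    doubled : List Bool → Bool → List Bool
    doubled s b = true ∷ b ∷ s

    foldl-doubled : ∀ y s → foldl doubled (code (map bit s)) y ≡ code (map bit (y ʳ++ s))
    foldl-doubled []      s = refl
    foldl-doubled (b ∷ y) s = foldl-doubled y (b ∷ s)

    run-verifier : ∀ w m {t} → length w ≤ m →
      (∀ md x T σ → w ≡ input md x T σ → Runs (sim md (regs (initN N x))) nil (stC (initN N x) σ T) t) →
      ((∀ md x T σ → w ≢ input md x T σ) → P false) →
      Runs verifier nil (initial w) (verifierTime m t)
    run-verifier w m {t} le K F =
      run-transfer {W = λ a s → st a s [] [] [] [] [] [] [] []} (λ _ → slot (λ _ → refl) (λ _ _ → refl))
        (moveTo iI) (flip _∷_) 1 push! (w ʳ++ []) [] m (≤-trans (≤-reflexive (length-reverse w)) le)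
        (subst (λ i → Runs (pop iI withMode) nil (st [] i [] [] [] [] [] [] [] []) _) (sym (reverse-involutive w)) (moded w le K F))
      where
      start : ∀ x {md σ T} → Runs (sim md (regs (initN N x))) nil (stC (initN N x) σ T) t →
              Runs (popSym iR₁ λ h → sim md (NOTM.start N , h , blank)) nil (st [] σ [] (code (map bit x)) [] [] T [] [] []) (2 + t)
      start [] {σ = σ} {T} k = run-popSym-[] {W = λ a → st [] σ [] a [] [] T [] [] []} (slot (λ _ → refl) (λ _ _ → refl)) k
      start (b ∷ x) {md} {σ} {T} k = run-popSym′ {W = λ a → st [] σ [] a [] [] T [] [] []} (slot (λ _ → refl) (λ _ _ → refl)) (bit b) (map bit x)
        (subst (λ r → Runs (sim md (regs (initN N (b ∷ x)))) nil (st [] σ [] (code r) [] [] T [] [] []) t) (inputTape-right b x) k)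

      moded : ∀ w → length w ≤ m →
        (∀ md x T σ → w ≡ input md x T σ → Runs (sim md (regs (initN N x))) nil (stC (initN N x) σ T) t) →
        ((∀ md x T σ → w ≢ input md x T σ) → P false) →
        Runs (pop iI withMode) nil (st [] w [] [] [] [] [] [] [] []) (1 + (m * 6 + (4 + (m * 5 + (4 + (2 + t))))))
      moded [] le K F = mono (≤-trans (m≤m+n 2 _) (s≤s (m≤n+m _ (m * 6)))) (pop-[] refl (halt! {t = 0} (F λ _ _ _ _ ())))
      moded (md ∷ i) le K F = pop-∷ refl
        (run-parse {W = λ a s → st [] a [] s [] [] [] [] [] []} (λ _ → slot (λ _ → refl) (λ _ _ → refl))
          pushPair doubled 2 (λ k → push! (push! k)) i [] m (≤-trans (n≤1+n _) le)
          (λ y r i≡ → subst (λ a → Runs _ nil (st [] r [] a [] [] [] [] [] []) _) (sym (foldl-doubled y []))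
            (run-parse {W = λ a s → st [] a [] (code (map bit (y ʳ++ []))) [] [] s [] [] []} (λ _ → slot (λ _ → refl) (λ _ _ → refl))
              (moveTo iT) (flip _∷_) 1 push! r [] m (r≤ y r i≡)
              (λ z σ r≡ → start (y ʳ++ []) (K md (reverse y) (reverse z) σ (cong (md ∷_) (whole y z σ r i≡ r≡))))
              (λ nf → F λ { md x T σ refl → nf (reverse T) σ
                (sym (proj₂ (field-injective (reverse x) y _ r i≡))) })))
          (λ nf → F λ { md x T σ refl → nf (reverse x) _ refl }))
        where
        whole : ∀ y z σ r → i ≡ fieldCode y ++ r → r ≡ fieldCode z ++ σ → i ≡ fieldCode (reverse (reverse y)) ++ fieldCode (reverse (reverse z)) ++ σ
        whole y z σ r i≡ r≡ = trans i≡ (cong₂ (λ y r → fieldCode y ++ r) (sym (reverse-involutive y))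
          (trans r≡ (cong (λ z → fieldCode z ++ σ) (sym (reverse-involutive z)))))
        r≤ : ∀ y r → i ≡ fieldCode y ++ r → length r ≤ m
        r≤ y r i≡ = ≤-trans (≤-trans (m≤n+m _ (length (fieldCode y))) (≤-reflexive (sym (trans (cong length i≡) (length-++ (fieldCode y)))))) (≤-trans (n≤1+n _) le)

  module Recognises (nptm : IsNPTM N) where

    p : ℕ → ℕ
    p = evalP (proj₁ nptm)

    -- The table in the input has at most `m` bits, and each of at most `p m` steps adds at most one
    -- entry, whose query has at most `p m` symbols.
    tableBound : ℕ → ℕ
    tableBound m = m + p m * (p m * 2 + 2)

    time : ℕ → ℕ
    time m = verifierTime m (simTime (p m) (tableBound m) (p m))

    poly-time : IsPoly time
    poly-time = poly-cong (λ m → cong (verifierTime m) (simTime-≡ (p m) (tableBound m) (p m)))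
        (poly-id *ᵖ poly-const 4 +ᵖ (poly-const 3 +ᵖ (poly-const 1 +ᵖ (poly-id *ᵖ poly-const 6 +ᵖ (poly-const 4 +ᵖ
          (poly-id *ᵖ poly-const 5 +ᵖ (poly-const 4 +ᵖ (poly-const 2 +ᵖ
            poly-p *ᵖ (poly-const (2 + A) +ᵖ (poly-p *ᵖ poly-const 43 +ᵖ
              (poly-id +ᵖ poly-p *ᵖ (poly-p *ᵖ poly-const 2 +ᵖ poly-const 2)) *ᵖ poly-const 13 +ᵖ poly-const 37))))))))))
      where
      poly-p : IsPoly p
      poly-p = poly-evalP (proj₁ nptm)

    Accepted : Word → Bool → Set
    Accepted w o = o ≡ true → Good w

    halting : ∀ w → Semantics.Halts everyAnswer (Accepted w) verifier nil (initial w) (time (length w))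
    halting w = unpack (run-verifier w m ≤-refl
        (λ md x T σ w≡ → mono (simTime-mono (p m) (tableBound m) (evalP-mono (proj₁ nptm) (x≤ md x T σ w≡)))
          (run-sim md (p m) (tableBound m) (p (length x)) (initN N x) σ T
            (λ D _ → proj₂ nptm D x)
            (evalP-mono (proj₁ nptm) (x≤ md x T σ w≡))
            (+-mono-≤ (T≤ md x T σ w≡) (*-monoˡ-≤ (p m * 2 + 2) (evalP-mono (proj₁ nptm) (x≤ md x T σ w≡))))
            (λ g _ → md , x , T , σ , w≡ , g)))
        (λ _ ()))
      where
      open Rules everyAnswer (Accepted w)
      open VRules everyAnswer (Accepted w)
      open Sound (Accepted w) (λ ())
      m = length w
      half : ∀ l → l ≤ l * 2 + 1
      half l = ≤-trans (m≤m*n l 2) (m≤m+n _ 1)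
      x≤ : ∀ md x T σ → w ≡ input md x T σ → length x ≤ m
      x≤ md x T σ refl = ≤-trans (≤-trans (half (length x)) (m≤m+n _ _)) (≤-trans (n≤1+n _) (≤-reflexive (sym (length-input md x T σ))))
      T≤ : ∀ md x T σ → w ≡ input md x T σ → length T ≤ m
      T≤ md x T σ refl = ≤-trans (≤-trans (≤-trans (half (length T)) (m≤m+n _ _)) (m≤n+m _ (length x * 2 + 1)))
        (≤-trans (n≤1+n _) (≤-reflexive (sym (length-input md x T σ))))

    accepting : ∀ w → Good w → ∃ λ t → Semantics.Halts someAnswer (_≡ true) verifier nil (initial w) t
    accepting w (md , x , T , σ , refl , E , o , l , w≡ , e) =
      let t , k = run-sim md (initN N x) σ T l w≡ e in
      verifierTime (length (input md x T σ)) t , unpack (run-verifier (input md x T σ) _ ≤-refl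
        -- The field codes are self-delimiting, so the parse can only recover the given components.
        (λ md′ x′ T′ σ′ eq → input-inj md x T σ md′ x′ T′ σ′ eq k)
        (λ nf → ⊥-elim (nf md x T σ refl)))
      where
      open Rules someAnswer (_≡ true)
      open VRules someAnswer (_≡ true)
      open Complete
      input-inj : ∀ md x T σ md′ x′ T′ σ′ → input md x T σ ≡ input md′ x′ T′ σ′ → ∀ {t} →
        Runs (sim md (regs (initN N x))) nil (stC (initN N x) σ T) t →
        Runs (sim md′ (regs (initN N x′))) nil (stC (initN N x′) σ′ T′) t
      input-inj md x T σ md′ x′ T′ σ′ eq =
        let eqx , eq₁ = field-injective (reverse x) (reverse x′) _ _ (∷-injectiveʳ eq)
            eqT , eqσ = field-injective (reverse T) (reverse T′) σ σ′ eq₁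
        in transport {x = x} {x′} {T} {T′} (∷-injectiveˡ eq) (reverse-injective eqx) (reverse-injective eqT) eqσ
        where
        transport : ∀ {md md′ x x′ T T′ σ σ′ t} → md ≡ md′ → x ≡ x′ → T ≡ T′ → σ ≡ σ′ →
          Runs (sim md (regs (initN N x))) nil (stC (initN N x) σ T) t →
          Runs (sim md′ (regs (initN N x′))) nil (stC (initN N x′) σ′ T′) t
        transport refl refl refl refl k = k

    open Program verifier using (polyCompiled; compiled; poly-runTime)

    machineTime : Poly
    machineTime = poly (poly-runTime poly-time)

    total : ∀ w → Run.HaltsT everyAnswer (Accepted w) (Program.δ verifier) load (inputTape w) emptyTape (evalP machineTime (length w))
    total w = polyCompiled everyAnswer (Accepted w) poly-time w (halting w)

    module Recogniser = Program.Nondeterministic verifier machineTime Accepted total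

    language : Lang
    language = Recogniser.language

    inNP : InNP language
    inNP = Recogniser.inNP

    sound : ∀ w → language w ≡ true → Good w
    sound w eq = Recogniser.language-sound w eq refl

    complete : ∀ w → Good w → language w ≡ true
    complete w g = let t , k = accepting w g in
      Recogniser.language-complete w _ (compiled someAnswer (_≡ true) w t k)

-- Interpreting the decision machine inside the search

-- The stacks of the search: Z is the query tape, X the input, K the table, G the
-- emission of the current round, latest bit on top, P the entries of the round,
-- T scratch, L and R the halves of the tapes of the decision machine.
pattern jZ  = zero
pattern jX  = suc jZ
pattern jK  = suc jX
pattern jG  = suc jK
pattern jP  = suc jG
pattern jT  = suc jP
pattern jL₁ = suc jT
pattern jR₁ = suc jL₁
pattern jL₂ = suc jR₁
pattern jR₂ = suc jL₂

ms : (z x κ g p t l₁ r₁ l₂ r₂ : List Bool) → Stacks 9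
ms z x κ g p t l₁ r₁ l₂ r₂ = z ∷ x ∷ κ ∷ g ∷ p ∷ t ∷ l₁ ∷ r₁ ∷ l₂ ∷ r₂ ∷ []

-- A bit of the word on the work tape of the decision machine.
write₁ : ∀ {R} → Bool → Prog R → Prog R
write₁ b c = push jR₁ b (push jR₁ true c)

copyBit : ∀ {R} → Bool → Prog R → Prog R
copyBit b c = push jT b (write₁ b c)

copyPair : ∀ {R} → Bool → Prog R → Prog R
copyPair b c = push jT b (write₁ b (write₁ true c))

copyField : ∀ {R} → Fin 10 → Prog R → Prog R
copyField i c = write₁ false (transfer i copyPair (transfer jT (moveTo i) c))

-- Every bit goes in front of what has been written, so the word is built from its end: the
-- prescription, then the table, then the input, and last the mode. `jG` has its latest bit on top
-- and hence ends up in the right order.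
prepare : ∀ {R} → Bool → Prog R → Prog R
prepare md c = transfer jG copyBit (transfer jT (moveTo jG) (copyField jK (copyField jX (write₁ md c))))

clean : ∀ {R} → Prog R → Prog R
clean c = transfer jL₁ discard (transfer jR₁ discard (transfer jL₂ discard (transfer jR₂ discard c)))

module Call (P₀ : DOTM) (p₀ : Poly) (A : Lang) (decides : DecidesWith P₀ p₀ ∅ A) where
  open DOTM P₀

  Regs : Set
  Regs = Fin nst × Sym × Sym

  finite-Regs : Finite Regs
  finite-Regs = finite-Fin nst ×ᶠ finite-Sym ×ᶠ finite-Sym

  act : Sym → Sym → Action nst Bool → Prog (Regs ⊎ Bool)
  act h₁ h₂ (move q w₁ w₂ d₁ d₂) =
    shift d₁ jL₁ jR₁ w₁ (λ h₁ → shift d₂ jL₂ jR₂ w₂ (λ h₂ → ret (inj₁ (q , h₁ , h₂))))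
  -- The machine decides relative to the empty oracle, so its queries are answered no without
  -- consulting the oracle of the search.
  act h₁ h₂ (ask qy qn) = ret (inj₁ (qn , h₁ , h₂))
  act h₁ h₂ (halt o)    = ret (inj₂ o)

  step : Regs → Prog (Regs ⊎ Bool)
  step (q , h₁ , h₂) = act h₁ h₂ (δ q h₁ h₂)

  simulate : ∀ {R} → Regs → (Bool → Prog R) → Prog R
  simulate r c = iter finite-Regs finite-Bool step r c

  call : ∀ {R} → Bool → (Bool → Prog R) → Prog R
  call md c = prepare md (popSym jR₁ λ h → simulate (start , h , blank) (λ b → clean (c b)))

  regs : Config nst → Regs
  regs (cfg q t₁ t₂) = q , scan t₁ , scan t₂

  cells : Tape → ℕ
  cells τ = length (left τ) + length (right τ)

  cells-move : ∀ d w τ → cells (moveT d (write w τ)) ≤ suc (cells τ)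
  cells-move S w τ = n≤1+n _
  cells-move L w (tape [] h r)      = ≤-refl
  cells-move L w (tape (s ∷ l) h r) = ≤-trans (≤-reflexive (+-suc _ _)) (n≤1+n _)
  cells-move R w (tape l h [])      = ≤-refl
  cells-move R w (tape l h (s ∷ r)) = s≤s (+-monoʳ-≤ (length l) (n≤1+n _))

  length-code : ∀ l → length (code l) ≤ length l * 2
  length-code []          = z≤n
  length-code (blank ∷ l) = s≤s (≤-trans (length-code l) (n≤1+n _))
  length-code (bit b ∷ l) = s≤s (s≤s (length-code l))

  runD-continues : ∀ {c c′ t} → stepAct ∅ c (δ (Config.state c) (scan (Config.tape₁ c)) (scan (Config.tape₂ c))) ≡ inj₁ c′ →
                   runD P₀ ∅ c (suc t) ≡ runD P₀ ∅ c′ t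
  runD-continues eq rewrite eq = refl

  runD-stops : ∀ {c o t} → stepAct ∅ c (δ (Config.state c) (scan (Config.tape₁ c)) (scan (Config.tape₂ c))) ≡ inj₂ o →
               runD P₀ ∅ c (suc t) ≡ just o
  runD-stops eq rewrite eq = refl

  -- The arguments bound the stacks G, K and X, the running time of the decision
  -- machine and the number of cells it visits.
  callCost : (g κ n s c : ℕ) → ℕ
  callCost g κ n s c = g * 10 + κ * 12 + n * 12 + s * 10 + c * 24 + 38

  module CallRules (br : Branching) (P : Bool → Set) where
    open Rules br P

    msC : (z x κ g p : List Bool) → Config nst → Stacks 9
    msC z x κ g p (cfg q t₁ t₂) = ms z x κ g p [] (code (left t₁)) (code (right t₁)) (code (left t₂)) (code (right t₂))

    run-simulate : ∀ {R} {c : Bool → Prog R} {fr z x κ g p} m t cf o {t′} → runD P₀ ∅ cf t ≡ just o →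
      cells (Config.tape₁ cf) + t ≤ m → cells (Config.tape₂ cf) + t ≤ m →
      (∀ cf′ → cells (Config.tape₁ cf′) ≤ m → cells (Config.tape₂ cf′) ≤ m → Runs (c o) fr (msC z x κ g p cf′) t′) →
      Runs (simulate (regs cf) c) fr (msC z x κ g p cf) (t * 10 + t′)
    run-simulate {c = c} {fr} {z} {x} {κ} {g} {p} m (suc t) cf@(cfg q t₁ t₂) o {t′} eq m₁ m₂ K =
      iter! (perform (δ q (scan t₁) (scan t₂)) refl)
      where
      perform : ∀ a → δ q (scan t₁) (scan t₂) ≡ a →
                Runs (act (scan t₁) (scan t₂) a) (frm finite-Regs finite-Bool step c fr) (msC z x κ g p cf) (9 + (t * 10 + t′))
      perform (move q′ w₁ w₂ d₁ d₂) δ≡ =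
        run-shift {W = λ a b → ms z x κ g p [] a b (code (left t₂)) (code (right t₂))}
          (λ _ → slot (λ _ → refl) (λ _ _ → refl)) (λ _ → slot (λ _ → refl) (λ _ _ → refl)) d₁ w₁ t₁
        (run-shift {W = λ a b → ms z x κ g p [] (code (left (moveT d₁ (write w₁ t₁)))) (code (right (moveT d₁ (write w₁ t₁)))) a b}
          (λ _ → slot (λ _ → refl) (λ _ _ → refl)) (λ _ → slot (λ _ → refl) (λ _ _ → refl)) d₂ w₂ t₂
        (again! (run-simulate m t (cfg q′ (moveT d₁ (write w₁ t₁)) (moveT d₂ (write w₂ t₂))) o
          (trans (sym (runD-continues {cf} (cong (stepAct ∅ cf) δ≡))) eq)
          (≤-trans (+-monoˡ-≤ t (cells-move d₁ w₁ t₁)) (≤-trans (≤-reflexive (sym (+-suc _ t))) m₁))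
          (≤-trans (+-monoˡ-≤ t (cells-move d₂ w₂ t₂)) (≤-trans (≤-reflexive (sym (+-suc _ t))) m₂)) K)))
      perform (ask qy qn) δ≡ = mono (m≤n+m _ 8) (again! (run-simulate m t (cfg qn t₁ t₂) o
          (trans (sym (runD-continues {cf} (cong (stepAct ∅ cf) δ≡))) eq)
          (≤-trans (+-monoʳ-≤ (cells t₁) (n≤1+n t)) m₁) (≤-trans (+-monoʳ-≤ (cells t₂) (n≤1+n t)) m₂) K))
      perform (halt o′) δ≡ = mono (≤-trans (s≤s (m≤n+m t′ (t * 10))) (m≤n+m _ 8))
        (exit! (subst (λ o → Runs (c o) fr (msC z x κ g p cf) t′)
          (just-injective (trans (sym eq) (runD-stops {cf} (cong (stepAct ∅ cf) δ≡))))
          (K cf (m+n≤o⇒m≤o _ m₁) (m+n≤o⇒m≤o _ m₂))))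

    cleanTime : ℕ → ℕ → ℕ
    cleanTime m t = m * 2 * 3 + (3 + (m * 2 * 3 + (3 + (m * 2 * 3 + (3 + (m * 2 * 3 + (3 + t)))))))

    run-clean : ∀ {R} {c : Prog R} {fr z x κ g p t} m cf → cells (Config.tape₁ cf) ≤ m → cells (Config.tape₂ cf) ≤ m →
      Runs c fr (ms z x κ g p [] [] [] [] []) t →
      Runs (clean c) fr (msC z x κ g p cf) (cleanTime m t)
    run-clean {z = z} {x} {κ} {g} {p} m (cfg q t₁ t₂) m₁ m₂ K =
      run-transfer {W = λ a (s : ⊤) → ms z x κ g p [] a (code (right t₁)) (code (left t₂)) (code (right t₂))}
        (λ _ → slot (λ _ → refl) (λ _ _ → refl)) discard (λ s _ → s) 0 id (code (left t₁)) tt (m * 2)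
        (short (left t₁) (≤-trans (m≤m+n _ _) m₁))
      (run-transfer {W = λ a (s : ⊤) → ms z x κ g p [] [] a (code (left t₂)) (code (right t₂))}
        (λ _ → slot (λ _ → refl) (λ _ _ → refl)) discard (λ s _ → s) 0 id (code (right t₁)) tt (m * 2)
        (short (right t₁) (≤-trans (m≤n+m _ (length (left t₁))) m₁))
      (run-transfer {W = λ a (s : ⊤) → ms z x κ g p [] [] [] a (code (right t₂))}
        (λ _ → slot (λ _ → refl) (λ _ _ → refl)) discard (λ s _ → s) 0 id (code (left t₂)) tt (m * 2)
        (short (left t₂) (≤-trans (m≤m+n _ _) m₂))
      (run-transfer {W = λ a (s : ⊤) → ms z x κ g p [] [] [] [] a}
        (λ _ → slot (λ _ → refl) (λ _ _ → refl)) discard (λ s _ → s) 0 id (code (right t₂)) tt (m * 2)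
        (short (right t₂) (≤-trans (m≤n+m _ (length (left t₂))) m₂)) K)))
      where
      short : ∀ l → length l ≤ m → length (code l) ≤ m * 2
      short l le = ≤-trans (length-code l) (*-monoˡ-≤ 2 le)

    codeW : Word → List Bool
    codeW w = code (map bit w)

    copied : List Bool × List Bool → Bool → List Bool × List Bool
    copied (t , r) b = b ∷ t , true ∷ b ∷ r

    foldl-copied : ∀ l t w → foldl copied (t , codeW w) l ≡ (l ʳ++ t , codeW (l ʳ++ w))
    foldl-copied []      t w = refl
    foldl-copied (b ∷ l) t w = foldl-copied l (b ∷ t) (b ∷ w)

    copiedPair : List Bool × List Bool → Bool → List Bool × List Bool
    copiedPair (t , r) b = b ∷ t , true ∷ true ∷ true ∷ b ∷ r

    foldl-copiedPair : ∀ l t v w → foldl copiedPair (t , codeW (pairs v ++ w)) l ≡ (l ʳ++ t , codeW (pairs (l ʳ++ v) ++ w))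
    foldl-copiedPair []      t v w = refl
    foldl-copiedPair (b ∷ l) t v w = foldl-copiedPair l (b ∷ t) (b ∷ v) w

    run-copyField : ∀ {i} {W : List Bool → List Bool → List Bool → Stacks 9} →
      (∀ t r → Slot i (λ a → W a t r)) → (∀ a r → Slot jT (λ t → W a t r)) → (∀ a t → Slot jR₁ (W a t)) →
      ∀ {R} {c : Prog R} {fr t} l w m → length l ≤ m →
      Runs c fr (W l [] (codeW (fieldCode (reverse l) ++ w))) t →
      Runs (copyField i c) fr (W l [] (codeW w)) (2 + (m * 8 + (3 + (m * 4 + (3 + t)))))
    run-copyField {i} {W} si sT sR {c = c} {fr} {t} l w m le K =
      slot-push (sR l []) (slot-push (sR l [])
        (run-transfer {W = λ a s → W a (proj₁ s) (proj₂ s)} (λ s → si (proj₁ s) (proj₂ s)) copyPair copiedPair 5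
          (λ {_} {_} {b} {a} {s} k → slot-push (sT a (proj₂ s)) (slot-push (sR a _) (slot-push (sR a _) (slot-push (sR a _) (slot-push (sR a _) k)))))
          l ([] , codeW (false ∷ w)) m le
          (subst (λ s → Runs (transfer jT (moveTo i) c) fr (W [] (proj₁ s) (proj₂ s)) _) (sym (foldl-copiedPair l [] [] (false ∷ w)))
            (run-transfer {W = λ a s → W s a (codeW (pairs (l ʳ++ []) ++ false ∷ w))} (λ s → sT s _) (moveTo i) (flip _∷_) 1
              (λ {_} {_} {b} {a} {s} k → slot-push (si a _) k) (l ʳ++ []) [] m (≤-trans (≤-reflexive (length-reverse l)) le)
              (subst₂ (λ l w → Runs c fr (W l [] (codeW w)) t) (sym (reverse-involutive l))
                (++-assoc (pairs (l ʳ++ [])) (false ∷ []) w) K)))))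

    run-prepare : ∀ md {R} {c : Prog R} {fr z p t} x κ g mg mκ mx → length g ≤ mg → length κ ≤ mκ → length x ≤ mx →
      Runs c fr (ms z x κ g p [] [] (codeW (input md x κ (reverse g))) [] []) t →
      Runs (prepare md c) fr (ms z x κ g p [] [] [] [] [])
        (mg * 6 + (3 + (mg * 4 + (3 + (2 + (mκ * 8 + (3 + (mκ * 4 + (3 + (2 + (mx * 8 + (3 + (mx * 4 + (3 + (2 + t)))))))))))))))
    run-prepare md {c = c} {fr} {z} {p} {t} x κ g mg mκ mx g≤ κ≤ x≤ K =
      run-transfer {W = λ a s → ms z x κ a p (proj₁ s) [] (proj₂ s) [] []} (λ _ → slot (λ _ → refl) (λ _ _ → refl))
        copyBit copied 3 (λ k → push! (push! (push! k))) g ([] , []) mg g≤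
      (subst (λ s → Runs _ fr (ms z x κ [] p (proj₁ s) [] (proj₂ s) [] []) _) (sym (foldl-copied g [] []))
      (run-transfer {W = λ a s → ms z x κ s p a [] (codeW (reverse g)) [] []} (λ _ → slot (λ _ → refl) (λ _ _ → refl))
        (moveTo jG) (flip _∷_) 1 push! (reverse g) [] mg (≤-trans (≤-reflexive (length-reverse g)) g≤)
      (subst (λ g′ → Runs _ fr (ms z x κ g′ p [] [] (codeW (reverse g)) [] []) _) (sym (reverse-involutive g))
      (run-copyField {W = λ a t r → ms z x a g p t [] r [] []}
        (λ _ _ → slot (λ _ → refl) (λ _ _ → refl)) (λ _ _ → slot (λ _ → refl) (λ _ _ → refl)) (λ _ _ → slot (λ _ → refl) (λ _ _ → refl))
        κ (reverse g) mκ κ≤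
      (run-copyField {W = λ a t r → ms z a κ g p t [] r [] []}
        (λ _ _ → slot (λ _ → refl) (λ _ _ → refl)) (λ _ _ → slot (λ _ → refl) (λ _ _ → refl)) (λ _ _ → slot (λ _ → refl) (λ _ _ → refl))
        x (fieldCode (reverse κ) ++ reverse g) mx x≤
      (push! (push! K)))))))

    run-call : ∀ md {R} {c : Bool → Prog R} {fr z p t} x κ g mg mκ mx ms′ mc → length g ≤ mg → length κ ≤ mκ → length x ≤ mx →
      evalP p₀ (length (input md x κ (reverse g))) ≤ ms′ →
      length (input md x κ (reverse g)) + ms′ ≤ mc →
      Runs (c (A (input md x κ (reverse g)))) fr (ms z x κ g p [] [] [] [] []) t →
      Runs (call md c) fr (ms z x κ g p [] [] [] [] []) (callCost mg mκ mx ms′ mc + t)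
    run-call md {c = c} {fr} {z} {p} {t} x κ g mg mκ mx ms′ mc g≤ κ≤ x≤ s≤ c≤ K =
      mono (≤-reflexive (solve 6 (λ g κ n s c t →
          g :* con 6 :+ (con 3 :+ (g :* con 4 :+ (con 3 :+ (con 2 :+ (κ :* con 8 :+ (con 3 :+ (κ :* con 4 :+ (con 3 :+ (con 2 :+
          (n :* con 8 :+ (con 3 :+ (n :* con 4 :+ (con 3 :+ (con 2 :+ (con 2 :+ (s :* con 10 :+
          (c :* con 2 :* con 3 :+ (con 3 :+ (c :* con 2 :* con 3 :+ (con 3 :+ (c :* con 2 :* con 3 :+ (con 3 :+ (c :* con 2 :* con 3 :+ (con 3 :+ t))))))))))))))))))))))))
          := g :* con 10 :+ κ :* con 12 :+ n :* con 12 :+ s :* con 10 :+ c :* con 24 :+ con 38 :+ t) refl mg mκ mx ms′ mc t))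
      (run-prepare md x κ g mg mκ mx g≤ κ≤ x≤
      (run-popSym′ {W = λ a → ms z x κ g p [] [] a [] []} (slot (λ _ → refl) (λ _ _ → refl)) (bit md) (map bit w)
      (mono (+-monoˡ-≤ _ (*-monoˡ-≤ 10 s≤))
      (subst (λ r → Runs (simulate (start , bit md , blank) (λ b → clean (c b))) fr (ms z x κ g p [] [] (code r) [] []) (evalP p₀ (length (md ∷ w)) * 10 + cleanTime mc t)) (inputTape-right md w)
      (run-simulate mc (evalP p₀ (length (md ∷ w))) (initD P₀ (md ∷ w)) (A (md ∷ w)) (decides (md ∷ w))
        (≤-trans (+-mono-≤ (≤-trans (≤-reflexive (trans (cong length (inputTape-right md w)) (length-map bit w))) (n≤1+n _)) s≤) c≤)
        (≤-trans s≤ (≤-trans (m≤n+m _ _) c≤))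
        (λ cf m₁ m₂ → run-clean mc cf m₁ m₂ K))))))
      where
      open +-*-Solver
      w = fieldCode (reverse x) ++ fieldCode (reverse κ) ++ reverse g

-- Prefixes of emissions

entries : List Word → List Bool
entries []       = []
entries (u ∷ us) = true ∷ pairs u ++ false ∷ entries us

emission-entries : ∀ E → emission E ≡ entries (map proj₁ E) ++ false ∷ []
emission-entries []            = refl
emission-entries ((u , b) ∷ E) = cong (true ∷_) (trans (cong (λ l → pairs u ++ false ∷ l) (emission-entries E))
  (sym (++-assoc (pairs u) (false ∷ entries (map proj₁ E)) (false ∷ []))))

entries-∷ʳ : ∀ us v → entries (us ∷ʳ v) ≡ (entries us ++ true ∷ pairs v) ++ false ∷ []
entries-∷ʳ []       v = refl
entries-∷ʳ (u ∷ us) v = cong (true ∷_) (trans (cong (λ l → pairs u ++ false ∷ l) (entries-∷ʳ us v))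
  (sym (trans (cong (_++ false ∷ []) (++-assoc (pairs u) (false ∷ entries us) (true ∷ pairs v)))
              (++-assoc (pairs u) (false ∷ entries us ++ true ∷ pairs v) (false ∷ [])))))

pairs-∷ʳ : ∀ v c → pairs (v ∷ʳ c) ≡ pairs v ++ true ∷ c ∷ []
pairs-∷ʳ []      c = refl
pairs-∷ʳ (b ∷ v) c = cong (λ l → true ∷ b ∷ l) (pairs-∷ʳ v c)

emits-prefix : ∀ o σ → emits o σ ≡ just [] → ∃ λ r → o ≡ σ ++ r
emits-prefix o           []          eq = o , refl
emits-prefix []          (c ∷ σ)     ()
emits-prefix (true ∷ o)  (true ∷ σ)  eq = let r , o≡ = emits-prefix o σ eq in r , cong (true ∷_) o≡
emits-prefix (true ∷ o)  (false ∷ σ) ()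
emits-prefix (false ∷ o) (true ∷ σ)  ()
emits-prefix (false ∷ o) (false ∷ σ) eq = let r , o≡ = emits-prefix o σ eq in r , cong (false ∷_) o≡

prefix-emits : ∀ σ r → emits (σ ++ r) σ ≡ just []
prefix-emits []          []      = refl
prefix-emits []          (c ∷ r) = prefix-emits [] r
prefix-emits (true ∷ σ)  r       = prefix-emits σ r
prefix-emits (false ∷ σ) r       = prefix-emits σ r

pairs-injective : ∀ x y {r s} → pairs x ++ false ∷ r ≡ pairs y ++ false ∷ s → x ≡ y × r ≡ s
pairs-injective []      []      eq = refl , ∷-injectiveʳ eq
pairs-injective []      (b ∷ y) ()
pairs-injective (b ∷ x) []      ()
pairs-injective (b ∷ x) (c ∷ y) eq =
  let xy , rs = pairs-injective x y (∷-injectiveʳ (∷-injectiveʳ eq))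
  in cong₂ _∷_ (∷-injectiveˡ (∷-injectiveʳ eq)) xy , rs

strip : ∀ us ks {r} → entries ks ++ false ∷ [] ≡ entries us ++ r →
        ∃ λ ks′ → ks ≡ us ++ ks′ × r ≡ entries ks′ ++ false ∷ []
strip []       ks       eq = ks , refl , sym eq
strip (u ∷ us) []       ()
strip (u ∷ us) (k ∷ ks) {r} eq =
  let ku , rest = pairs-injective k u (trans (sym (++-assoc (pairs k) (false ∷ entries ks) (false ∷ [])))
                    (trans (∷-injectiveʳ eq) (++-assoc (pairs u) (false ∷ entries us) r)))
      ks′ , ks≡ , r≡ = strip us ks rest
  in ks′ , cong₂ _∷_ ku ks≡ , r≡

-- The position in the grammar of emissions: between entries, between the letters of a query, or
-- just after the `true` announcing a letter. It determines the meaning of the next bit.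
data Phase : Set where
  entryStart inside letter : Phase

finite-Phase : Finite Phase
finite-Phase = retract code′ decode decode-code finite-Mb
  where
  code′ : Phase → Maybe Bool
  code′ entryStart = nothing
  code′ inside     = just true
  code′ letter     = just false
  decode : Maybe Bool → Phase
  decode nothing      = entryStart
  decode (just true)  = inside
  decode (just false) = letter
  decode-code : ∀ p → decode (code′ p) ≡ p
  decode-code entryStart = refl
  decode-code inside     = refl
  decode-code letter     = refl

partial : Phase → List Word → Word → List Bool
partial entryStart us v = entries us
partial inside     us v = entries us ++ true ∷ pairs v
partial letter     us v = (entries us ++ true ∷ pairs v) ++ true ∷ []

NonEmpty : List Bool → Set
NonEmpty r = ∃ λ c → ∃ λ r′ → r ≡ c ∷ r′

nonEmpty-entries : ∀ ks → NonEmpty (entries ks ++ false ∷ [])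
nonEmpty-entries []       = false , [] , refl
nonEmpty-entries (k ∷ ks) = true , _ , refl

inside-continues : ∀ v k {r s} → pairs v ++ r ≡ pairs k ++ false ∷ s → NonEmpty r
inside-continues []      []      refl = false , _ , refl
inside-continues []      (c ∷ k) refl = true , _ , refl
inside-continues (b ∷ v) []      ()
inside-continues (b ∷ v) (c ∷ k) eq = inside-continues v k (∷-injectiveʳ (∷-injectiveʳ eq))

letter-continues : ∀ v k {r s} → pairs v ++ true ∷ r ≡ pairs k ++ false ∷ s → NonEmpty r
letter-continues []      []      ()
letter-continues []      (c ∷ k) refl = c , _ , refl
letter-continues (b ∷ v) []      ()
letter-continues (b ∷ v) (c ∷ k) eq = letter-continues v k (∷-injectiveʳ (∷-injectiveʳ eq))

current-entry : ∀ us ks {r} → entries ks ++ false ∷ [] ≡ entries us ++ true ∷ r →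
                ∃ λ k → ∃ λ s → r ≡ pairs k ++ false ∷ s
current-entry us ks eq with strip us ks eq
... | []      , _ , ()
... | k ∷ ks′ , _ , r≡ = k , _ , trans (∷-injectiveʳ r≡) (++-assoc (pairs k) (false ∷ entries ks′) (false ∷ []))

-- An emission ends with the `false` that stands in place of a further entry. No phase lies behind
-- that mark, so a partial emission is always a proper prefix.
partial-continues : ∀ ph us v ks {r} → entries ks ++ false ∷ [] ≡ partial ph us v ++ r → NonEmpty r
partial-continues entryStart us v ks eq =
  let ks′ , _ , r≡ = strip us ks eq in subst NonEmpty (sym r≡) (nonEmpty-entries ks′)
partial-continues inside us v ks {r} eq =
  let k , s , r≡ = current-entry us ks (trans eq (++-assoc (entries us) (true ∷ pairs v) r))
  in inside-continues v k r≡
partial-continues letter us v ks {r} eq =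
  let k , s , r≡ = current-entry us ks (trans eq (trans (++-assoc (entries us ++ true ∷ pairs v) (true ∷ []) r)
                                                         (++-assoc (entries us) (true ∷ pairs v) (true ∷ r))))
  in letter-continues v k r≡

-- Entries begin with `true`, so the end mark cannot be the start of one: a prefix containing it
-- determines the whole list of queries.
complete-keys : ∀ us ks {r} → entries ks ++ false ∷ [] ≡ (entries us ++ false ∷ []) ++ r → ks ≡ us
complete-keys us ks {r} eq with strip us ks (trans eq (++-assoc (entries us) (false ∷ []) r))
... | []      , ks≡ , _ = trans ks≡ (++-identityʳ us)
... | k ∷ ks′ , _   , ()

-- The search in rounds and its polynomial bound

module Searching (N : NOTM) (nptm : IsNPTM N) (P₀ : DOTM) (p₀ : Poly) (A : Lang) (decides : DecidesWith P₀ p₀ ∅ A) where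
  open Certificates bitTables N
  open Verify N using (Certified; span; span-moved; next-move; next-ask)
  open Call P₀ p₀ A decides

  -- While the bits of a query are found, it is built up twice: on `jZ` for asking, and on `jP` as a
  -- table entry, which the answer completes. Both stacks reverse it, as `ask` and the table format
  -- require.
  extendBy : Phase → Bool → Prog (Phase ⊎ ⊤)
  extendBy entryStart true  = push jP false (ret (inj₁ inside))
  extendBy entryStart false = ret (inj₂ tt)
  extendBy inside     true  = ret (inj₁ letter)
  extendBy inside     false = ask λ a → push jP a (transfer jZ discard (ret (inj₁ entryStart)))
  extendBy letter     c     = push jP c (push jP true (push jZ c (ret (inj₁ inside))))

  -- One call per bit suffices. The prefix so far is certified and some bit continues it, so a
  -- refusal of `true` forces `false`.
  tryBit : Phase → Bool → Prog (Phase ⊎ ⊤)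
  tryBit ph true  = extendBy ph true
  tryBit ph false = pop jG λ _ → push jG false (extendBy ph false)

  build : ∀ {R} → Phase → Prog R → Prog R
  build ph c = iter finite-Phase finite-⊤ (λ ph → push jG true (call true (tryBit ph))) ph (λ _ → c)

  finishRound : ∀ {R} → Prog R → Prog R
  finishRound c = transfer jG discard (transfer jP (moveTo jT) (transfer jT (moveTo jK) c))

  afterRej : Bool → Prog (⊤ ⊎ ⊥)
  afterRej true  = build entryStart (finishRound (ret (inj₁ tt)))
  afterRej false = halt true

  afterAcc : Bool → Prog (⊤ ⊎ ⊥)
  afterAcc true  = call false afterRej
  afterAcc false = halt false

  rounds : Prog ⊥
  rounds = iter finite-⊤ finite-⊥ (λ _ → call true afterAcc) tt ⊥-elim

  searcher : Prog ⊥
  searcher = transfer jZ (moveTo jX) rounds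

  -- `D` gives the guessed answers, so the lazy run is a run under `D` and its time bound applies:
  -- at most `t` queries, each of at most `n` symbols, with two bits per symbol and two marks per
  -- query.
  lazy-size : ∀ {D T c E o t n} → Lazy T c E o → Agree D T → Answers D E → HaltsWithin N D c t → span c + t ≤ n →
              length (emission E) ≤ t * (n * 2 + 2) + 1
  lazy-size (halts _) ag as h le = m≤n+m 1 _
  lazy-size {t = suc t} {n} (moves {c = c} {q} {w₁} {w₂} {d₁} {d₂} a∈ l) ag as h le =
    ≤-trans (lazy-size {n = n} l ag as (next-move h a∈)
              (≤-trans (+-monoˡ-≤ t (span-moved q w₁ w₂ d₁ d₂ c)) (≤-trans (≤-reflexive (sym (+-suc (span c) t))) le)))
      (+-monoˡ-≤ 1 (m≤n+m (t * (n * 2 + 2)) (n * 2 + 2)))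
  lazy-size {t = suc t} {n} (known {c = c} {qy} {qn} b a∈ eq l) ag as h le =
    ≤-trans (lazy-size {n = n} l ag as (subst (λ b → HaltsWithin N _ (goto (if b then qy else qn) c) t) (ag _ _ eq) (next-ask h a∈))
              (≤-trans (+-monoʳ-≤ (span c) (n≤1+n t)) le))
      (+-monoˡ-≤ 1 (m≤n+m (t * (n * 2 + 2)) (n * 2 + 2)))
  lazy-size {t = suc t} {n} (fresh {c = c} {qy} {qn} {E} b a∈ eq l) ag (a ∷ as) h le =
    ≤-trans (≤-reflexive (cong suc (trans (length-++ (pairs u)) (cong (_+ suc (length (emission E))) (length-pairs u)))))
    (≤-trans (s≤s (+-mono-≤ (*-monoˡ-≤ 2 u≤) (s≤s (lazy-size {n = n} l (agree-ext _ b ag a) as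
        (subst (λ b → HaltsWithin N _ (goto (if b then qy else qn) c) t) a (next-ask h a∈))
        (≤-trans (+-monoʳ-≤ (span c) (n≤1+n t)) le)))))
      (≤-reflexive (solve 2 (λ x y → con 1 :+ (x :+ (con 1 :+ (y :+ con 1))) := ((x :+ con 2) :+ y) :+ con 1) refl (n * 2) (t * (n * 2 + 2)))))
    where
    open +-*-Solver
    u = asked c
    u≤ : length u ≤ n
    u≤ = ≤-trans (length-contents (Config.tape₂ c)) (≤-trans (≤-trans (s≤s (m≤m+n (span c) t)) (≤-reflexive (sym (+-suc (span c) t)))) le)

  certificate-size : ∀ {D T x E o t} → (∀ D → HaltsWithin N D (initN N x) t) → Lazy T (initN N x) E o → Agree D T →
                     length (emission E) ≤ t * (t * 2 + 2) + 1
  certificate-size {D} {T} {x} {E} {t = t} h l ag =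
    lazy-size {n = t} l (patch-agree l ag) (patch-answers D l) (h _) ≤-refl

  learn-∷ʳ : ∀ {D} us v T → learn D (us ∷ʳ v) T ≡ extend v (D v) (learn D us T)
  learn-∷ʳ []       v T = refl
  learn-∷ʳ (u ∷ us) v T = learn-∷ʳ us v _

  learn-++ : ∀ {D} us S₀ T → learn D us S₀ ++ T ≡ learn D us (S₀ ++ T)
  learn-++ []       S₀ T = refl
  learn-++ {D} (u ∷ us) S₀ T = trans (learn-++ us _ T)
    (cong (learn D us) (cong (D u ∷_) (++-assoc (pairs (u ʳ++ [])) (false ∷ S₀) T)))

  length-learn : ∀ {D} us T → length (learn D us T) ≡ length T + length (entries us)
  length-learn []       T = sym (+-identityʳ _)
  length-learn {D} (u ∷ us) T = trans (length-learn us _) (trans (cong (_+ length (entries us)) (length-extend u (D u) T))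
    (trans (+-assoc (length T) _ _) (cong (length T +_)
      (sym (trans (cong suc (trans (length-++ (pairs u)) (cong (_+ suc (length (entries us))) (length-pairs u))))
        (solve 2 (λ x y → con 1 :+ (x :+ (con 1 :+ y)) := (x :+ con 2) :+ y) refl (length u * 2) (length (entries us))))))))
    where open +-*-Solver

  p : ℕ → ℕ
  p = evalP (proj₁ nptm)

  -- An entry is as long in the table as in an emission, so each of at most `suc (p n)` learning
  -- rounds lengthens the table by at most `emissionBound n`. The `suc` before the emission bound in
  -- `inputBound` accounts for the tentative bit, which may go beyond a certified prefix.
  emissionBound tableBound inputBound decisionTime callTime bitTime roundCost : ℕ → ℕ
  emissionBound n = p n * (p n * 2 + 2) + 1
  tableBound n    = suc (p n) * emissionBound n
  inputBound n    = 1 + ((n * 2 + 1) + ((tableBound n * 2 + 1) + suc (emissionBound n)))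
  decisionTime n  = evalP p₀ (inputBound n)
  callTime n      = callCost (suc (emissionBound n)) (tableBound n) n (decisionTime n) (inputBound n + decisionTime n)
  bitTime n       = callTime n + (emissionBound n * 3 + 10)
  roundCost n     = callTime n * 2 + suc (emissionBound n) * bitTime n + emissionBound n * 11 + 13

  roundTime : ℕ → ℕ → ℕ
  roundTime n t = 1 + (callTime n + (1 + (callTime n + (1 + (suc (emissionBound n) * bitTime n +
    (emissionBound n * 3 + (3 + (emissionBound n * 4 + (3 + (emissionBound n * 4 + (3 + (1 + t))))))))))))

  -- `r` bounds the rounds that learn something; one further round is charged for the one that
  -- halts.
  roundsTime : ℕ → ℕ → ℕ
  roundsTime n zero    = roundTime n 0
  roundsTime n (suc r) = roundTime n (roundsTime n r)

  roundsTime-≡ : ∀ n r → roundsTime n r ≡ suc r * roundCost n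
  roundsTime-≡ n r = each-round r
    where
    roundTime-≡ : ∀ t → roundTime n t ≡ roundCost n + t
    roundTime-≡ t = solve 4 (λ c b e t →
        con 1 :+ (c :+ (con 1 :+ (c :+ (con 1 :+ (b :+ (e :* con 3 :+ (con 3 :+ (e :* con 4 :+ (con 3 :+ (e :* con 4 :+ (con 3 :+ (con 1 :+ t))))))))))))
        := (c :* con 2 :+ b :+ e :* con 11 :+ con 13) :+ t) refl (callTime n) (suc (emissionBound n) * bitTime n) (emissionBound n) t
      where open +-*-Solver
    each-round : ∀ r → roundsTime n r ≡ suc r * roundCost n
    each-round zero    = roundTime-≡ 0
    each-round (suc r) = trans (roundTime-≡ _) (cong (roundCost n +_) (each-round r))

  module Correctness (under : RobustlyUnderproductive N)
           (sound : ∀ w → A w ≡ true → Good N w) (complete : ∀ w → Good N w → A w ≡ true)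
           (D : Lang) (x : Word) where

    c₀ = initN N x
    n = length x
    e = emissionBound n

    -- What the verdict can guarantee under an arbitrary oracle, where accepting and rejecting runs
    -- may both be absent.
    Right : Bool → Set
    Right o = (o ≡ true → ¬ ∃ λ us → Path D c₀ us rej) × (o ≡ false → ¬ ∃ λ us → Path D c₀ us acc)

    open Rules (byOracle D) Right
    open VerifierRules (byOracle D) Right using (ask!)
    open CallRules (byOracle D) Right

    certified : ∀ {md T σ} → A (input md x T σ) ≡ true → Certified md T c₀ σ
    certified {md} {T} {σ} eq = let md′ , x′ , T′ , σ′ , w≡ , g = sound _ eq in transport md′ x′ T′ σ′ w≡ g
      where
      transport : ∀ md′ x′ T′ σ′ → input md x T σ ≡ input md′ x′ T′ σ′ → Certified md′ T′ (initN N x′) σ′ → Certified md T c₀ σ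
      transport md′ x′ T′ σ′ w≡ g
        with refl ← ∷-injectiveˡ w≡
        with eqx , eq₁ ← field-injective (reverse x) (reverse x′) _ _ (∷-injectiveʳ w≡)
        with eqT , eqσ ← field-injective (reverse T) (reverse T′) σ σ′ eq₁
        with refl ← reverse-injective {x = x} {y = x′} eqx
        with refl ← reverse-injective {x = T} {y = T′} eqT
        with refl ← eqσ = g

    recognised : ∀ {md T σ} → Certified md T c₀ σ → A (input md x T σ) ≡ true
    recognised {md} {T} {σ} g = complete _ (md , x , T , σ , refl , g)

    emission-short : ∀ {T E o} → Agree D T → Lazy T c₀ E o → length (emission E) ≤ e
    emission-short ag l = certificate-size (λ D → proj₂ nptm D x) l ag

    certified-prefix : ∀ {md T σ} → Certified md T c₀ σ →
      ∃ λ E → ∃ λ o → Lazy T c₀ E o × wanted md o ≡ true × ∃ λ r → emission E ≡ σ ++ r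
    certified-prefix {σ = σ} (E , o , l , w , eq) = E , o , l , w , emits-prefix (emission E) σ eq

    prefix-certified : ∀ {md T σ E o r} → Lazy T c₀ E o → wanted md o ≡ true → emission E ≡ σ ++ r → Certified md T c₀ σ
    prefix-certified {σ = σ} {E} {o} {r} l w eq = E , o , l , w , trans (cong (λ o → emits o σ) eq) (prefix-emits σ r)

    certified-short : ∀ {md T σ} → Agree D T → Certified md T c₀ σ → length σ ≤ e
    certified-short {σ = σ} ag g = let E , o , l , w , r , eq = certified-prefix g in
      ≤-trans (≤-trans (m≤m+n (length σ) (length r)) (≤-reflexive (sym (trans (cong length eq) (length-++ σ))))) (emission-short ag l)

    next-bit : ∀ {md T} ph us v → Certified md T c₀ (partial ph us v) → ∃ λ c → Certified md T c₀ (partial ph us v ++ c ∷ [])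
    next-bit ph us v g =
      let E , o , l , w , r , eq = certified-prefix g
          c , r′ , r≡ = partial-continues ph us v (keys E) (trans (sym (emission-entries E)) eq)
      in c , prefix-certified l w (trans eq (trans (cong (partial ph us v ++_) r≡) (sym (++-assoc (partial ph us v) (c ∷ []) r′))))

    run-call-here : ∀ md {R} {c : Bool → Prog R} {fr z pd t} T G → length G ≤ suc e → length T ≤ tableBound n →
      (∀ b → A (input md x T (reverse G)) ≡ b → Runs (c b) fr (ms z x T G pd [] [] [] [] []) t) →
      Runs (call md c) fr (ms z x T G pd [] [] [] [] []) (callTime n + t)
    run-call-here md T G G≤ T≤ K =
      run-call md x T G (suc e) (tableBound n) n (decisionTime n) (inputBound n + decisionTime n) G≤ T≤ ≤-refl
        (evalP-mono p₀ short) (+-monoˡ-≤ (decisionTime n) short) (K _ refl)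
      where
      short : length (input md x T (reverse G)) ≤ inputBound n
      short = ≤-trans (≤-reflexive (length-input md x T (reverse G)))
        (s≤s (+-monoʳ-≤ (n * 2 + 1) (+-mono-≤ (+-monoˡ-≤ 1 (*-monoˡ-≤ 2 T≤)) (≤-trans (≤-reflexive (length-reverse G)) G≤))))

    learnt : Phase → List Word → Word → List Bool
    learnt entryStart us v = learn D us []
    learnt _          us v = pairs (reverse v) ++ false ∷ learn D us []

    asking : Phase → Word → List Bool
    asking entryStart v = []
    asking _          v = reverse v

    Building : Phase → List Word → Word → List Bool → List Bool → Stacks 9
    Building ph us v T G = ms (asking ph v) x T G (learnt ph us v) [] [] [] [] []

    module _ {T : List Bool} (agree : Agree D T) (T≤ : length T ≤ tableBound n)
             {R : Set} {c : Prog R} {fr : Frames 9 R} {t : ℕ}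
             (K : ∀ us G → reverse G ≡ entries us ++ false ∷ [] → Certified true T c₀ (reverse G) →
                  Runs c fr (ms [] x T G (learn D us []) [] [] [] [] []) t) where

      Loop-frame : Frames 9 (Phase ⊎ ⊤)
      Loop-frame = frm finite-Phase finite-⊤ (λ ph → push jG true (call true (tryBit ph))) (λ _ → c) fr

      snoc : ∀ c G {σ : List Bool} → reverse G ≡ σ → reverse (c ∷ G) ≡ σ ++ c ∷ []
      snoc c G eq = trans (unfold-reverse c G) (cong (_++ c ∷ []) eq)

      mutual
        -- `d` is fuel: a certified prefix has at most `e` bits, so the loop has left before
        -- `length G + d > e` could hold with `d` equal to zero.
        run-build : ∀ d ph us v G → reverse G ≡ partial ph us v → Certified true T c₀ (reverse G) → e < length G + d →
                    Runs (build ph c) fr (Building ph us v T G) (d * bitTime n + t)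
        run-build zero ph us v G G≡ g fuel = ⊥-elim (<-irrefl refl (<-≤-trans fuel
          (≤-trans (≤-reflexive (trans (+-identityʳ _) (sym (length-reverse G)))) (certified-short agree g))))
        run-build (suc d) ph us v G G≡ g fuel = mono (≤-reflexive time)
          (iter! (push! (run-call-here true T (true ∷ G) (s≤s G≤) T≤ tried)))
          where
          G≤ : length G ≤ e
          G≤ = ≤-trans (≤-reflexive (sym (length-reverse G))) (certified-short agree g)
          rest = d * bitTime n + t
          time : 2 + (callTime n + (2 + (e * 3 + 6 + rest))) ≡ suc d * bitTime n + t
          time = solve 4 (λ c e b t → con 2 :+ (c :+ (con 2 :+ (e :* con 3 :+ con 6 :+ (b :+ t)))) := c :+ (e :* con 3 :+ con 10) :+ b :+ t)
                   refl (callTime n) e (d * bitTime n) t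
            where open +-*-Solver
          fuel′ : ∀ b → e < length (b ∷ G) + d
          fuel′ b = <-≤-trans fuel (≤-reflexive (+-suc (length G) d))
          forced : ∀ b → A (input true x T (reverse (true ∷ G))) ≡ false → Certified true T c₀ (partial ph us v ++ b ∷ []) →
                   Certified true T c₀ (reverse (false ∷ G))
          forced true  eq g′ = contradiction (trans (sym eq) (recognised (subst (Certified true T c₀) (sym (snoc true G G≡)) g′))) λ ()
          forced false eq g′ = subst (Certified true T c₀) (sym (snoc false G G≡)) g′
          tried : ∀ b → A (input true x T (reverse (true ∷ G))) ≡ b →
                  Runs (tryBit ph b) Loop-frame (Building ph us v T (true ∷ G)) (2 + (e * 3 + 6 + rest))
          tried true  eq = mono (m≤n+m _ 2) (run-extend d ph us v true G G≡ G≤ (certified eq) (fuel′ true))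
          tried false eq = let b , g′ = next-bit ph us v (subst (Certified true T c₀) G≡ g) in
            pop-∷ refl (push! (run-extend d ph us v false G G≡ G≤ (forced b eq g′) (fuel′ false)))

        run-extend : ∀ d ph us v b G → reverse G ≡ partial ph us v → length G ≤ e →
                     Certified true T c₀ (reverse (b ∷ G)) → e < length (b ∷ G) + d →
                     Runs (extendBy ph b) Loop-frame (Building ph us v T (b ∷ G)) (e * 3 + 6 + (d * bitTime n + t))
        run-extend d entryStart us v true G G≡ G≤ g fuel = mono (pad 2 4)
          (push! (again! (run-build d inside us [] (true ∷ G) (snoc true G G≡) g fuel)))
        run-extend d entryStart us v false G G≡ G≤ g fuel = mono (≤-trans (s≤s (m≤n+m t (d * bitTime n))) (pad 1 5))
          (exit! (K us (false ∷ G) (snoc false G G≡) g))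
        run-extend d inside us v true G G≡ G≤ g fuel = mono (pad 1 5)
          (again! (run-build d letter us v (true ∷ G) (snoc true G G≡) g fuel))
        run-extend d inside us v false G G≡ G≤ g fuel = mono (≤-reflexive time)
          (ask! (push! (run-transfer {W = λ a (s : ⊤) → ms a x T (false ∷ G) (D (reverse (reverse v)) ∷ pairs (reverse v) ++ false ∷ learn D us []) [] [] [] [] []}
              (λ _ → slot (λ _ → refl) (λ _ _ → refl)) discard (λ s _ → s) 0 id (reverse v) tt e v≤
            (again! (subst (λ l → Runs (build entryStart c) fr (ms [] x T (false ∷ G) l [] [] [] [] []) (d * bitTime n + t)) entry≡
              (run-build d entryStart (us ∷ʳ v) [] (false ∷ G) (trans (snoc false G G≡) (sym (entries-∷ʳ us v))) g fuel))))))
          where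
          time : 2 + (e * 3 + (3 + (1 + (d * bitTime n + t)))) ≡ e * 3 + 6 + (d * bitTime n + t)
          time = solve 2 (λ e t → con 2 :+ (e :* con 3 :+ (con 3 :+ (con 1 :+ t))) := e :* con 3 :+ con 6 :+ t) refl e (d * bitTime n + t)
            where open +-*-Solver
          entry≡ : learn D (us ∷ʳ v) [] ≡ D (reverse (reverse v)) ∷ pairs (reverse v) ++ false ∷ learn D us []
          entry≡ = trans (learn-∷ʳ us v []) (cong (λ b → b ∷ pairs (reverse v) ++ false ∷ learn D us []) (cong D (sym (reverse-involutive v))))
          v≤ : length (reverse v) ≤ e
          v≤ = ≤-trans (≤-reflexive (length-reverse v)) (≤-trans (≤-trans (≤-trans (m≤m*n (length v) 2) (≤-reflexive (sym (length-pairs v))))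
            (≤-trans (n≤1+n _) (≤-trans (m≤n+m _ (length (entries us))) (≤-reflexive (trans (sym (length-++ (entries us)))
              (trans (cong length (sym G≡)) (length-reverse G))))))) G≤)
        run-extend d letter us v b G G≡ G≤ g fuel = mono (pad 4 2)
          (push! (push! (push! (again! (subst₂ (λ z l → Runs (build inside c) fr (ms z x T (b ∷ G) l [] [] [] [] []) (d * bitTime n + t))
              reversed (cong (λ r → pairs r ++ false ∷ learn D us []) reversed)
            (run-build d inside us (v ∷ʳ b) (b ∷ G) (trans (snoc b G G≡) more) g fuel))))))
          where
          reversed : reverse (v ∷ʳ b) ≡ b ∷ reverse v
          reversed = reverse-++ v (b ∷ [])
          more : ((entries us ++ true ∷ pairs v) ++ true ∷ []) ++ b ∷ [] ≡ entries us ++ true ∷ pairs (v ∷ʳ b)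
          more = trans (++-assoc (entries us ++ true ∷ pairs v) (true ∷ []) (b ∷ []))
            (trans (++-assoc (entries us) (true ∷ pairs v) (true ∷ b ∷ []))
              (cong (λ l → entries us ++ true ∷ l) (sym (pairs-∷ʳ v b))))

        pad : ∀ i j {y} → i + y ≤ e * 3 + (i + j) + y
        pad i j {y} = +-monoˡ-≤ y (≤-trans (m≤m+n i j) (m≤n+m (i + j) (e * 3)))

    run-finishRound : ∀ {R} {c : Prog R} {fr t T} us G → length G ≤ e → length (learn D us []) ≤ e →
      Runs c fr (ms [] x (learn D us T) [] [] [] [] [] [] []) t →
      Runs (finishRound c) fr (ms [] x T G (learn D us []) [] [] [] [] []) (e * 3 + (3 + (e * 4 + (3 + (e * 4 + (3 + t))))))
    run-finishRound {c = c} {fr} {t} {T} us G G≤ Λ≤ K =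
      run-transfer {W = λ a (s : ⊤) → ms [] x T a Λ [] [] [] [] []} (λ _ → slot (λ _ → refl) (λ _ _ → refl)) discard (λ s _ → s) 0 id G tt e G≤
      (run-transfer {W = λ a s → ms [] x T [] a s [] [] [] []} (λ _ → slot (λ _ → refl) (λ _ _ → refl)) (moveTo jT) (flip _∷_) 1 push! Λ [] e Λ≤
      (run-transfer {W = λ a s → ms [] x s [] [] a [] [] [] []} (λ _ → slot (λ _ → refl) (λ _ _ → refl)) (moveTo jK) (flip _∷_) 1 push! (Λ ʳ++ []) T e
        (≤-trans (≤-reflexive (length-reverse Λ)) Λ≤)
      (subst (λ κ → Runs c fr (ms [] x κ [] [] [] [] [] [] []) t) (sym (trans (ʳ++-ʳ++ Λ) (learn-++ us [] T))) K)))
      where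
      Λ = learn D us []

    -- All oracles agreeing with `T` are included because the second call of a round reports
    -- rejecting lazy runs, whose guesses need not be the answers of `D`.
    RejBound : ℕ → List Bool → Set
    RejBound r T = ∀ D′ us → Agree D′ T → Path D′ c₀ us rej → unknown T us < r

    wanted-rej : ∀ o → wanted false o ≡ true → o ≡ rej
    wanted-rej rej _ = refl
    wanted-rej acc ()
    wanted-rej unk ()

    wanted-acc : ∀ o → wanted true o ≡ true → o ≡ acc
    wanted-acc acc _ = refl
    wanted-acc rej ()
    wanted-acc unk ()

    -- Learning may shadow an entry of `T`, but only with the answer of `D`, which by `Agree D T` is
    -- the same; so agreement with the larger table implies agreement with `T`.
    agree-learnt : ∀ {D′} us {T} → Agree D T → Agree D′ (learn D us T) → Agree D′ T
    agree-learnt {D′} us {T} ag ag′ w b eq with find (learn D us T) (reverse w) in eq′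
    ... | nothing = contradiction (trans (sym (learn-⊑ us w eq′)) eq) λ ()
    ... | just b′ = trans (ag′ w b′ eq′) (trans (sym (learn-agree us ag w b′ eq′)) (ag w b eq))

    entries-short : ∀ {T E o} → Agree D T → Lazy T c₀ E o → length (entries (keys E)) ≤ e
    entries-short {E = E} ag l = ≤-trans (≤-trans (m≤m+n _ 1) (≤-reflexive (sym (trans (cong length (emission-entries E)) (length-++ (entries (keys E)))))))
      (emission-short ag l)

    run-round : ∀ T → Agree D T → length T ≤ tableBound n → ∀ rest →
      (∀ {E E′} → Lazy T c₀ E acc → Lazy T c₀ E′ rej → Runs rounds nil (ms [] x (learn D (keys E) T) [] [] [] [] [] [] []) rest) →
      Runs rounds nil (ms [] x T [] [] [] [] [] [] []) (roundTime n rest)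
    run-round T ag T≤ rest K = iter! (run-call-here true T [] z≤n T≤ after-acc)
      where
      after-rej : Certified true T c₀ [] → ∀ b → A (input false x T []) ≡ b →
        Runs (afterRej b) (frm finite-⊤ finite-⊥ (λ _ → call true afterAcc) ⊥-elim nil) (ms [] x T [] [] [] [] [] [] [])
          (1 + (suc e * bitTime n + (e * 3 + (3 + (e * 4 + (3 + (e * 4 + (3 + (1 + rest)))))))))
      -- A rejecting path under `D` would be a lazy run over `T`, as `D` agrees with `T`, and the
      -- empty prescription admits every emission; the call would have answered yes.
      after-rej g false eq = halt!
        ( (λ { _ (us , path) → let E , l = path⇒lazy {T = T} path ag in
                 contradiction (trans (sym eq) (recognised {false} {T} {[]} (E , rej , l , refl , prefix-emits [] (emission E)))) λ () })
        , (λ ()) )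
      after-rej g true eq = let E′ , o′ , l′ , w′ , _ = certified {false} eq in
        mono (n≤1+n _) (run-build ag T≤
          (λ us G G≡ g′ → finished us G G≡ g′ (subst (Lazy T c₀ E′) (wanted-rej o′ w′) l′))
          (suc e) entryStart [] [] [] refl g (n<1+n e))
        where
        finished : ∀ us G → reverse G ≡ entries us ++ false ∷ [] → Certified true T c₀ (reverse G) → ∀ {E′} → Lazy T c₀ E′ rej →
          Runs (finishRound (ret (inj₁ tt))) (frm finite-⊤ finite-⊥ (λ _ → call true afterAcc) ⊥-elim nil)
            (ms [] x T G (learn D us []) [] [] [] [] []) (e * 3 + (3 + (e * 4 + (3 + (e * 4 + (3 + (1 + rest)))))))
        finished us G G≡ g′ lr =
          -- The prefix found contains the end mark, so the queries of the certifying accepting run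
          -- are exactly `us`; this bounds the length of the new entries and identifies what has
          -- been learnt.
          let E , o , l , w , r , em = certified-prefix g′
              us≡ : keys E ≡ us
              us≡ = complete-keys us (keys E) (trans (sym (emission-entries E)) (trans em (cong (_++ r) G≡)))
              la = subst (Lazy T c₀ E) (wanted-acc o w) l
          in run-finishRound us G
               (≤-trans (≤-reflexive (sym (length-reverse G))) (certified-short ag g′))
               (≤-trans (≤-reflexive (trans (length-learn us []) (cong (length ∘ entries) (sym us≡)))) (entries-short ag l))
               (again! (subst (λ us → Runs rounds nil (ms [] x (learn D us T) [] [] [] [] [] [] []) rest) us≡ (K la lr)))

      after-acc : ∀ b → A (input true x T []) ≡ b →
        Runs (afterAcc b) (frm finite-⊤ finite-⊥ (λ _ → call true afterAcc) ⊥-elim nil) (ms [] x T [] [] [] [] [] [] [])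
          (1 + (callTime n + (1 + (suc e * bitTime n + (e * 3 + (3 + (e * 4 + (3 + (e * 4 + (3 + (1 + rest)))))))))))
      after-acc false eq = halt!
        ( (λ ())
        , (λ { _ (us , path) → let E , l = path⇒lazy {T = T} path ag in
                 contradiction (trans (sym eq) (recognised {true} {T} {[]} (E , acc , l , refl , prefix-emits [] (emission E)))) λ () }) )
      after-acc true eq = mono (n≤1+n _) (run-call-here false T [] z≤n T≤ (after-rej (certified eq)))

    run-rounds : ∀ r T → Agree D T → RejBound r T → length T + r * e ≤ tableBound n →
                 Runs rounds nil (ms [] x T [] [] [] [] [] [] []) (roundsTime n r)
    -- With `r` equal to zero this round must halt: a rejecting lazy run would be a path under
    -- `patch E′ D`, an oracle agreeing with `T`, and would have fewer than zero unknown queries.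
    run-rounds zero T ag bound T≤ = run-round T ag (m+n≤o⇒m≤o _ T≤) 0 λ {E} {E′} la lr →
      let D′ = patch E′ D
          ag′ = patch-agree {T = T} lr ag
          us , path = lazy⇒path lr ag′ (patch-answers D lr)
      in ⊥-elim (n≮0 (bound D′ us ag′ path))
    run-rounds (suc r) T ag bound T≤ = run-round T ag (m+n≤o⇒m≤o _ T≤) (roundsTime n r) λ {E} la lr →
      run-rounds r (learn D (keys E) T) (learn-agree (keys E) ag)
        (λ D′ us ag′ path →
          let ag″ = agree-learnt (keys E) ag ag′
              -- The common query `u` was unknown to `T` and has been learnt in this round, so the
              -- count drops on every rejecting path under an agreeing oracle.
              u , u∈us , u∈E = conflict (λ D → under D x) la ag″ path
              b , lk≡ = learn-knows {D} (keys E) {T} u∈E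
          in <-≤-trans (unknown-strict us (learn-⊑ {D} (keys E)) u∈us (All.lookup (lazy-fresh la) u∈E) lk≡)
               (s≤s⁻¹ (bound D′ us ag″ path)))
        (≤-trans (≤-reflexive (trans (cong (_+ r * e) (length-learn {D} (keys E) T)) (+-assoc (length T) _ _)))
          (≤-trans (+-monoʳ-≤ (length T) (+-monoˡ-≤ (r * e) (entries-short ag la))) T≤))

    run-searcher : Runs searcher nil (ms (x ʳ++ []) [] [] [] [] [] [] [] [] []) (n * 4 + (3 + roundsTime n (suc (p n))))
    run-searcher = run-transfer {W = λ a s → ms a s [] [] [] [] [] [] [] []} (λ _ → slot (λ _ → refl) (λ _ _ → refl))
        (moveTo jX) (flip _∷_) 1 push! (x ʳ++ []) [] n (≤-reflexive (length-reverse x))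
        (subst (λ y → Runs rounds nil (ms [] y [] [] [] [] [] [] [] []) (roundsTime n (suc (p n)))) (sym (reverse-involutive x))
          (run-rounds (suc (p n)) [] (λ _ _ ())
            (λ D′ us _ path → s≤s (≤-trans (unknown≤ [] us) (path-length (proj₂ nptm D′ x) path)))
            ≤-refl))

  searchTime : ℕ → ℕ
  searchTime n = n * 4 + (3 + roundsTime n (suc (p n)))

  poly-searchTime : IsPoly searchTime
  poly-searchTime = poly-cong (λ n → cong (λ t → n * 4 + (3 + t)) (roundsTime-≡ n (suc (p n))))
      (poly-id *ᵖ poly-const 4 +ᵖ (poly-const 3 +ᵖ (poly-const 2 +ᵖ poly-p) *ᵖ poly-round))
    where
    poly-p : IsPoly p
    poly-p = poly-evalP (proj₁ nptm)
    poly-emission : IsPoly emissionBound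
    poly-emission = poly-p *ᵖ (poly-p *ᵖ poly-const 2 +ᵖ poly-const 2) +ᵖ poly-const 1
    poly-table : IsPoly tableBound
    poly-table = (poly-const 1 +ᵖ poly-p) *ᵖ poly-emission
    poly-input : IsPoly inputBound
    poly-input = poly-const 1 +ᵖ ((poly-id *ᵖ poly-const 2 +ᵖ poly-const 1) +ᵖ
                   ((poly-table *ᵖ poly-const 2 +ᵖ poly-const 1) +ᵖ (poly-const 1 +ᵖ poly-emission)))
    poly-decision : IsPoly decisionTime
    poly-decision = poly-∘ (poly-evalP p₀) poly-input
    poly-call : IsPoly callTime
    poly-call = (poly-const 1 +ᵖ poly-emission) *ᵖ poly-const 10 +ᵖ poly-table *ᵖ poly-const 12 +ᵖ poly-id *ᵖ poly-const 12
                +ᵖ poly-decision *ᵖ poly-const 10 +ᵖ (poly-input +ᵖ poly-decision) *ᵖ poly-const 24 +ᵖ poly-const 38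
    poly-bit : IsPoly bitTime
    poly-bit = poly-call +ᵖ (poly-emission *ᵖ poly-const 3 +ᵖ poly-const 10)
    poly-round : IsPoly roundCost
    poly-round = poly-call *ᵖ poly-const 2 +ᵖ (poly-const 1 +ᵖ poly-emission) *ᵖ poly-bit
                 +ᵖ poly-emission *ᵖ poly-const 11 +ᵖ poly-const 13

-- The two inclusions between the reducibilities

module Backward {A B : Lang} (N : NOTM) (nptm : IsNPTM N) (under : RobustlyUnderproductive N) (over : Overproductive N B)
         (accepts : AcceptsL N B A) (P₀ : DOTM) (p₀ : Poly) (decides : DecidesWith P₀ p₀ ∅ (Recognises.language N nptm)) where
  open Certificates bitTables N
  open Searching N nptm P₀ p₀ (Recognises.language N nptm) decides
  open Correctness under (Recognises.sound N nptm) (Recognises.complete N nptm)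

  right-output : ∀ x o → Right B x o → o ≡ A x
  right-output x true (noRej , _) = sym (Equivalence.from (accepts x) (acc-yielded (over x)))
    where
    acc-yielded : OverprodAt N B x → acc ∈out N ^ B [ x ]
    acc-yielded (inj₁ y) = y
    acc-yielded (inj₂ y) = contradiction (path y) (noRej refl)
  right-output x false (_ , noAcc) = rejected (A x) refl
    where
    rejected : ∀ b → A x ≡ b → false ≡ b
    rejected false eq = refl
    rejected true  eq = contradiction (path (Equivalence.to (accepts x) eq)) (noAcc refl)

  deterministic : A ≤pT B
  deterministic = Program.reduces searcher poly-searchTime Right
    (λ D x → Rules.unpack (run-searcher D x)) right-output

backward : P≡NP → ∀ {A B} → A ≤UT B → A ≤pT B
backward P=NP (N , nptm , under , over , accepts) =
  let P₀ , p₀ , decides = Equivalence.from (P=NP (Recognises.language N nptm)) (Recognises.inNP N nptm)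
  in Backward.deterministic N nptm under over accepts P₀ p₀ decides

module Forward (M : DOTM) where
  open DOTM M

  verdict : Bool → Outcome
  verdict true  = acc
  verdict false = rej

  embed : Action nst Bool → Action nst Outcome
  embed (move q w₁ w₂ d₁ d₂) = move q w₁ w₂ d₁ d₂
  embed (ask qy qn)          = ask qy qn
  embed (halt b)             = halt (verdict b)

  machine : NOTM
  machine = record { nst = nst ; start = start ; δ = λ q s₁ s₂ → embed (δ q s₁ s₂) ∷ [] }

  module _ (D : Lang) where

    stepM : Config nst → Config nst ⊎ Bool
    stepM c = stepAct D c (δ (Config.state c) (scan (Config.tape₁ c)) (scan (Config.tape₂ c)))

    stepN : Config nst → Config nst ⊎ Outcome
    stepN c = stepAct D c (embed (δ (Config.state c) (scan (Config.tape₁ c)) (scan (Config.tape₂ c))))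

    Corresponds : Config nst ⊎ Bool → Config nst ⊎ Outcome → Set
    Corresponds (inj₁ c) s = s ≡ inj₁ c
    Corresponds (inj₂ b) s = s ≡ inj₂ (verdict b)

    corresponds : ∀ c → Corresponds (stepM c) (stepN c)
    corresponds c with δ (Config.state c) (scan (Config.tape₁ c)) (scan (Config.tape₂ c))
    ... | move _ _ _ _ _ = refl
    ... | ask _ _        = refl
    ... | halt _         = refl

    runs-within : ∀ t c {b} → runD M D c t ≡ just b → HaltsWithin machine D c t
    runs-within (suc t) c eq with stepM c | corresponds c
    ... | inj₁ c′ | s = hw (λ ()) (subst (NextHalts machine D t) (sym s) (cont (runs-within t c′ eq)) ∷ [])
    ... | inj₂ b  | s = hw (λ ()) (subst (NextHalts machine D t) (sym s) done ∷ [])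

    run-yields : ∀ t c {b} → runD M D c t ≡ just b → Yields machine D c (verdict b)
    run-yields (suc t) c eq with stepM c | corresponds c
    run-yields (suc t) c eq   | inj₁ c′ | s = there (∈-here refl) s (run-yields t c′ eq)
    run-yields (suc t) c refl | inj₂ b  | s = here (∈-here refl) s

    yields-run : ∀ t c {b o} → runD M D c t ≡ just b → Yields machine D c o → o ≡ verdict b
    yields-run (suc t) c eq   y                       with stepM c | corresponds c
    yields-run (suc t) c eq   (here (∈-here refl) e)    | inj₁ c′ | s = contradiction (trans (sym s) e) λ ()
    yields-run (suc t) c eq   (there (∈-here refl) e y) | inj₁ c′ | s with refl ← trans (sym s) e = yields-run t c′ eq y
    yields-run (suc t) c refl (here (∈-here refl) e)    | inj₂ b  | s with refl ← trans (sym s) e = refl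
    yields-run (suc t) c refl (there (∈-here refl) e y) | inj₂ b  | s = contradiction (trans (sym s) e) λ ()

-- A deterministic machine has a single path, which under every oracle ends in `acc` or `rej`: never
-- in both, whence robust underproductivity, and never in `unk`, whence overproductivity.
forward : ∀ {A B} → A ≤pT B → A ≤UT B
forward {A} {B} (M , p , halts , decides) =
  machine , (p , λ D x → runs-within D _ _ (proj₂ (halts D x))) , under , over , accepts
  where
  open Forward M
  under : RobustlyUnderproductive machine
  under D x (ya , yr) = contradiction
    (trans (yields-run D (evalP p (length x)) _ (proj₂ (halts D x)) ya) (sym (yields-run D (evalP p (length x)) _ (proj₂ (halts D x)) yr))) λ ()
  yielded : ∀ x → Yields machine B (initN machine x) (verdict (A x))
  yielded x = run-yields B (evalP p (length x)) _ (decides x)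
  over : Overproductive machine B
  over x with A x | yielded x
  ... | true  | y = inj₁ y
  ... | false | y = inj₂ y
  accepts : AcceptsL machine B A
  accepts x = mk⇔ (λ eq → subst (λ b → Yields machine B (initN machine x) (verdict b)) eq (yielded x))
                  (λ y → accepted (A x) (yields-run B (evalP p (length x)) _ (decides x) y))
    where
    accepted : ∀ b → acc ≡ verdict b → b ≡ true
    accepted true  _  = refl
    accepted false ()

theorem4p10 : ¬ ≤UT≡≤pT → ¬ P≡NP
theorem4p10 distinct P=NP = distinct λ A B → mk⇔ (backward P=NP) forward
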